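{- Let $n$ be a positive integer that is neither a power of $2$ nor a prime. Then there is a transitive avoidance game on $n$ points that is a Player I win.
   Context: An avoidance game consists of a finite set $X$ (the board) and a family $\mathcal{L}$ of subsets of $X$ (the lines). Two players, Player I and Player II, alternately claim previously unclaimed points of $X$, Player I moving first. The first player to have claimed all points of some line loses; if all points have been claimed and neither player has completed a line, the game is a draw. The game is transitive if its automorphism group (the group of permutations of $X$ mapping $\mathcal{L}$ onto $\mathcal{L}$) acts transitively on $X$. The game is a Player I win if Player I has a strategy guaranteeing that Player II loses (with perfect play). -}

module Defs where

open import Data.Nat using (ℕ)
open import Data.Bool using (Bool; true)
open import Data.Fin using (Fin)
open import Data.Fin.Subset using (Subset; _∈_; _∉_; _⊆_; _∪_; ⁅_⁆; ⊥)
open import Data.Fin.Permutation using (Permutation′; _⟨$⟩ʳ_; _⟨$⟩ˡ_)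
open import Data.Vec using (lookup; tabulate)
open import Data.Product using (Σ; ∃; _×_)
open import Data.Sum using (_⊎_)
open import Function.Bundles using (_⇔_)
open import Relation.Binary.PropositionalEquality using (_≡_)
open import Relation.Nullary using (¬_)

-- An avoidance game on the board X = Fin n: the family of lines is given
-- by its (decidable) membership predicate on subsets of the board.
Lines : ℕ → Set
Lines n = Subset n → Bool

image : ∀ {n} → Permutation′ n → Subset n → Subset n
image σ S = tabulate (λ y → lookup S (σ ⟨$⟩ˡ y))

IsAutomorphism : ∀ {n} → Lines n → Permutation′ n → Set
IsAutomorphism {n} ℒ σ = ∀ (L : Subset n) → (ℒ L ≡ true) ⇔ (ℒ (image σ L) ≡ true)

IsTransitive : ∀ {n} → Lines n → Set
IsTransitive {n} ℒ = ∀ (x y : Fin n) →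
  Σ (Permutation′ n) (λ σ → IsAutomorphism ℒ σ × (σ ⟨$⟩ʳ x ≡ y))

ContainsLine : ∀ {n} → Lines n → Subset n → Set
ContainsLine {n} ℒ S = Σ (Subset n) (λ L → (ℒ L ≡ true) × (L ⊆ S))

-- Positions: A = points claimed by Player I, B = points claimed by Player II
-- (neither has completed a line so far).
-- WinI ℒ A B : Player I is to move and can force that Player II loses.
-- WinII ℒ A B : Player II is to move and Player I can force that Player II loses.
-- A player who completes a line with their move loses immediately; if no
-- unclaimed point remains the game is a draw (so WinII requires a move to exist).
-- Being inductive, these describe finite strategy trees.
mutual
  data WinI {n} (ℒ : Lines n) (A B : Subset n) : Set where
    move : (x : Fin n) → x ∉ A → x ∉ B →
           ¬ ContainsLine ℒ (A ∪ ⁅ x ⁆) →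
           WinII ℒ (A ∪ ⁅ x ⁆) B → WinI ℒ A B

  data WinII {n} (ℒ : Lines n) (A B : Subset n) : Set where
    respond : Σ (Fin n) (λ x → x ∉ A × x ∉ B) →
              (∀ (x : Fin n) → x ∉ A → x ∉ B →
                 ContainsLine ℒ (B ∪ ⁅ x ⁆) ⊎ WinI ℒ A (B ∪ ⁅ x ⁆)) →
              WinII ℒ A B

PlayerIWin : ∀ {n} → Lines n → Set
PlayerIWin ℒ = WinI ℒ ⊥ ⊥

{-# OPTIONS --safe #-}

-- In both constructions every line has the same size s: all sets of size s are lines except the
-- members of an invariant family N, and no two disjoint sets of size s both belong to N. So
-- Player I wins by making his first s points a member of N.
--
-- Odd boards (B blocks of m points, both odd): N asks for a majority in more than half of the
-- blocks. Player I opens new blocks as long as he needs them and otherwise always plays in a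
-- block where he leads without a majority, first of all in the one Player II has just entered.
--
-- Even boards (B = 2h + 1 blocks, each a cycle of length 2c with c a power of two): s is half of
-- the board, so the two final sets are complementary. The symmetries are the cyclic shift of the
-- blocks and the rotations of the blocks whose angles add up to 0 modulo 2c. None of them maps a
-- set with antipodal blocks (one point of each antipodal pair) to its complement, since that is
-- a rotation of each of the B blocks by c. Hence such sets can be divided evenly (N₃), by adding
-- up canonical positions of the blocks. Two kinds of asymmetry also put a set into N: an excess
-- of one point in some block and a deficit of one in one of its h cyclic successors (N₁); or,
-- with all blocks balanced, a block in which the first pair not split between the players,
-- counted from a pair that the other blocks determine, belongs to the set (N₂).
-- Player I keeps all but one of the unclaimed points in antipodal pairs, answering a point by
-- its antipode, unless taking the antipode of his own last unanswered point makes the set he is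
-- heading for a member of N₁ or N₂. He opens the blocks in order, so that Player II may enter at
-- most blocks that are not successors of the current one; once the last untouched block is
-- reached, N₁ confines Player II to the current block, and the order in which Player I opens the
-- pairs of that block turns every deviation into N₂.

module Submission where

open import Defs
open import Data.Bool using (Bool; true; false; not; _xor_; _∨_)
open import Data.Bool.Properties using (not-involutive; not-¬; not-distribʳ-xor; not-distribˡ-xor; xor-same; xor-assoc; xor-identityʳ)
open import Data.Empty using (⊥; ⊥-elim)
open import Data.Fin using (Fin; zero; suc; toℕ; fromℕ<)
import Data.Fin.Properties as Fin
open import Data.Fin.Permutation using (Permutation′; transpose; _⟨$⟩ʳ_; _⟨$⟩ˡ_)
open import Data.Fin.Subset using (Subset; _∉_; _⊆_; _∪_; ⁅_⁆) renaming (⊥ to ∅)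
open import Data.Fin.Subset.Properties using (x∈⁅x⁆; x≢y⇒x∉⁅y⁆; ∉⊥; x∈p∪q⁻; x∈p∪q⁺; ⊆-refl)
open import Data.Nat using (ℕ; zero; suc; _+_; _*_; _∸_; _^_; _≤_; _<_; z≤n; s≤s; z<s; _≤?_; _<?_; _≟_; pred; NonZero; >-nonZero; >-nonZero⁻¹; n>1⇒nonTrivial; nonTrivial⇒n>1)
open import Data.Nat.DivMod using (_/_; _%_; _mod_; m≡m%n+[m/n]*n; [m+n]%n≡m%n; m%n<n; %-distribˡ-+; m<n⇒m/n≡0; m<n⇒m%n≡m; n%n≡0; m*n%n≡0; m/n≡1+[m∸n]/n)
open import Data.Nat.Divisibility using (divides)
open import Data.Nat.Primality using (Prime; prime; composite; composite?)
open import Data.Nat.Properties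
open import Data.Nat.Solver using (module +-*-Solver)
open +-*-Solver using (solve; _:=_; _:+_; _:*_; con)
open import Data.Product using (Σ; ∃; _×_; _,_; proj₁; proj₂)
open import Data.Product.Function.NonDependent.Propositional using (_×-↔_)
open import Data.Sum using (_⊎_; inj₁; inj₂; [_,_]′)
open import Data.Vec using (lookup)
open import Data.Vec.Properties using (lookup∘tabulate; []=⇒lookup; lookup⇒[]=)
open import Function using (_∘_; id)
open import Function.Bundles using (_↔_; Inverse; mk↔ₛ′; mk⇔)
open import Function.Construct.Composition using (_↔-∘_)
open import Function.Construct.Symmetry using (↔-sym)
open import Function.Construct.Identity using (↔-id)
open import Relation.Binary.Definitions using (DecidableEquality; tri<; tri≈; tri>)
open import Relation.Binary.PropositionalEquality
open import Relation.Nullary using (¬_; Dec; yes; no; does; ¬?; _×-dec_; _⊎-dec_; _→-dec_; map′)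
open import Relation.Nullary.Decidable using (dec-true; dec-false; decidable-stable)
open import Algebra.Properties.CommutativeMonoid.Sum +-0-commutativeMonoid

-- Sums over finite index sets

⟦_⟧ : Bool → ℕ
⟦ false ⟧ = 0
⟦ true ⟧ = 1

sum-mono : ∀ {n} {f g : Fin n → ℕ} → (∀ i → f i ≤ g i) → sum f ≤ sum g
sum-mono {zero} _ = z≤n
sum-mono {suc n} f≤g = +-mono-≤ (f≤g zero) (sum-mono (f≤g ∘ suc))

-- One strict inequality between entries would make the sums strictly ordered as well.
sum-mono-≡ : ∀ {n} {f g : Fin n → ℕ} → (∀ i → f i ≤ g i) → sum g ≤ sum f → ∀ i → f i ≡ g i
sum-mono-≡ {suc n} {f} {g} f≤g Σg≤Σf = λ
  { zero → ≤-antisym (f≤g zero) (+-cancelʳ-≤ (sum (g ∘ suc)) _ _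
      (≤-trans Σg≤Σf (+-monoʳ-≤ (f zero) (sum-mono (f≤g ∘ suc)))))
  ; (suc i) → sum-mono-≡ (f≤g ∘ suc) (+-cancelˡ-≤ (g zero) _ _
      (≤-trans Σg≤Σf (+-monoˡ-≤ _ (f≤g zero)))) i }

-- The change at `i` is an equation with `x` and `y` added to the two sides, so that increases and
-- decreases are covered without truncated subtraction.
sum-exchange : ∀ {n} {f g : Fin n → ℕ} {x y} i → (∀ j → j ≢ i → g j ≡ f j) →
               g i + x ≡ f i + y → sum g + x ≡ sum f + y
sum-exchange {suc n} {f} {g} {x} {y} zero same eq = begin
  g zero + sum (g ∘ suc) + x    ≡⟨ solve 3 (λ a b c → a :+ b :+ c := a :+ c :+ b) refl (g zero) _ x ⟩
  g zero + x + sum (g ∘ suc)    ≡⟨ cong₂ _+_ eq (sum-cong-≗ (λ j → same (suc j) λ ())) ⟩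
  f zero + y + sum (f ∘ suc)    ≡⟨ solve 3 (λ a b c → a :+ b :+ c := a :+ c :+ b) refl (f zero) y _ ⟩
  f zero + sum (f ∘ suc) + y    ∎
  where open ≡-Reasoning
sum-exchange {suc n} {f} {g} {x} {y} (suc i) same eq = begin
  g zero + sum (g ∘ suc) + x    ≡⟨ +-assoc (g zero) _ x ⟩
  g zero + (sum (g ∘ suc) + x)  ≡⟨ cong₂ _+_ (same zero λ ()) (sum-exchange i (λ j j≢i → same (suc j) λ { refl → j≢i refl }) eq) ⟩
  f zero + (sum (f ∘ suc) + y)  ≡⟨ +-assoc (f zero) _ y ⟨
  f zero + sum (f ∘ suc) + y    ∎
  where open ≡-Reasoning

sum-suc : ∀ {n} {f g : Fin n → ℕ} i → (∀ j → j ≢ i → g j ≡ f j) → g i ≡ suc (f i) → sum g ≡ suc (sum f)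
sum-suc {f = f} {g} i same eq = begin
  sum g      ≡⟨ +-identityʳ _ ⟨
  sum g + 0  ≡⟨ sum-exchange i same (trans (+-identityʳ (g i)) (trans eq (+-comm 1 (f i)))) ⟩
  sum f + 1  ≡⟨ +-comm _ 1 ⟩
  suc (sum f) ∎
  where open ≡-Reasoning

sum-positive : ∀ {n} {f : Fin n → ℕ} → 1 ≤ sum f → ∃ λ i → 1 ≤ f i
sum-positive {suc n} {f} 1≤Σ with f zero in eq
... | suc k = zero , subst (1 ≤_) (sym eq) (s≤s z≤n)
... | zero with sum-positive {f = f ∘ suc} 1≤Σ
...   | i , 1≤fi = suc i , 1≤fi

sum-const : ∀ n {x} {f : Fin n → ℕ} → (∀ i → f i ≡ x) → sum f ≡ n Data.Nat.* x
sum-const zero    _  = refl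
sum-const (suc n) eq = cong₂ _+_ (eq zero) (sum-const n (eq ∘ suc))

does-true : ∀ {P : Set} (P? : Dec P) → does P? ≡ true → P
does-true (yes p) _ = p

-- Positions on a board and the numbers of their cells

data Cell : Set where
  free mine his : Cell

isMine isHis isFree : Cell → Bool
isMine mine = true
isMine _    = false
isHis his   = true
isHis _     = false
isFree free = true
isFree _    = false

module Board {X : Set} {n : ℕ} (board : Fin n ↔ X) where

  point : Fin n → X
  point = Inverse.to board

  index : X → Fin n
  index = Inverse.from board

  point∘index : ∀ x → point (index x) ≡ x
  point∘index x = Inverse.inverseˡ board refl

  index∘point : ∀ i → index (point i) ≡ i
  index∘point i = Inverse.inverseʳ board refl

  point-injective : ∀ {i j} → point i ≡ point j → i ≡ j
  point-injective {i} {j} eq = trans (sym (index∘point i)) (trans (cong index eq) (index∘point j))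

  infix 4 _≟ˣ_
  _≟ˣ_ : DecidableEquality X
  x ≟ˣ y = map′ (λ eq → trans (sym (point∘index x)) (trans (cong point eq) (point∘index y)))
                (cong index) (index x Fin.≟ index y)

  Position : Set
  Position = X → Cell

  infixl 10 _[_≔_]
  _[_≔_] : {C : Set} → (X → C) → X → C → X → C
  (p [ x ≔ c ]) y with y ≟ˣ x
  ... | yes _ = c
  ... | no  _ = p y

  ≔-same : ∀ {C : Set} (p : X → C) x {c} → (p [ x ≔ c ]) x ≡ c
  ≔-same p x with x ≟ˣ x
  ... | yes _  = refl
  ... | no x≢x = ⊥-elim (x≢x refl)

  ≔-other : ∀ {C : Set} (p : X → C) {x y c} → y ≢ x → (p [ x ≔ c ]) y ≡ p y
  ≔-other p {x} {y} y≢x with y ≟ˣ x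
  ... | yes y≡x = ⊥-elim (y≢x y≡x)
  ... | no _    = refl

  size : (X → Bool) → ℕ
  size F = sum (λ i → ⟦ F (point i) ⟧)

  size-cong : ∀ {F G} → F ≗ G → size F ≡ size G
  size-cong F≗G = sum-cong-≗ (λ i → cong ⟦_⟧ (F≗G (point i)))

  size-insert : ∀ {F G} x → F x ≡ false → G x ≡ true → (∀ y → y ≢ x → G y ≡ F y) → size G ≡ suc (size F)
  size-insert {F} {G} x Fx Gx same = sum-suc (index x)
    (λ j j≢ → cong ⟦_⟧ (same (point j) (λ eq → j≢ (trans (sym (index∘point j)) (cong index eq)))))
    (begin
      ⟦ G (point (index x)) ⟧ ≡⟨ cong (⟦_⟧ ∘ G) (point∘index x) ⟩
      ⟦ G x ⟧ ≡⟨ cong ⟦_⟧ Gx ⟩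
      1 ≡⟨ cong (suc ∘ ⟦_⟧) Fx ⟨
      suc ⟦ F x ⟧ ≡⟨ cong (suc ∘ ⟦_⟧ ∘ F) (point∘index x) ⟨
      suc ⟦ F (point (index x)) ⟧ ∎)
    where open ≡-Reasoning

  size-mine : ∀ p x → p x ≡ free → size (isMine ∘ p [ x ≔ mine ]) ≡ suc (size (isMine ∘ p))
  size-mine p x px = size-insert x (cong isMine px) (cong isMine (≔-same p x))
    (λ y y≢x → cong isMine (≔-other p y≢x))

  size-mine-his : ∀ p x → p x ≡ free → size (isMine ∘ p [ x ≔ his ]) ≡ size (isMine ∘ p)
  size-mine-his p x px = size-cong lemma
    where
    lemma : isMine ∘ p [ x ≔ his ] ≗ isMine ∘ p
    lemma y with y ≟ˣ x
    ... | yes refl = sym (cong isMine px)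
    ... | no _     = refl

  size-his : ∀ p x → p x ≡ free → size (isHis ∘ p [ x ≔ his ]) ≡ suc (size (isHis ∘ p))
  size-his p x px = size-insert x (cong isHis px) (cong isHis (≔-same p x))
    (λ y y≢x → cong isHis (≔-other p y≢x))

  size-his-mine : ∀ p x → p x ≡ free → size (isHis ∘ p [ x ≔ mine ]) ≡ size (isHis ∘ p)
  size-his-mine p x px = size-cong lemma
    where
    lemma : isHis ∘ p [ x ≔ mine ] ≗ isHis ∘ p
    lemma y with y ≟ˣ x
    ... | yes refl = sym (cong isHis px)
    ... | no _     = refl

  size-total : ∀ p → size (isMine ∘ p) + size (isHis ∘ p) + size (isFree ∘ p) ≡ n
  size-total p = begin
    size (isMine ∘ p) + size (isHis ∘ p) + size (isFree ∘ p)
      ≡⟨ cong (_+ size (isFree ∘ p)) (∑-distrib-+ {n} _ _) ⟨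
    sum (λ i → ⟦ isMine (p (point i)) ⟧ + ⟦ isHis (p (point i)) ⟧) + size (isFree ∘ p)
      ≡⟨ ∑-distrib-+ {n} _ _ ⟨
    sum (λ i → ⟦ isMine (p (point i)) ⟧ + ⟦ isHis (p (point i)) ⟧ + ⟦ isFree (p (point i)) ⟧)
      ≡⟨ sum-const n (λ i → one (p (point i))) ⟩
    n * 1 ≡⟨ *-identityʳ n ⟩
    n ∎
    where
    open ≡-Reasoning
    one : ∀ c → ⟦ isMine c ⟧ + ⟦ isHis c ⟧ + ⟦ isFree c ⟧ ≡ 1
    one free = refl
    one mine = refl
    one his  = refl

  exists-free : ∀ p → size (isMine ∘ p) + size (isHis ∘ p) < n → ∃ λ x → p x ≡ free
  exists-free p <n with sum-positive {f = λ i → ⟦ isFree (p (point i)) ⟧}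
    (+-cancelˡ-≤ (size (isMine ∘ p) + size (isHis ∘ p)) _ _
      (subst₂ _≤_ (+-comm 1 _) (sym (size-total p)) <n))
  ... | i , 1≤ = point i , is-free (p (point i)) 1≤
    where
    is-free : ∀ c → 1 ≤ ⟦ isFree c ⟧ → c ≡ free
    is-free free _ = refl

  size-positive : ∀ {F} x → F x ≡ true → 1 ≤ size F
  size-positive {F} x Fx = subst (1 ≤_)
    (sym (size-insert {F [ x ≔ false ]} x (≔-same F x) Fx (λ y y≢x → sym (≔-other F y≢x)))) (s≤s z≤n)

  -- Handing `x` to Player II leaves a position in which `exists-free` finds a different point.
  other-free : ∀ p {x} → p x ≡ free → suc (size (isMine ∘ p) + size (isHis ∘ p)) < n → ∃ λ y → p y ≡ free × y ≢ x
  other-free p {x} px <n with exists-free (p [ x ≔ his ]) (subst (_< n)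
      (sym (trans (cong₂ _+_ (size-mine-his p x px) (size-his p x px)) (+-suc _ _))) <n)
  ... | y , qy with y ≟ˣ x
  ...   | no y≢x = y , qy , y≢x

  -- Once `x` is handed to Player II, `n` cells are claimed, so a second free point would exceed the
  -- board.
  free-unique : ∀ p {x y} → p x ≡ free → p y ≡ free → suc (size (isMine ∘ p) + size (isHis ∘ p)) ≡ n → y ≡ x
  free-unique p {x} {y} px py ≡n with y ≟ˣ x
  ... | yes y≡x = y≡x
  ... | no y≢x = ⊥-elim (<⇒≱ (+-monoʳ-< (size (isMine ∘ q) + size (isHis ∘ q)) (size-positive {isFree ∘ q} y (cong isFree qy)))
      (≤-reflexive (trans (size-total q) (trans (sym ≡n) (trans
        (sym (trans (cong₂ _+_ (size-mine-his p x px) (size-his p x px)) (+-suc _ _))) (sym (+-identityʳ _)))))))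
    where
    q = p [ x ≔ his ]
    qy = trans (≔-other p y≢x) py

  size-permute : ∀ (φ : X ↔ X) F → size (F ∘ Inverse.to φ) ≡ size F
  size-permute φ F = trans
    (sum-cong-≗ {n} λ i → cong (⟦_⟧ ∘ F) (sym (point∘index (Inverse.to φ (point i)))))
    (sym (sum-permute {n} {n} (λ i → ⟦ F (point i) ⟧) ((↔-sym board ↔-∘ φ) ↔-∘ board)))

  χ : Subset n → X → Bool
  χ S x = lookup S (index x)

  χ-point : ∀ S i → χ S (point i) ≡ lookup S i
  χ-point S i = cong (lookup S) (index∘point i)

  ∉⇒lookup : ∀ {S : Subset n} {i} → i ∉ S → lookup S i ≡ false
  ∉⇒lookup {S} {i} i∉S with lookup S i in eq
  ... | true  = ⊥-elim (i∉S (lookup⇒[]= i S eq))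
  ... | false = refl

  lookup⇒∉ : ∀ {S : Subset n} {i} → lookup S i ≡ false → i ∉ S
  lookup⇒∉ {S} {i} eq i∈S with trans (sym eq) ([]=⇒lookup i∈S)
  ... | ()

  lookup-insert-same : ∀ (S : Subset n) i → lookup (S ∪ ⁅ i ⁆) i ≡ true
  lookup-insert-same S i = []=⇒lookup (x∈p∪q⁺ {p = S} (inj₂ (x∈⁅x⁆ i)))

  lookup-insert-other : ∀ (S : Subset n) {i j} → j ≢ i → lookup (S ∪ ⁅ i ⁆) j ≡ lookup S j
  lookup-insert-other S {i} {j} j≢i with lookup S j in eq
  ... | true  = []=⇒lookup (x∈p∪q⁺ {p = S} (inj₁ (lookup⇒[]= j S eq)))
  ... | false = ∉⇒lookup {S ∪ ⁅ i ⁆} λ j∈ →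
    [ lookup⇒∉ {S} eq , x≢y⇒x∉⁅y⁆ j≢i ]′ (x∈p∪q⁻ S ⁅ i ⁆ j∈)

  ⊆⇒size-≤ : ∀ {L S : Subset n} → L ⊆ S → ∀ i → ⟦ χ L (point i) ⟧ ≤ ⟦ χ S (point i) ⟧
  ⊆⇒size-≤ {L} {S} L⊆S i rewrite χ-point L i | χ-point S i with lookup L i in eq
  ... | false = z≤n
  ... | true rewrite []=⇒lookup (L⊆S (lookup⇒[]= i L eq)) = ≤-refl

  -- Games whose lines all have one size, and winning strategies for them

  module Rules (s : ℕ) (N : (X → Bool) → Set) (N? : ∀ F → Dec (N F))
               (N-resp-≗ : ∀ {F G} → F ≗ G → N F → N G) where

    IsLine : Subset n → Set
    IsLine S = size (χ S) ≡ s × ¬ N (χ S)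

    isLine? : ∀ S → Dec (IsLine S)
    isLine? S = (size (χ S) ≟ s) ×-dec ¬? (N? (χ S))

    lines : Lines n
    lines S = does (isLine? S)

    noLine-small : ∀ {S} → size (χ S) < s → ¬ ContainsLine lines S
    noLine-small {S} small (L , line , L⊆S) = <⇒≱ small
      (subst (_≤ size (χ S)) (proj₁ (does-true (isLine? L) line)) (sum-mono (⊆⇒size-≤ L⊆S)))

    -- A line inside `S` has as many points as `S`, hence is `S` itself, and a member of `N` is not
    -- a line.
    noLine-N : ∀ {S} → size (χ S) ≡ s → N (χ S) → ¬ ContainsLine lines S
    noLine-N {S} sz NS (L , line , L⊆S) with does-true (isLine? L) line
    ... | szL , ¬NL = ¬NL (N-resp-≗ S≗L NS)
      where
      ⟦⟧-injective : ∀ {x y} → ⟦ x ⟧ ≡ ⟦ y ⟧ → y ≡ x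
      ⟦⟧-injective {false} {false} _ = refl
      ⟦⟧-injective {true}  {true}  _ = refl
      S≗L : χ S ≗ χ L
      S≗L x = subst (λ y → χ S y ≡ χ L y) (point∘index x) (⟦⟧-injective
        (sum-mono-≡ (⊆⇒size-≤ L⊆S) (≤-reflexive (trans sz (sym szL))) (index x)))

    isLine : ∀ {S} → size (χ S) ≡ s → ¬ N (χ S) → ContainsLine lines S
    isLine {S} sz ¬NS = S , dec-true (isLine? S) (sz , ¬NS) , ⊆-refl

    -- Inv t p holds when it is Player II's turn and Player I has claimed t points.
    record Strategy : Set₁ where
      field
        Inv   : ℕ → Position → Set
        first : Σ X λ x → Inv 1 ((λ _ → free) [ x ≔ mine ])
        open′ : ∀ {t p} → Inv t p → size (isMine ∘ p) ≡ t → suc (size (isHis ∘ p)) ≡ t → t ≤ s →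
                ∃ λ x → p x ≡ free
        reply : ∀ {t p} → Inv t p → size (isMine ∘ p) ≡ t → suc (size (isHis ∘ p)) ≡ t → t < s →
                ∀ x → p x ≡ free →
                ∃ λ y → (p [ x ≔ his ]) y ≡ free × Inv (suc t) (p [ x ≔ his ] [ y ≔ mine ])
        safe  : ∀ {p} → Inv s p → size (isMine ∘ p) ≡ s → suc (size (isHis ∘ p)) ≡ s → N (isMine ∘ p)
        fatal : ∀ {p} → Inv s p → size (isMine ∘ p) ≡ s → suc (size (isHis ∘ p)) ≡ s →
                ∀ x → p x ≡ free → ¬ N (isHis ∘ p [ x ≔ his ])

    module _ (strategy : Strategy) (1≤s : 1 ≤ s) where
      open Strategy strategy

      record Represents (is : Cell → Bool) (S : Subset n) (p : Position) : Set where
        constructor represents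
        field at : ∀ i → lookup S i ≡ is (p (point i))
      open Represents

      χ-represents : ∀ {is S p} → Represents is S p → χ S ≗ is ∘ p
      χ-represents {is} {S} {p} rep x = trans (at rep (index x)) (cong (is ∘ p) (point∘index x))

      insert : ∀ {is S p} c x → is c ≡ true → Represents is S p → Represents is (S ∪ ⁅ x ⁆) (p [ point x ≔ c ])
      insert {is} {S} {p} c x isc rep .at i with i Fin.≟ x
      ... | yes refl = trans (lookup-insert-same S i)
                         (sym (trans (cong is (≔-same p (point i))) isc))
      ... | no i≢x = trans (lookup-insert-other S i≢x) (trans (at rep i)
                         (cong is (sym (≔-other p (i≢x ∘ point-injective)))))

      keep : ∀ {is S p} c x → is c ≡ false → is (p (point x)) ≡ false → Represents is S p →
             Represents is S (p [ point x ≔ c ])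
      keep {is} {S} {p} c x isc isp rep .at i with i Fin.≟ x
      ... | yes refl = trans (at rep i) (trans isp (sym (trans (cong is (≔-same p (point i))) isc)))
      ... | no i≢x = trans (at rep i) (cong is (sym (≔-other p (i≢x ∘ point-injective))))

      unclaimed : ∀ {A B p} i → Represents isMine A p → Represents isHis B p → i ∉ A → i ∉ B → p (point i) ≡ free
      unclaimed {A} {B} {p} i repA repB i∉A i∉B
        with p (point i) | at repA i | at repB i
      ... | free | _ | _ = refl
      ... | mine | eq | _ = ⊥-elim (i∉A (lookup⇒[]= i A eq))
      ... | his  | _ | eq = ⊥-elim (i∉B (lookup⇒[]= i B eq))

      unclaimed-∉ : ∀ {is S p} i → is free ≡ false → Represents is S p → p (point i) ≡ free → i ∉ S
      unclaimed-∉ {is} {S} i isf rep eq = lookup⇒∉ {S} (trans (at rep i) (trans (cong is eq) isf))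

      free-at : ∀ {p : Position} {x} → p x ≡ free → p (point (index x)) ≡ free
      free-at {p} {x} eq = trans (cong p (point∘index x)) eq

      reposition : ∀ {p : Position} {x c} (P : Position → Set) → P (p [ x ≔ c ]) → P (p [ point (index x) ≔ c ])
      reposition {p} {x} {c} P = subst (λ y → P (p [ y ≔ c ])) (sym (point∘index x))

      noLine : ∀ {t A p} → Represents isMine A p → size (isMine ∘ p) ≡ t → suc (size (isHis ∘ p)) ≡ t →
               t ≤ s → Inv t p → ¬ ContainsLine lines A
      noLine {t} {A} {p} rep szA szB t≤s inv with m≤n⇒m<n∨m≡n t≤s
      ... | inj₁ t<s = noLine-small {A} (subst (_< s) (sym sz) t<s)
        where sz = trans (size-cong (χ-represents {isMine} rep)) szA
      ... | inj₂ refl = noLine-N {A} (trans (size-cong (χ-represents {isMine} rep)) szA)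
              (N-resp-≗ (λ i → sym (χ-represents {isMine} rep i)) (safe inv szA szB))

      -- Recursion on the number `r` of points that Player I still needs to reach `s`. Before that
      -- his set is too small to contain a line; at size `s` it lies in `N`. When `r` is 0, Player
      -- II has `s - 1` points, and whichever point he adds completes a line.
      winII : ∀ r t {A B p} → t + r ≡ s → Represents isMine A p → Represents isHis B p →
              size (isMine ∘ p) ≡ t → suc (size (isHis ∘ p)) ≡ t → Inv t p → WinII lines A B
      winII r t {A} {B} {p} t+r≡s repA repB szA szB inv =
        respond (index z , unclaimed-∉ _ refl repA (free-at {p} pz) , unclaimed-∉ _ refl repB (free-at {p} pz))
                (answer r t+r≡s)
        where
        t≤s : t ≤ s
        t≤s = subst (t ≤_) t+r≡s (m≤m+n t r)
        z = proj₁ (open′ inv szA szB t≤s)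
        pz = proj₂ (open′ inv szA szB t≤s)
        answer : ∀ r → t + r ≡ s → ∀ x → x ∉ A → x ∉ B →
                 ContainsLine lines (B ∪ ⁅ x ⁆) ⊎ WinI lines A (B ∪ ⁅ x ⁆)
        answer zero t+0≡s x x∉A x∉B with trans (sym (+-identityʳ t)) t+0≡s
        ... | refl = inj₁ (isLine {B ∪ ⁅ x ⁆}
            (trans (size-cong (χ-represents {isHis} rep′)) (trans (size-his p _ px) szB))
            (λ NB → fatal inv szA szB (point x) px (N-resp-≗ (χ-represents {isHis} rep′) NB)))
          where
          px = unclaimed x repA repB x∉A x∉B
          rep′ = insert {isHis} his x refl repB
        answer (suc r) t+r≡s x x∉A x∉B
          with unclaimed x repA repB x∉A x∉B
        ... | px with reply inv szA szB (subst (t <_) t+r≡s (m<m+n t (s≤s z≤n))) (point x) px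
        ... | y , qy , inv′ = inj₂ (move (index y)
                (unclaimed-∉ _ refl repA₁ (free-at {q} qy)) (unclaimed-∉ _ refl repB₁ (free-at {q} qy))
                (noLine repA₂ szA₂ szB₂ (subst (suc t ≤_) t+r≡s′ (m≤m+n (suc t) r)) inv₂)
                (winII r (suc t) t+r≡s′ repA₂ repB₂ szA₂ szB₂ inv₂))
          where
          q = p [ point x ≔ his ]
          qy′ = free-at {q} qy
          q₂ = q [ point (index y) ≔ mine ]
          inv₂ : Inv (suc t) q₂
          inv₂ = reposition {q} {y} {mine} (Inv (suc t)) inv′
          repA₁ : Represents isMine A q
          repA₁ = keep {isMine} his x refl (cong isMine px) repA
          repB₁ : Represents isHis (B ∪ ⁅ x ⁆) q
          repB₁ = insert {isHis} his x refl repB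
          repA₂ : Represents isMine (A ∪ ⁅ index y ⁆) q₂
          repA₂ = insert {isMine} mine (index y) refl repA₁
          repB₂ : Represents isHis (B ∪ ⁅ x ⁆) q₂
          repB₂ = keep {isHis} mine (index y) refl (cong isHis qy′) repB₁
          szA₂ = trans (size-mine q _ qy′) (cong suc (trans (size-mine-his p _ px) szA))
          szB₂ = cong suc (trans (size-his-mine q _ qy′) (trans (size-his p _ px) szB))
          t+r≡s′ = trans (sym (+-suc t r)) t+r≡s

      playerIWin : PlayerIWin lines
      playerIWin = move x ∉⊥ ∉⊥ (noLine repA szA szB 1≤s inv)
        (winII (s ∸ 1) 1 (m+[n∸m]≡n 1≤s) repA repB szA szB inv)
        where
        x₀ = proj₁ first
        x = index x₀
        p₀ : Position
        p₀ _ = free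
        p = p₀ [ point x ≔ mine ]
        inv : Inv 1 p
        inv = reposition {p₀} {x₀} {mine} (Inv 1) (proj₂ first)
        rep∅ : ∀ {is} → is free ≡ false → Represents is ∅ p₀
        rep∅ isf .at i = trans (∉⇒lookup {∅} ∉⊥) (sym isf)
        repA : Represents isMine (∅ ∪ ⁅ x ⁆) p
        repA = insert {isMine} {∅} {p₀} mine x refl (rep∅ {isMine} refl)
        repB : Represents isHis ∅ p
        repB = keep {isHis} {∅} {p₀} mine x refl refl (rep∅ {isHis} refl)
        sz0 : ∀ {is} → is free ≡ false → size (is ∘ p₀) ≡ 0
        sz0 isf = trans (sum-const n (λ i → cong ⟦_⟧ isf)) (*-zeroʳ n)
        szA : size (isMine ∘ p) ≡ 1
        szA = trans (size-mine p₀ (point x) refl) (cong suc (sz0 {isMine} refl))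
        szB : suc (size (isHis ∘ p)) ≡ 1
        szB = cong suc (trans (size-his-mine p₀ (point x) refl) (sz0 {isHis} refl))

    -- Symmetries of `N` and transitivity of the game

    -- Invariance is stored in both directions, so that inverting a symmetry only exchanges the
    -- fields.
    record Symmetry (φ : X ↔ X) : Set where
      constructor symmetry
      field
        forth : ∀ {F} → N F → N (F ∘ Inverse.from φ)
        back  : ∀ {F} → N F → N (F ∘ Inverse.to φ)
    open Symmetry

    infix 4 _∼_
    _∼_ : X → X → Set
    x ∼ y = Σ (X ↔ X) λ φ → Symmetry φ × Inverse.to φ x ≡ y

    ∼-refl : ∀ {x} → x ∼ x
    ∼-refl = ↔-id X , symmetry id id , refl

    ∼-sym : ∀ {x y} → x ∼ y → y ∼ x
    ∼-sym (φ , s , refl) = ↔-sym φ , symmetry (back s) (forth s) , Inverse.inverseʳ φ refl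

    ∼-trans : ∀ {x y z} → x ∼ y → y ∼ z → x ∼ z
    ∼-trans (φ , s , refl) (ψ , t , refl) =
      ψ ↔-∘ φ , symmetry (forth t ∘ forth s) (back s ∘ back t) , refl

    conjugate : X ↔ X → Permutation′ n
    conjugate φ = (↔-sym board ↔-∘ φ) ↔-∘ board

    χ-image : ∀ φ S → χ (image (conjugate φ) S) ≗ χ S ∘ Inverse.from φ
    χ-image φ S x = trans (lookup∘tabulate _ (index x))
      (cong (lookup S ∘ index ∘ Inverse.from φ) (point∘index x))

    automorphism : ∀ {φ} → Symmetry φ → IsAutomorphism lines (conjugate φ)
    automorphism {φ} sym-φ S = mk⇔
      (λ line → dec-true (isLine? S′) (to-image (does-true (isLine? S) line)))
      (λ line → dec-true (isLine? S) (from-image (does-true (isLine? S′) line)))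
      where
      size-image : size (χ (image (conjugate φ) S)) ≡ size (χ S)
      size-image = trans (size-cong (χ-image φ S)) (size-permute (↔-sym φ) (χ S))
      S′ = image (conjugate φ) S
      to-image : IsLine S → IsLine (image (conjugate φ) S)
      to-image (sz , ¬N) = trans size-image sz , λ N′ → ¬N (N-resp-≗
        (λ x → cong (χ S) (Inverse.inverseʳ φ refl))
        (back sym-φ (N-resp-≗ (χ-image φ S) N′)))
      from-image : IsLine (image (conjugate φ) S) → IsLine S
      from-image (sz , ¬N) = trans (sym size-image) sz ,
        λ N′ → ¬N (N-resp-≗ (λ x → sym (χ-image φ S x)) (forth sym-φ N′))

    transitive : (∀ x y → x ∼ y) → IsTransitive lines
    transitive ∼-all i j with ∼-all (point i) (point j)
    ... | φ , s , eq = conjugate φ , automorphism s , trans (cong index eq) (index∘point j)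

-- Boards of odd size

opened : ℕ → ℕ
opened zero    = 0
opened (suc _) = 1

untouched : ℕ → ℕ → ℕ
untouched zero zero = 1
untouched _    _    = 0

Increment : ∀ {B} → Fin B → (Fin B → ℕ) → (Fin B → ℕ) → Set
Increment k a a′ = a′ k ≡ suc (a k) × (∀ l → l ≢ k → a′ l ≡ a l)

increment-elim : ∀ {B} {k : Fin B} {a a′} (P : Fin B → ℕ → Set) → Increment k a a′ →
                 P k (suc (a k)) → (∀ l → l ≢ k → P l (a l)) → ∀ l → P l (a′ l)
increment-elim {k = k} P (at , other) Pk Pl l with l Fin.≟ k
... | yes refl = subst (P l) (sym at) Pk
... | no l≢k   = subst (P l) (sym (other l l≢k)) (Pl l l≢k)

module OddBoard (H q B m : ℕ) (2H≡ : H + H ≡ suc B) (2q≡ : q + q ≡ suc m)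
                (2≤H : 2 ≤ H) (2≤q : 2 ≤ q) (k₀ : Fin B) (x₀ : Fin m) where

  s : ℕ
  s = q * H

  -- With `H = 2 + h` and `q = 2 + r` the two sides differ by `1 + 2h + 2r + 2hr`. Hence the board
  -- is not exhausted before Player II has to claim his `s`-th point.
  capacity : s + s ≤ B * m
  capacity with m≤n⇒∃[o]m+o≡n 2≤H | m≤n⇒∃[o]m+o≡n 2≤q
  ... | h , refl | r , refl = subst₂ (λ x y → s + s ≤ x * y) (suc-injective 2H≡) (suc-injective 2q≡) (begin
      s + s
        ≤⟨ m≤m+n _ (1 + 2 * h + 2 * r + 2 * (h * r)) ⟩
      (2 + r) * (2 + h) + (2 + r) * (2 + h) + (1 + 2 * h + 2 * r + 2 * (h * r))
        ≡⟨ solve 2 (λ h r → (con 2 :+ r) :* (con 2 :+ h) :+ (con 2 :+ r) :* (con 2 :+ h)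
                              :+ (con 1 :+ con 2 :* h :+ con 2 :* r :+ con 2 :* (h :* r))
                            := (con 1 :+ h :+ (con 2 :+ h)) :* (con 1 :+ r :+ (con 2 :+ r))) refl h r ⟩
      (1 + h + (2 + h)) * (1 + r + (2 + r)) ∎)
    where
    open ≤-Reasoning

  X : Set
  X = Fin B × Fin m

  open Board {X} {B * m} (Fin.*↔× {B} {m})

  count : (X → Bool) → Fin B → ℕ
  count F k = sum (λ x → ⟦ F (k , x) ⟧)

  majority : ℕ → ℕ
  majority c = ⟦ does (q ≤? c) ⟧

  N : (X → Bool) → Set
  N F = H ≤ sum (majority ∘ count F)

  N-resp-≗ : ∀ {F G} → F ≗ G → N F → N G
  N-resp-≗ F≗G = subst (H ≤_)
    (sum-cong-≗ λ k → cong majority (sum-cong-≗ λ x → cong ⟦_⟧ (F≗G (k , x))))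

  open Rules s N (λ F → H ≤? _) (λ {F} {G} → N-resp-≗ {F} {G}) public

  N-permute : ∀ (π : Permutation′ B) (θ : Permutation′ m) {F} → N F → N (F ∘ Inverse.to (π ×-↔ θ))
  N-permute π θ {F} = subst (H ≤_) (trans (sum-permute (majority ∘ count F) π)
    (sum-cong-≗ {B} λ k → cong majority (sum-permute (λ x → ⟦ F (π ⟨$⟩ʳ k , x) ⟧) θ)))

  N-permute⁻¹ : ∀ (π : Permutation′ B) (θ : Permutation′ m) {F} → N F → N (F ∘ Inverse.from (π ×-↔ θ))
  N-permute⁻¹ π θ {F} = N-permute (Data.Fin.Permutation.flip π) (Data.Fin.Permutation.flip θ) {F}

  -- A transposition of blocks is combined with a transposition of positions that acts alike in
  -- every block.
  all-symmetric : ∀ x y → x ∼ y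
  all-symmetric (k , x) (l , y) = (π ×-↔ θ) ,
    symmetry (λ {F} → N-permute⁻¹ π θ {F}) (λ {F} → N-permute π θ {F}) ,
    cong₂ _,_ (transpose-here k l) (transpose-here x y)
    where
    π = transpose k l
    θ = transpose x y
    transpose-here : ∀ {n} (i j : Fin n) → transpose i j ⟨$⟩ʳ i ≡ j
    transpose-here i j with i Fin.≟ i
    ... | yes _  = refl
    ... | no i≢i = ⊥-elim (i≢i refl)

  -- Player I aims at a majority in H of the blocks; ν of them are still to be opened.
  record Counts (a b : Fin B → ℕ) : Set where
    field
      ν       : ℕ
      blocks  : sum (opened ∘ a) + ν ≡ H
      reserve : 2 * ν ≤ sum (λ k → untouched (a k) (b k))
      capped  : ∀ k → a k ≤ q
      lead    : ∀ k → a k ≡ 0 ⊎ a k ≡ q ⊎ b k < a k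

  Counts-cong : ∀ {a a′ b b′} → a ≗ a′ → b ≗ b′ → Counts a b → Counts a′ b′
  Counts-cong {a} {a′} {b} {b′} a≗ b≗ c = record
    { ν = ν
    ; blocks = trans (cong (_+ ν) (sum-cong-≗ λ k → cong opened (sym (a≗ k)))) blocks
    ; reserve = subst (2 * ν ≤_) (sum-cong-≗ λ k → cong₂ untouched (a≗ k) (b≗ k)) reserve
    ; capped = λ k → subst (_≤ q) (a≗ k) (capped k)
    ; lead = λ k → subst₂ (λ x y → x ≡ 0 ⊎ x ≡ q ⊎ y < x) (a≗ k) (b≗ k) (lead k)
    }
    where open Counts c

  -- Both numbers are below `q`, so they add up to at most `2q - 2 = m - 1`.
  room : ∀ {a b} → b ≤ a → a < q → a + b < m
  room {a} {b} b≤a a<q = ≤-pred (subst (suc (suc (a + b)) ≤_) 2q≡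
    (subst (_≤ q + q) (cong suc (+-suc a b)) (+-mono-≤ a<q (≤-<-trans b≤a a<q))))

  opened-≤ : ∀ c → c ≤ q → c ≤ q * opened c
  opened-≤ zero    _   = z≤n
  opened-≤ (suc c) c≤q = subst (suc c ≤_) (sym (*-identityʳ q)) c≤q

  sum-*ˡ : ∀ x {n} (f : Fin n → ℕ) → sum (λ i → x * f i) ≡ x * sum f
  sum-*ˡ x {zero}  f = sym (*-zeroʳ x)
  sum-*ˡ x {suc n} f = trans (cong (x * f zero +_) (sum-*ˡ x (f ∘ suc))) (sym (*-distribˡ-+ x (f zero) _))

  -- If Player II has entered a block where Player I leads without a majority, answering there
  -- restores the lead. Otherwise every lead survives his move, and Player I may open an untouched
  -- block while `ν` is positive, or else add to an unfinished one. The reserve of two untouched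
  -- blocks for each block still to be opened pays for one block spoilt by Player II and one opened
  -- by Player I.
  choose : ∀ {a b b′ j} → Counts a b → sum a < s → Increment j b b′ →
           ∃ λ k → a k + b′ k < m × (∀ {a′} → Increment k a a′ → Counts a′ b′)
  choose {a} {b} {b′} {j} c Σa<s incb@(b′j , b′-other) = go (1 ≤? a j) (a j <? q)
    where
    open Counts c
    Lead : Fin B → ℕ → Set
    Lead l x = x ≡ 0 ⊎ x ≡ q ⊎ b′ l < x

    advance : ∀ {k} → 1 ≤ a k → a k < q → b′ k ≤ a k → (∀ l → l ≢ k → Lead l (a l)) →
              2 * ν ≤ sum (λ k → untouched (a k) (b′ k)) →
              ∀ {a′} → Increment k a a′ → Counts a′ b′
    advance {k} 1≤ak ak<q b′k≤ak leads reserve′ {a′} inc = record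
      { ν = ν
      ; blocks = trans (cong (_+ ν) (sum-cong-≗ (increment-elim (λ l x → opened x ≡ opened (a l)) inc
          (same-opened 1≤ak) (λ _ _ → refl)))) blocks
      ; reserve = subst (2 * ν ≤_) (sum-cong-≗ (increment-elim (λ l x → untouched (a l) (b′ l) ≡ untouched x (b′ l)) inc
          (same-untouched 1≤ak) (λ _ _ → refl))) reserve′
      ; capped = increment-elim (λ _ x → x ≤ q) inc ak<q (λ l _ → capped l)
      ; lead = increment-elim Lead inc (inj₂ (inj₂ (s≤s b′k≤ak))) leads
      }
      where
      same-opened : ∀ {x} → 1 ≤ x → opened (suc x) ≡ opened x
      same-opened (s≤s _) = refl
      same-untouched : ∀ {x y} → 1 ≤ x → untouched x y ≡ untouched (suc x) y
      same-untouched (s≤s _) = refl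

    reserve-bound : 2 * ν ≤ suc (sum (λ l → untouched (a l) (b′ l)))
    reserve-bound = ≤-trans reserve (begin
      sum (λ l → untouched (a l) (b l))
        ≡⟨ +-identityʳ _ ⟨
      sum (λ l → untouched (a l) (b l)) + 0
        ≡⟨ sum-exchange j (λ l l≢j → cong (untouched (a l)) (b′-other l l≢j))
             (trans (cong (λ y → untouched (a j) y + untouched (a j) (b j)) b′j)
               (trans (cong (_+ untouched (a j) (b j)) (touched (a j))) (sym (+-identityʳ _)))) ⟨
      sum (λ l → untouched (a l) (b′ l)) + untouched (a j) (b j)
        ≤⟨ +-monoʳ-≤ _ (untouched-≤1 (a j) (b j)) ⟩
      sum (λ l → untouched (a l) (b′ l)) + 1
        ≡⟨ +-comm _ 1 ⟩
      suc (sum (λ l → untouched (a l) (b′ l))) ∎)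
      where
      open ≤-Reasoning
      touched : ∀ x {y} → untouched x (suc y) ≡ 0
      touched zero    = refl
      touched (suc _) = refl
      untouched-≤1 : ∀ x y → untouched x y ≤ 1
      untouched-≤1 zero    zero    = ≤-refl
      untouched-≤1 zero    (suc _) = z≤n
      untouched-≤1 (suc _) _       = z≤n

    -- With nothing left to open and no block strictly between 0 and `q`, each of the `H` opened
    -- blocks holds exactly `q` points of Player I.
    all-secured : ν ≡ 0 → ¬ (∃ λ k → 1 ≤ a k × a k < q) → s ≤ sum a
    all-secured refl none = ≤-reflexive (begin
      q * H             ≡⟨ cong (q *_) (trans (sym (+-identityʳ _)) blocks) ⟨
      q * sum (opened ∘ a)        ≡⟨ sum-*ˡ q (opened ∘ a) ⟨
      sum (λ k → q * opened (a k)) ≡⟨ sum-cong-≗ full ⟩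
      sum a                       ∎)
      where
      open ≡-Reasoning
      full : ∀ k → q * opened (a k) ≡ a k
      full k with a k in eq
      ... | zero = *-zeroʳ q
      ... | suc x = trans (*-identityʳ q) (≤-antisym
              (≮⇒≥ λ x<q → none (k , subst (1 ≤_) (sym eq) (s≤s z≤n) , subst (_< q) (sym eq) x<q))
              (subst (_≤ q) eq (capped k)))

    late : a j ≡ 0 ⊎ a j ≡ q ⊎ b′ j < a j → ∃ λ k → a k + b′ k < m × (∀ {a′} → Increment k a a′ → Counts a′ b′)
    late leadj = by-ν ν refl
      where
      leads : ∀ l → Lead l (a l)
      leads l with l Fin.≟ j
      ... | yes refl = leadj
      ... | no l≢j = subst (λ y → a l ≡ 0 ⊎ a l ≡ q ⊎ y < a l) (sym (b′-other l l≢j)) (lead l)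

      by-ν : ∀ ν′ → ν ≡ ν′ → ∃ λ k → a k + b′ k < m × (∀ {a′} → Increment k a a′ → Counts a′ b′)
      by-ν zero ν≡0 with Fin.any? (λ k → (1 ≤? a k) ×-dec (a k <? q))
      ... | no none = ⊥-elim (<⇒≱ Σa<s (all-secured ν≡0 none))
      ... | yes (k , 1≤ak , ak<q) with leads k
      ...   | inj₁ ak≡0 = ⊥-elim (<⇒≱ 1≤ak (≤-reflexive ak≡0))
      ...   | inj₂ (inj₁ ak≡q) = ⊥-elim (<-irrefl ak≡q ak<q)
      ...   | inj₂ (inj₂ b′k<ak) = k , room (<⇒≤ b′k<ak) ak<q ,
                advance 1≤ak ak<q (<⇒≤ b′k<ak) (λ l _ → leads l) (subst (λ x → 2 * x ≤ _) (sym ν≡0) z≤n)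
      by-ν (suc ν′) ν≡ with sum-positive {f = λ l → untouched (a l) (b′ l)} (≤-pred (≤-trans (s≤s (s≤s z≤n)) bound))
        where
        bound : suc (suc (2 * ν′)) ≤ suc (sum (λ l → untouched (a l) (b′ l)))
        bound = subst (_≤ suc (sum (λ l → untouched (a l) (b′ l)))) (trans (cong (2 *_) ν≡) (*-suc 2 ν′)) reserve-bound
      ... | k , new = k , subst₂ (λ x y → x + y < m) (sym ak≡0) (sym b′k≡0) (≤-<-trans z≤n (Fin.toℕ<n x₀)) , λ {a′} inc → record
          { ν = ν′
          ; blocks = trans (trans (cong (_+ ν′) (sum-suc k (λ l l≢k → cong opened (proj₂ inc l l≢k))
              (trans (cong opened (proj₁ inc)) (cong (suc ∘ opened) (sym ak≡0))))) (sym (+-suc _ ν′)))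
              (trans (cong (sum (opened ∘ a) +_) (sym ν≡)) blocks)
          ; reserve = ≤-pred (≤-pred (begin
              suc (suc (2 * ν′))    ≡⟨ trans (cong (2 *_) ν≡) (*-suc 2 ν′) ⟨
              2 * ν                 ≤⟨ reserve-bound ⟩
              suc (sum (λ l → untouched (a l) (b′ l)))
                ≡⟨ cong suc (sum-suc k (λ l l≢k → cong (λ x → untouched x (b′ l)) (sym (proj₂ inc l l≢k)))
                     (trans (cong₂ untouched ak≡0 b′k≡0) (cong (λ x → suc (untouched x (b′ k))) (sym (proj₁ inc))))) ⟩
              suc (suc (sum (λ l → untouched (a′ l) (b′ l)))) ∎))
          ; capped = increment-elim (λ _ x → x ≤ q) inc (subst (λ x → suc x ≤ q) (sym ak≡0) (<⇒≤ 2≤q)) (λ l _ → capped l)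
          ; lead = increment-elim Lead inc (inj₂ (inj₂ (subst (_< suc (a k)) (sym b′k≡0) (s≤s z≤n)))) (λ l _ → leads l)
          }
        where
        open ≤-Reasoning
        both-0 : ∀ x y → 1 ≤ untouched x y → x ≡ 0 × y ≡ 0
        both-0 zero zero _ = refl , refl
        ak≡0 = proj₁ (both-0 (a k) (b′ k) new)
        b′k≡0 = proj₂ (both-0 (a k) (b′ k) new)

    go : Dec (1 ≤ a j) → Dec (a j < q) → ∃ λ k → a k + b′ k < m × (∀ {a′} → Increment k a a′ → Counts a′ b′)
    go (yes 1≤aj) (yes aj<q) = j , room b′j≤aj aj<q , advance 1≤aj aj<q b′j≤aj
        (λ l l≢j → subst (λ y → a l ≡ 0 ⊎ a l ≡ q ⊎ y < a l) (sym (b′-other l l≢j)) (lead l))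
        (subst (2 * ν ≤_) (sum-cong-≗ (λ l → increment-elim
          (λ l y → untouched (a l) (b l) ≡ untouched (a l) y) incb (unaffected 1≤aj) (λ _ _ → refl) l)) reserve)
      where
      b′j≤aj : b′ j ≤ a j
      b′j≤aj with lead j
      ... | inj₁ aj≡0 = ⊥-elim (<⇒≱ 1≤aj (≤-reflexive aj≡0))
      ... | inj₂ (inj₁ aj≡q) = ⊥-elim (<-irrefl aj≡q aj<q)
      ... | inj₂ (inj₂ bj<aj) = subst (_≤ a j) (sym b′j) bj<aj
      unaffected : ∀ {x y z} → 1 ≤ x → untouched x y ≡ untouched x z
      unaffected (s≤s _) = refl
    go (no aj<1) _ = late (inj₁ (n<1⇒n≡0 (≰⇒> aj<1)))
    go (yes _) (no aj≮q) = late (inj₂ (inj₁ (≤-antisym (capped j) (≮⇒≥ aj≮q))))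

  -- Block counts along a game and the strategy on odd boards

  count-insert : ∀ (is : Cell → Bool) {p c k x} → is (p (k , x)) ≡ false → is c ≡ true →
                 Increment k (count (is ∘ p)) (count (is ∘ p [ (k , x) ≔ c ]))
  count-insert is {p} {c} {k} {x} isp isc =
    sum-suc x (λ y y≢x → cong (⟦_⟧ ∘ is) (≔-other p (λ { refl → y≢x refl })))
      (trans (cong (⟦_⟧ ∘ is) (≔-same p (k , x))) (trans (cong ⟦_⟧ isc) (cong (suc ∘ ⟦_⟧) (sym isp)))) ,
    λ l l≢k → sum-cong-≗ {m} λ y → cong (⟦_⟧ ∘ is) (≔-other p (λ { refl → l≢k refl }))

  count-ignore : ∀ (is : Cell → Bool) {p c x} → is (p x) ≡ false → is c ≡ false →
                 count (is ∘ p) ≗ count (is ∘ p [ x ≔ c ])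
  count-ignore is {p} {c} {x} isp isc l = sum-cong-≗ {m} same
    where
    same : ∀ y → ⟦ is (p (l , y)) ⟧ ≡ ⟦ is ((p [ x ≔ c ]) (l , y)) ⟧
    same y with (l , y) ≟ˣ x
    ... | yes refl = cong ⟦_⟧ (trans isp (sym isc))
    ... | no _     = refl

  count-total : ∀ p k → count (isMine ∘ p) k + count (isHis ∘ p) k + count (isFree ∘ p) k ≡ m
  count-total p k = begin
    count (isMine ∘ p) k + count (isHis ∘ p) k + count (isFree ∘ p) k
      ≡⟨ cong (_+ count (isFree ∘ p) k) (∑-distrib-+ {m} _ _) ⟨
    sum (λ x → ⟦ isMine (p (k , x)) ⟧ + ⟦ isHis (p (k , x)) ⟧) + count (isFree ∘ p) k
      ≡⟨ ∑-distrib-+ {m} _ _ ⟨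
    sum (λ x → ⟦ isMine (p (k , x)) ⟧ + ⟦ isHis (p (k , x)) ⟧ + ⟦ isFree (p (k , x)) ⟧)
      ≡⟨ sum-const m (λ x → one (p (k , x))) ⟩
    m * 1 ≡⟨ *-identityʳ m ⟩
    m ∎
    where
    open ≡-Reasoning
    one : ∀ c → ⟦ isMine c ⟧ + ⟦ isHis c ⟧ + ⟦ isFree c ⟧ ≡ 1
    one free = refl
    one mine = refl
    one his  = refl

  count-≤ : ∀ p k → count (isMine ∘ p) k + count (isHis ∘ p) k ≤ m
  count-≤ p k = subst (count (isMine ∘ p) k + count (isHis ∘ p) k ≤_) (count-total p k) (m≤m+n _ _)

  unclaimed-in : ∀ p k → count (isMine ∘ p) k + count (isHis ∘ p) k < m → ∃ λ x → p (k , x) ≡ free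
  unclaimed-in p k <m with sum-positive {f = λ x → ⟦ isFree (p (k , x)) ⟧}
    (+-cancelˡ-≤ (count (isMine ∘ p) k + count (isHis ∘ p) k) _ _
      (subst₂ _≤_ (+-comm 1 _) (sym (count-total p k)) <m))
  ... | x , 1≤ = x , is-free (p (k , x)) 1≤
    where
    is-free : ∀ c → 1 ≤ ⟦ isFree c ⟧ → c ≡ free
    is-free free _ = refl

  mines hises : Position → Fin B → ℕ
  mines p = count (isMine ∘ p)
  hises p = count (isHis ∘ p)

  Inv : ℕ → Position → Set
  Inv t p = Counts (mines p) (hises p) × sum (mines p) ≡ t

  sum-increment : ∀ {k a a′} → Increment {B} k a a′ → sum a′ ≡ suc (sum a)
  sum-increment (at , other) = sum-suc _ other at

  -- An opened block holds at most `q` points and at most `H` blocks are opened, so a total of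
  -- `q * H` forces equality everywhere: `H` blocks with exactly `q` points each.
  majorities : ∀ {a b} → Counts a b → sum a ≡ s → H ≤ sum (majority ∘ a)
  majorities {a} {b} c Σa≡s = subst (H ≤_) (sum-cong-≗ same) (*-cancelˡ-≤ q {{>-nonZero (<⇒≤ 2≤q)}}
      (subst₂ _≤_ Σa≡s (sum-*ˡ q (opened ∘ a)) (sum-mono below)))
    where
    open Counts c
    below : ∀ k → a k ≤ q * opened (a k)
    below k = opened-≤ (a k) (capped k)
    blocks≤ : sum (λ k → q * opened (a k)) ≤ sum a
    blocks≤ = subst₂ _≤_ (sym (sum-*ˡ q (opened ∘ a))) (sym Σa≡s)
      (*-monoʳ-≤ q (subst (sum (opened ∘ a) ≤_) blocks (m≤m+n _ ν)))
    exact : ∀ k → a k ≡ q * opened (a k)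
    exact = sum-mono-≡ below blocks≤
    same : ∀ k → opened (a k) ≡ majority (a k)
    same k with a k | exact k
    ... | zero  | _  = cong ⟦_⟧ (sym (dec-false (q ≤? 0) (<⇒≱ (<⇒≤ 2≤q))))
    ... | suc x | eq = cong ⟦_⟧ (sym (dec-true (q ≤? suc x) (≤-reflexive (sym (trans eq (*-identityʳ q))))))

  majority-exclusive : ∀ {x y} → x + y ≤ m → majority x + majority y ≤ 1
  majority-exclusive {x} {y} x+y≤m = exclusive (q ≤? x) (q ≤? y)
    where
    exclusive : ∀ (x? : Dec (q ≤ x)) (y? : Dec (q ≤ y)) → ⟦ does x? ⟧ + ⟦ does y? ⟧ ≤ 1
    exclusive (no _)    (no _)    = z≤n
    exclusive (no _)    (yes _)   = ≤-refl
    exclusive (yes _)   (no _)    = ≤-refl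
    exclusive (yes q≤x) (yes q≤y) = ⊥-elim (<⇒≱ (s≤s x+y≤m) (subst (_≤ x + y) 2q≡ (+-mono-≤ q≤x q≤y)))

  sum-const0 : ∀ n {f : Fin n → ℕ} → (∀ i → f i ≡ 0) → sum f ≡ 0
  sum-const0 n eq = trans (sum-const n eq) (*-zeroʳ n)

  start : Inv 1 ((λ _ → free) [ (k₀ , x₀) ≔ mine ])
  start = record
    -- The first move opens one block; the other `B - 1 = 2 * pred H` blocks are untouched, so
    -- `reserve` starts with equality.
    { ν = pred H
    ; blocks = trans (cong (_+ pred H) (trans
        (sum-suc k₀ (λ k k≢ → cong opened (trans (other k k≢) (mines-0 k))) (cong opened at₀))
        (cong suc (sum-const0 B (λ _ → refl))))) (suc-pred H)
    ; reserve = ≤-reflexive (suc-injective (trans 1+2ν≡B (sym (begin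
        suc (sum (λ k → untouched (mines p₁ k) (hises p₁ k)))
          ≡⟨ sum-suc k₀ (λ k k≢ → sym (cong₂ untouched (trans (other k k≢) (mines-0 k)) (hises-0 k)))
               (sym (cong suc (cong₂ untouched at₀ (hises-0 k₀)))) ⟨
        sum {B} (λ _ → 1)  ≡⟨ trans (sum-const B (λ _ → refl)) (*-identityʳ B) ⟩
        B                  ∎))))
    ; capped = increment-elim (λ _ x → x ≤ q) first-move (subst (λ x → suc x ≤ q) (sym (mines-0 k₀)) (<⇒≤ 2≤q))
        (λ k _ → subst (_≤ q) (sym (mines-0 k)) z≤n)
    ; lead = increment-elim (λ k x → x ≡ 0 ⊎ x ≡ q ⊎ hises p₁ k < x) first-move
        (inj₂ (inj₂ (subst (_< suc (mines p₀ k₀)) (sym (hises-0 k₀)) z<s))) (λ k _ → inj₁ (mines-0 k))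
    } , trans (sum-increment first-move) (cong suc (sum-const0 B mines-0))
    where
    open ≡-Reasoning
    instance
      H≢0 : NonZero H
      H≢0 = >-nonZero (<⇒≤ 2≤H)
    1+2ν≡B : suc (2 * pred H) ≡ B
    1+2ν≡B = suc-injective (begin
      2 + 2 * pred H   ≡⟨ *-suc 2 (pred H) ⟨
      2 * suc (pred H) ≡⟨ cong (2 *_) (suc-pred H) ⟩
      2 * H            ≡⟨ cong (H +_) (+-identityʳ H) ⟩
      H + H            ≡⟨ 2H≡ ⟩
      suc B            ∎)
    p₀ p₁ : Position
    p₀ = λ _ → free
    p₁ = p₀ [ (k₀ , x₀) ≔ mine ]
    mines-0 : ∀ k → mines p₀ k ≡ 0
    mines-0 k = sum-const0 m (λ _ → refl)
    hises-0 : ∀ k → hises p₁ k ≡ 0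
    hises-0 k = trans (sym (count-ignore isHis {p₀} {mine} {k₀ , x₀} refl refl k)) (sum-const0 m (λ _ → refl))
    first-move : Increment k₀ (mines p₀) (mines p₁)
    first-move = count-insert isMine {p₀} {mine} {k₀} {x₀} refl refl
    other = proj₂ first-move
    at₀ : mines p₁ k₀ ≡ 1
    at₀ = trans (proj₁ first-move) (cong suc (mines-0 k₀))

  strategy : Strategy
  strategy = record
    { Inv = Inv
    ; first = (k₀ , x₀) , start
    ; open′ = λ {t} {p} _ szA szB t≤s → opening {t} {p} szA szB t≤s
    ; reply = λ {t} {p} inv _ _ t<s → reply {t} {p} inv t<s
    ; safe = λ { (c , Σ≡) _ _ → majorities c Σ≡ }
    ; fatal = λ {p} inv _ _ → fatal {p} inv
    }
    where
    opening : ∀ {t p} → size (isMine ∘ p) ≡ t → suc (size (isHis ∘ p)) ≡ t → t ≤ s → ∃ λ x → p x ≡ free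
    opening {t} {p} refl szB t≤s = exists-free p (≤-<-trans (≤-reflexive (+-comm t _))
      (subst (λ z → size (isHis ∘ p) + z < B * m) szB
        (≤-trans (s≤s (+-monoʳ-≤ b (≤-reflexive szB))) (≤-trans (+-mono-≤ 1+b≤s (≤-trans (≤-reflexive (sym szB)) 1+b≤s)) capacity))))
      where
      b = size (isHis ∘ p)
      1+b≤s : suc b ≤ s
      1+b≤s = subst (_≤ s) (sym szB) t≤s

    reply : ∀ {t p} → Inv t p → t < s → ∀ x → p x ≡ free →
            ∃ λ y → (p [ x ≔ his ]) y ≡ free × Inv (suc t) (p [ x ≔ his ] [ y ≔ mine ])
    reply {t} {p} (c , refl) t<s x px with choose c t<s (count-insert isHis {p} (cong isHis px) refl)
    ... | k , room , next with unclaimed-in (p [ x ≔ his ]) k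
                                 (subst (λ z → z + hises (p [ x ≔ his ]) k < m) (count-ignore isMine {p} {his} (cong isMine px) refl k) room)
    ... | y , qy = (k , y) , qy ,
          Counts-cong (λ _ → refl) (count-ignore isHis (cong isHis qy) refl) (next inc) , sum-increment inc
      where
      q₁ = p [ x ≔ his ]
      inc : Increment k (mines p) (mines (q₁ [ (k , y) ≔ mine ]))
      inc with count-insert isMine {q₁} {mine} {k} {y} (cong isMine qy) refl
      ... | at , other = trans at (cong suc (sym (same k))) , λ l l≢k → trans (other l l≢k) (sym (same l))
        where same = count-ignore isMine {p} {his} (cong isMine px) refl

    -- Together the two players would have at least `H + H = B + 1` majorities, but no block has
    -- room for two.
    fatal : ∀ {p} → Inv s p → ∀ x → p x ≡ free → ¬ N (isHis ∘ p [ x ≔ his ])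
    fatal {p} (c , Σ≡s) x px his-majorities = <⇒≱ (subst (suc B ≤_) (sym 2H≡) ≤-refl)
      (begin
        H + H
          ≤⟨ +-mono-≤ (majorities c Σ≡s) his-majorities ⟩
        sum (majority ∘ mines p) + sum (majority ∘ hises p₁)
          ≡⟨ ∑-distrib-+ {B} _ _ ⟨
        sum (λ k → majority (mines p k) + majority (hises p₁ k))
          ≤⟨ sum-mono (λ k → majority-exclusive (subst (λ z → z + hises p₁ k ≤ m)
               (sym (count-ignore isMine {p} (cong isMine px) refl k)) (count-≤ p₁ k))) ⟩
        sum {B} (λ _ → 1)
          ≡⟨ trans (sum-const B (λ _ → refl)) (*-identityʳ B) ⟩
        B ∎)
      where
      open ≤-Reasoning
      p₁ = p [ x ≔ his ]

  1≤s : 1 ≤ s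
  1≤s = *-mono-≤ (<⇒≤ 2≤q) (<⇒≤ 2≤H)

odd-game : ∀ H q B m → H + H ≡ suc B → q + q ≡ suc m → 2 ≤ H → 2 ≤ q →
           Σ (Lines (B * m)) λ ℒ → IsTransitive ℒ × PlayerIWin ℒ
odd-game H q zero m 2H≡ _ 2≤H _ = ⊥-elim (<⇒≱ (+-mono-≤ 2≤H (<⇒≤ 2≤H)) (≤-trans (≤-reflexive 2H≡) (s≤s z≤n)))
odd-game H q (suc B) zero _ 2q≡ _ 2≤q = ⊥-elim (<⇒≱ (+-mono-≤ 2≤q (<⇒≤ 2≤q)) (≤-trans (≤-reflexive 2q≡) (s≤s z≤n)))
odd-game H q (suc B) (suc m) 2H≡ 2q≡ 2≤H 2≤q = lines , transitive all-symmetric , playerIWin strategy 1≤s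
  where open OddBoard H q (suc B) (suc m) 2H≡ 2q≡ 2≤H 2≤q zero zero

-- Cyclic blocks

odd : ℕ → Bool
odd zero    = false
odd (suc n) = not (odd n)

odd-even : ∀ k → odd (k + k) ≡ false
odd-even zero    = refl
odd-even (suc k) = trans (cong (not ∘ odd) (+-suc k k)) (trans (not-involutive _) (odd-even k))

half : ∀ n → ∃ λ k → n ≡ ⟦ odd n ⟧ + (k + k)
half zero = 0 , refl
half (suc n) with odd n | half n
... | false | k , eq = k , cong suc eq
... | true  | k , eq = suc k , trans (cong suc eq) (cong suc (sym (+-suc k k)))

pick : ∀ {P : Set} → Dec P → ℕ → ℕ → ℕ
pick (yes _) x y = y
pick (no _)  x y = x

argmax : (ℕ → ℕ) → ℕ → ℕ
argmax g zero    = 0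
argmax g (suc n) = pick (g (argmax g n) ≤? g (suc n)) (argmax g n) (suc n)

argmax-max : ∀ (g : ℕ → ℕ) n {w} → w ≤ n → g w ≤ g (argmax g n)
argmax-max g zero    z≤n = ≤-refl
argmax-max g (suc n) {w} w≤ = by-cases (g (argmax g n) ≤? g (suc n)) (m≤n⇒m<n∨m≡n w≤)
  where
  by-cases : ∀ (g? : Dec (g (argmax g n) ≤ g (suc n))) → w < suc n ⊎ w ≡ suc n → g w ≤ g (pick g? (argmax g n) (suc n))
  by-cases (yes g≤) (inj₁ (s≤s w≤n)) = ≤-trans (argmax-max g n w≤n) g≤
  by-cases (yes _)  (inj₂ refl)      = ≤-refl
  by-cases (no _)   (inj₁ (s≤s w≤n)) = argmax-max g n w≤n
  by-cases (no g≰)  (inj₂ refl)      = <⇒≤ (≰⇒> g≰)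

argmax-cong : ∀ {g g′ : ℕ → ℕ} n → g ≗ g′ → argmax g n ≡ argmax g′ n
argmax-cong zero _ = refl
argmax-cong {g} {g′} (suc n) eq = trans
  (cong₂ (λ u v → pick (u ≤? v) (argmax g n) (suc n)) (eq (argmax g n)) (eq (suc n)))
  (cong (λ x → pick (g′ x ≤? g′ (suc n)) x (suc n)) (argmax-cong n eq))

-- A word read as a binary number, least significant digit first; any injective code would serve to
-- compare words.
code : ℕ → (ℕ → Bool) → ℕ
code zero    g = 0
code (suc n) g = ⟦ g 0 ⟧ + 2 * code n (g ∘ suc)

code-cong : ∀ n {g g′} → g ≗ g′ → code n g ≡ code n g′
code-cong zero    _  = refl
code-cong (suc n) eq = cong₂ (λ x y → ⟦ x ⟧ + 2 * y) (eq 0) (code-cong n (eq ∘ suc))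

digits : ∀ x y u v → ⟦ x ⟧ + 2 * u ≡ ⟦ y ⟧ + 2 * v → x ≡ y × u ≡ v
digits false false u v eq = refl , *-cancelˡ-≡ u v 2 eq
digits true  true  u v eq = refl , *-cancelˡ-≡ u v 2 (suc-injective eq)
digits false true  u v eq = ⊥-elim (even≢odd u v eq)
digits true  false u v eq = ⊥-elim (even≢odd v u (sym eq))

code-injective : ∀ n {g g′} → code n g ≡ code n g′ → ∀ {k} → k < n → g k ≡ g′ k
code-injective (suc n) {g} {g′} eq {zero}  _ = proj₁ (digits (g 0) (g′ 0) (code n (g ∘ suc)) (code n (g′ ∘ suc)) eq)
code-injective (suc n) {g} {g′} eq {suc k} (s≤s k<n) =
  code-injective n (proj₂ (digits (g 0) (g′ 0) (code n (g ∘ suc)) (code n (g′ ∘ suc)) eq)) k<n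

-- A word with g (x + 2ᵃ) = not (g x) has no period other than the multiples of 2ᵃ⁺¹: an odd
-- multiple of 2ᵗ with t ≤ a would, after 2ᵃ⁻ᵗ repetitions, become an odd multiple of 2ᵃ.
module _ {g : ℕ → Bool} where

  iterate-period : ∀ {d} → (∀ x → g (x + d) ≡ g x) → ∀ k x → g (x + k * d) ≡ g x
  iterate-period per zero x = cong g (+-identityʳ x)
  iterate-period {d} per (suc k) x = trans (cong g (sym (+-assoc x d (k * d))))
    (trans (iterate-period per k (x + d)) (per x))

  iterate-antiperiod : ∀ {c} → (∀ x → g (x + c) ≡ not (g x)) → ∀ k x → g (x + k * c) ≡ odd k xor g x
  iterate-antiperiod anti zero x = cong g (+-identityʳ x)
  iterate-antiperiod {c} anti (suc k) x = trans (cong g (sym (+-assoc x c (k * c))))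
    (trans (iterate-antiperiod anti k (x + c)) (trans (cong (odd k xor_) (anti x))
      (trans (sym (not-distribʳ-xor (odd k) (g x))) (not-distribˡ-xor (odd k) (g x)))))

  period-divisible : ∀ a {d} → (∀ x → g (x + 2 ^ a) ≡ not (g x)) → (∀ x → g (x + d) ≡ g x) →
                     ∀ t r → t + r ≡ suc a → ∃ λ u → d ≡ u * 2 ^ t
  period-divisible a {d} anti per zero r _ = d , sym (*-identityʳ d)
  period-divisible a {d} anti per (suc t) r eq
    with period-divisible a anti per t (suc r) (trans (+-suc t r) eq)
  ... | u , d≡ with odd u in odd-u | half u
  ...   | false | k , u≡ = k , trans d≡ (trans (cong (_* 2 ^ t) u≡)
            (solve 2 (λ k z → (k :+ k) :* z := k :* (con 2 :* z)) refl k (2 ^ t)))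
    
  ...   | true | _ = ⊥-elim (not-¬ refl (trans (sym (iterate-period per (2 ^ r) 0)) (begin
            g (2 ^ r * d)             ≡⟨ cong (λ z → g (2 ^ r * z)) d≡ ⟩
            g (2 ^ r * (u * 2 ^ t))   ≡⟨ cong g (solve 3 (λ x y z → x :* (y :* z) := y :* (z :* x)) refl (2 ^ r) u (2 ^ t)) ⟩
            g (u * (2 ^ t * 2 ^ r))   ≡⟨ cong (λ z → g (u * z)) (^-distribˡ-+-* 2 t r) ⟨
            g (u * 2 ^ (t + r))       ≡⟨ cong (λ z → g (u * 2 ^ z)) (suc-injective eq) ⟩
            g (u * 2 ^ a)             ≡⟨ iterate-antiperiod anti u 0 ⟩
            odd u xor g 0             ≡⟨ cong (_xor g 0) odd-u ⟩
            not (g 0)                 ∎)))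
    where
    open ≡-Reasoning

-- A block is a cycle of length c + c; the pair {v , v + c} is recorded as Fin c, its two points as Bool.
module Block (c : ℕ) .{{_ : NonZero c}} where

  Point : Set
  Point = Fin c × Bool

  -- Angles are natural numbers: equality of `pt` stands for congruence modulo `c + c`, and equality
  -- of its first component for congruence modulo `c`.
  pt : ℕ → Point
  pt v = v mod c , odd (v / c)

  num : Point → ℕ
  num (i , e) = toℕ i + ⟦ e ⟧ * c

  antipode : Point → Point
  antipode (i , e) = i , not e

  mod-cong : ∀ {v w} → v % c ≡ w % c → v mod c ≡ w mod c
  mod-cong {v} {w} eq = Fin.fromℕ<-cong (v % c) (w % c) eq (m%n<n v c) (m%n<n w c)

  toℕ-mod : ∀ v → toℕ (v mod c) ≡ v % c
  toℕ-mod v = Fin.toℕ-fromℕ< (m%n<n v c)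

  +c/c : ∀ v → (v + c) / c ≡ suc (v / c)
  +c/c v = trans (m/n≡1+[m∸n]/n (m≤n+m c v)) (cong (λ z → suc (z / c)) (m+n∸n≡m v c))

  pt-+c : ∀ v → pt (v + c) ≡ antipode (pt v)
  pt-+c v = cong₂ _,_ (mod-cong ([m+n]%n≡m%n v c)) (cong odd (+c/c v))

  antipode-involutive : ∀ x → antipode (antipode x) ≡ x
  antipode-involutive (i , e) = cong (i ,_) (not-involutive e)

  pt-+2c : ∀ v → pt (v + (c + c)) ≡ pt v
  pt-+2c v = trans (cong pt (sym (+-assoc v c c))) (trans (pt-+c (v + c))
    (trans (cong antipode (pt-+c v)) (antipode-involutive (pt v))))

  pt-+k2c : ∀ v k → pt (v + k * (c + c)) ≡ pt v
  pt-+k2c v zero = cong pt (+-identityʳ v)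
  pt-+k2c v (suc k) = trans (cong pt (sym (+-assoc v (c + c) (k * (c + c)))))
    (trans (pt-+k2c (v + (c + c)) k) (pt-+2c v))

  pt-+kc : ∀ v k → pt (v + k * c) ≡ (v mod c , odd k xor odd (v / c))
  pt-+kc v zero = cong pt (+-identityʳ v)
  pt-+kc v (suc k) = trans (cong pt (trans (cong (v +_) (+-comm c (k * c))) (sym (+-assoc v (k * c) c))))
    (trans (pt-+c (v + k * c)) (trans (cong antipode (pt-+kc v k))
      (cong (v mod c ,_) (not-distribˡ-xor (odd k) _))))

  pt-num : ∀ x → pt (num x) ≡ x
  pt-num (i , e) = trans (pt-+kc (toℕ i) ⟦ e ⟧) (cong₂ _,_
    (trans (mod-cong′ (Fin.toℕ<n i)) (Fin.fromℕ<-toℕ i (Fin.toℕ<n i)))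
    (trans (cong (λ z → odd ⟦ e ⟧ xor odd z) (m<n⇒m/n≡0 (Fin.toℕ<n i))) (odd-⟦⟧ e)))
    where
    mod-cong′ : ∀ {v} (v<c : v < c) → v mod c ≡ fromℕ< v<c
    mod-cong′ {v} v<c = Fin.fromℕ<-cong (v % c) v (m<n⇒m%n≡m v<c) (m%n<n v c) v<c
    odd-⟦⟧ : ∀ e → odd ⟦ e ⟧ xor false ≡ e
    odd-⟦⟧ false = refl
    odd-⟦⟧ true  = refl

  num-<2c : ∀ x → num x < c + c
  num-<2c (i , false) = ≤-trans (s≤s (≤-reflexive (+-identityʳ _))) (≤-trans (Fin.toℕ<n i) (m≤m+n c c))
  num-<2c (i , true)  = +-mono-<-≤ (Fin.toℕ<n i) (≤-reflexive (+-identityʳ c))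

  num-pt : ∀ v → ∃ λ k → v ≡ num (pt v) + k * (c + c)
  num-pt v with half (v / c)
  ... | k , eq = k , (begin
    v                                    ≡⟨ m≡m%n+[m/n]*n v c ⟩
    v % c + v / c * c                    ≡⟨ cong₂ _+_ (sym (toℕ-mod v)) (cong (_* c) eq) ⟩
    toℕ (v mod c) + (⟦ odd (v / c) ⟧ + (k + k)) * c
      ≡⟨ solve 4 (λ i o k c → i :+ (o :+ (k :+ k)) :* c := (i :+ o :* c) :+ k :* (c :+ c)) refl (toℕ (v mod c)) ⟦ odd (v / c) ⟧ k c ⟩
    num (pt v) + k * (c + c)             ∎)
    where
    open ≡-Reasoning

  pt-num-+ : ∀ v d → pt (num (pt v) + d) ≡ pt (v + d)
  pt-num-+ v d with num-pt v
  ... | k , eq = begin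
    pt (num (pt v) + d)                   ≡⟨ pt-+k2c _ k ⟨
    pt (num (pt v) + d + k * (c + c))     ≡⟨ cong pt (solve 3 (λ x d y → x :+ d :+ y := x :+ y :+ d) refl (num (pt v)) d (k * (c + c))) ⟩
    pt (num (pt v) + k * (c + c) + d)     ≡⟨ cong (λ z → pt (z + d)) eq ⟨
    pt (v + d)                            ∎
    where
    open ≡-Reasoning

  pt-cong-+ : ∀ {v w} d → pt v ≡ pt w → pt (v + d) ≡ pt (w + d)
  pt-cong-+ {v} {w} d eq = trans (sym (pt-num-+ v d)) (trans (cong (λ z → pt (num z + d)) eq) (pt-num-+ w d))

  pt-cong-+₂ : ∀ {v w v′ w′} → pt v ≡ pt w → pt v′ ≡ pt w′ → pt (v + v′) ≡ pt (w + w′)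
  pt-cong-+₂ {v} {w} {v′} {w′} eq eq′ = trans (pt-cong-+ v′ eq)
    (trans (cong pt (+-comm w v′)) (trans (pt-cong-+ w eq′) (cong pt (+-comm w′ w))))

  -- A representative of - d modulo c + c.
  neg : ℕ → ℕ
  neg d = d * (c + c) ∸ d

  +-neg : ∀ d → d + neg d ≡ d * (c + c)
  +-neg d = m+[n∸m]≡n (≤-trans (≤-reflexive (sym (*-identityʳ d))) (*-monoʳ-≤ d (≤-trans (>-nonZero⁻¹ c) (m≤m+n c c))))

  pt-+-neg : ∀ v d → pt (v + d + neg d) ≡ pt v
  pt-+-neg v d = trans (cong pt (trans (+-assoc v d (neg d)) (cong (v +_) (+-neg d)))) (pt-+k2c v d)

  pt-neg-+ : ∀ v d → pt (v + neg d + d) ≡ pt v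
  pt-neg-+ v d = trans (cong pt (trans (+-assoc v (neg d) d) (trans (cong (v +_) (+-comm (neg d) d)) (sym (+-assoc v d (neg d)))))) (pt-+-neg v d)

  rotate : ℕ → Point → Point
  rotate d x = pt (num x + d)

  rotate-pt : ∀ d v → rotate d (pt v) ≡ pt (v + d)
  rotate-pt d v = pt-num-+ v d

  rotate-inverse : ∀ d d′ k → d + d′ ≡ k * (c + c) → ∀ x → rotate d′ (rotate d x) ≡ x
  rotate-inverse d d′ k eq x = begin
    rotate d′ (pt (num x + d))   ≡⟨ rotate-pt d′ (num x + d) ⟩
    pt (num x + d + d′)          ≡⟨ cong pt (trans (+-assoc (num x) d d′) (cong (num x +_) eq)) ⟩
    pt (num x + k * (c + c))     ≡⟨ pt-+k2c (num x) k ⟩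
    pt (num x)                   ≡⟨ pt-num x ⟩
    x                            ∎
    where open ≡-Reasoning

  idx : ℕ → Fin c
  idx v = proj₁ (pt v)

  idx-cong-+ : ∀ {v w} d → idx v ≡ idx w → idx (v + d) ≡ idx (w + d)
  idx-cong-+ {v} {w} d eq = mod-cong (begin
    (v + d) % c            ≡⟨ %-distribˡ-+ v d c ⟩
    (v % c + d % c) % c    ≡⟨ cong (λ z → (z + d % c) % c) (trans (sym (toℕ-mod v)) (trans (cong toℕ eq) (toℕ-mod w))) ⟩
    (w % c + d % c) % c    ≡⟨ %-distribˡ-+ w d c ⟨
    (w + d) % c            ∎)
    where open ≡-Reasoning

  idx-pt : ∀ {v w} → pt v ≡ pt w → idx v ≡ idx w
  idx-pt = cong proj₁

  idx-cancel-+ : ∀ {v w} d → idx (v + d) ≡ idx (w + d) → idx v ≡ idx w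
  idx-cancel-+ {v} {w} d eq = trans (sym (idx-pt (pt-+-neg v d))) (trans (idx-cong-+ (neg d) eq) (idx-pt (pt-+-neg w d)))

  idx-cong-+₂ : ∀ {v w v′ w′} → idx v ≡ idx w → idx v′ ≡ idx w′ → idx (v + v′) ≡ idx (w + w′)
  idx-cong-+₂ {v} {w} {v′} {w′} eq eq′ = trans (idx-cong-+ v′ eq)
    (trans (cong idx (+-comm w v′)) (trans (idx-cong-+ w eq′) (cong idx (+-comm w′ w))))

  idx-toℕ : ∀ i → idx (toℕ i) ≡ i
  idx-toℕ i = trans (cong idx (sym (+-identityʳ (toℕ i)))) (cong proj₁ (pt-num (i , false)))

  -- Comparing with the value at v makes the key insensitive to complementing f.
  key : (Point → Bool) → ℕ → ℕ
  key f v = code (c + c) (λ k → f (pt (v + k)) xor f (pt v))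

  -- An angle from which the word read is greatest: a canonical position of `f`. For rigid `f` it is
  -- determined modulo `c` and moves along when `f` is rotated.
  peak : (Point → Bool) → ℕ
  peak f = argmax (key f) (c + c)

  peak-cong : ∀ {f f′} → f ≗ f′ → peak f ≡ peak f′
  peak-cong f≗f′ = argmax-cong (c + c) λ v → code-cong (c + c) λ k → cong₂ _xor_ (f≗f′ _) (f≗f′ _)

  key-pt : ∀ f {v w} → pt v ≡ pt w → key f v ≡ key f w
  key-pt f eq = code-cong (c + c) λ k → cong₂ (λ x y → f x xor f y) (pt-cong-+ k eq) eq

  IsPeak : (Point → Bool) → ℕ → Set
  IsPeak f v = ∀ w → key f w ≤ key f v

  peak-isPeak : ∀ f → IsPeak f (peak f)
  peak-isPeak f w = subst (_≤ key f (peak f)) (key-pt f (pt-num (pt w)))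
    (argmax-max (key f) (c + c) (<⇒≤ (num-<2c (pt w))))

  -- Only rotations by multiples of c map f to itself or to its complement.
  Rigid : (Point → Bool) → Set
  Rigid f = ∀ (v w : Fin (c + c)) → key f (toℕ v) ≡ key f (toℕ w) → idx (toℕ v) ≡ idx (toℕ w)

  rigid? : ∀ f → Dec (Rigid f)
  rigid? f = Fin.all? λ v → Fin.all? λ w → (key f (toℕ v) ≟ key f (toℕ w)) →-dec (idx (toℕ v) Fin.≟ idx (toℕ w))

  rigid⇒ : ∀ f → Rigid f → ∀ {v w} → key f v ≡ key f w → idx v ≡ idx w
  rigid⇒ f rig {v} {w} eq = trans (sym (idx-pt (pt-rep v))) (trans
    (rig (rep v) (rep w) (trans (key-pt f (pt-rep v)) (trans eq (sym (key-pt f (pt-rep w)))))) (idx-pt (pt-rep w)))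
    where
    rep : ℕ → Fin (c + c)
    rep v = fromℕ< (num-<2c (pt v))
    pt-rep : ∀ v → pt (toℕ (rep v)) ≡ pt v
    pt-rep v = trans (cong pt (Fin.toℕ-fromℕ< (num-<2c (pt v)))) (pt-num (pt v))

  peak-unique : ∀ f → Rigid f → ∀ {v w} → IsPeak f v → IsPeak f w → idx v ≡ idx w
  peak-unique f rig v-peak w-peak = rigid⇒ f rig (≤-antisym (w-peak _) (v-peak _))

  -- Peaks under rotation and complement; rigid words

  Shifted : ℕ → (Point → Bool) → (Point → Bool) → Set
  Shifted d f f′ = ∀ v → f′ (pt (v + d)) ≡ f (pt v)

  module _ {d f f′} (shift : Shifted d f f′) where

    key-shift : ∀ v → key f′ (v + d) ≡ key f v
    key-shift v = code-cong (c + c) λ k → cong₂ _xor_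
      (trans (cong (f′ ∘ pt) (solve 3 (λ v d k → v :+ d :+ k := v :+ k :+ d) refl v d k)) (shift (v + k)))
      (shift v)

    key-unshift : ∀ v → key f (v + neg d) ≡ key f′ v
    key-unshift v = trans (sym (key-shift (v + neg d))) (key-pt f′ (pt-neg-+ v d))

    rigid-shift : Rigid f → Rigid f′
    rigid-shift rig v w eq = idx-cancel-+ (neg d)
      (rigid⇒ f rig (trans (key-unshift (toℕ v)) (trans eq (sym (key-unshift (toℕ w))))))

    -- Turned back by `d`, the peak of `f′` is a peak of `f`, and a rigid `f` has only one peak
    -- modulo `c`.
    peak-shift : Rigid f → idx (peak f′) ≡ idx (peak f + d)
    peak-shift rig = trans (sym (idx-pt (pt-neg-+ (peak f′) d)))
      (idx-cong-+ d (peak-unique f rig unshifted (peak-isPeak f)))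
      where
      unshifted : IsPeak f (peak f′ + neg d)
      unshifted w = subst₂ _≤_ (key-shift w) (sym (key-unshift (peak f′))) (peak-isPeak f′ (w + d))

  xor-complement : ∀ x y → not x xor not y ≡ x xor y
  xor-complement x y = trans (sym (not-distribˡ-xor x (not y)))
    (trans (cong not (sym (not-distribʳ-xor x y))) (not-involutive _))

  key-complement : ∀ f v → key (not ∘ f) v ≡ key f v
  key-complement f v = code-cong (c + c) λ k → xor-complement (f (pt (v + k))) (f (pt v))

  peak-complement : ∀ f → Rigid f → idx (peak (not ∘ f)) ≡ idx (peak f)
  peak-complement f rig = peak-unique f rig
    (λ w → subst₂ _≤_ (key-complement f w) (key-complement f (peak (not ∘ f))) (peak-isPeak (not ∘ f) w))
    (peak-isPeak f)

  -- The words read from `v` and from `w` agree after each is compared with its first letter. So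
  -- rotation by `δ`, the difference of `w` and `v`, changes `f` by the constant `ε` that relates
  -- these two first letters.
  coincidence : ∀ f {v w} → key f v ≡ key f w →
                ∃ λ δ → ∃ λ ε → pt (v + δ) ≡ pt w × (∀ x → f (pt (x + δ)) ≡ f (pt x) xor ε)
  coincidence f {v} {w} eq = δ , f (pt v) xor f (pt w) , v+δ , λ x → recombine (f (pt x)) (f (pt v)) (begin
      f (pt x) xor f (pt v)            ≡⟨ cong (λ p → f p xor f (pt v)) (sym (trans (cong pt (shuffle v x (neg v))) (pt-+-neg x v))) ⟩
      f (pt (v + (x + neg v))) xor f (pt v) ≡⟨ words (x + neg v) ⟩
      f (pt (w + (x + neg v))) xor f (pt w) ≡⟨ cong (λ z → f (pt z) xor f (pt w)) (solve 3 (λ w x n → w :+ (x :+ n) := x :+ (w :+ n)) refl w x (neg v)) ⟩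
      f (pt (x + δ)) xor f (pt w)      ∎)
    where
    open ≡-Reasoning
    δ = w + neg v
    shuffle : ∀ v x n → v + (x + n) ≡ x + v + n
    shuffle = solve 3 (λ v x n → v :+ (x :+ n) := x :+ v :+ n) refl
    v+δ : pt (v + δ) ≡ pt w
    v+δ = trans (cong pt (shuffle v w (neg v))) (pt-+-neg w v)
    at-num : ∀ u k → pt (u + k) ≡ pt (u + num (pt k))
    at-num u k = pt-cong-+₂ {u} {u} refl (sym (pt-num (pt k)))
    words : ∀ k → f (pt (v + k)) xor f (pt v) ≡ f (pt (w + k)) xor f (pt w)
    words k = trans (cong (λ p → f p xor f (pt v)) (at-num v k))
      (trans (code-injective (c + c) eq (num-<2c (pt k))) (cong (λ p → f p xor f (pt w)) (sym (at-num w k))))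
    recombine : ∀ p a {q b} → p xor a ≡ q xor b → q ≡ p xor (a xor b)
    recombine p a {q} {b} eq = begin
      q               ≡⟨ xor-identityʳ q ⟨
      q xor false     ≡⟨ cong (q xor_) (xor-same b) ⟨
      q xor (b xor b) ≡⟨ xor-assoc q b b ⟨
      (q xor b) xor b ≡⟨ cong (_xor b) eq ⟨
      (p xor a) xor b ≡⟨ xor-assoc p a b ⟩
      p xor (a xor b) ∎

  twice : ∀ (f : Point → Bool) {δ ε} → (∀ x → f (pt (x + δ)) ≡ f (pt x) xor ε) → ∀ x → f (pt (x + (δ + δ))) ≡ f (pt x)
  twice f {δ} {ε} per x = begin
    f (pt (x + (δ + δ)))    ≡⟨ cong (f ∘ pt) (+-assoc x δ δ) ⟨
    f (pt (x + δ + δ))      ≡⟨ trans (per (x + δ)) (cong (_xor ε) (per x)) ⟩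
    (f (pt x) xor ε) xor ε  ≡⟨ trans (xor-assoc (f (pt x)) ε ε) (trans (cong (f (pt x) xor_) (xor-same ε)) (xor-identityʳ _)) ⟩
    f (pt x)                ∎
    where open ≡-Reasoning

  Single : (Point → Bool) → Fin c → Set
  Single f i = f (i , true) ≡ not (f (i , false))

  Antipodal : (Point → Bool) → Set
  Antipodal f = ∀ i → Single f i

  single-antipode : ∀ {f i} → Single f i → ∀ e → f (i , not e) ≡ not (f (i , e))
  single-antipode s false = s
  single-antipode s true  = trans (sym (not-involutive _)) (cong not (sym s))

  antipode-single : ∀ {f i} e → f (i , not e) ≡ not (f (i , e)) → Single f i
  antipode-single false s = s
  antipode-single true  s = trans (sym (not-involutive _)) (cong not (sym s))

  idx-+kc : ∀ v k → idx (v + k * c) ≡ idx v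
  idx-+kc v k = cong proj₁ (pt-+kc v k)

  -- Equal keys yield a rotation by `δ` that fixes `f` up to complement, so `δ + δ` is a period.
  -- Since `f` changes sign under the power of two `c`, its periods are multiples of `2 * c`; hence
  -- `δ` is a multiple of `c`.
  antipodal⇒rigid : ∀ {a} → c ≡ 2 ^ a → ∀ {f} → Antipodal f → Rigid f
  antipodal⇒rigid {a} c≡ {f} anti v w eq with coincidence f {toℕ v} {toℕ w} eq
  ... | δ , ε , v+δ , per with period-divisible {λ x → f (pt x)} a {δ + δ}
          (λ x → trans (cong (λ z → f (pt (x + z))) (sym c≡)) (trans (cong f (pt-+c x)) (single-antipode {f} (anti (idx x)) (odd (x / c)))))
          (twice f per) (suc a) 0 (+-identityʳ _)
  ... | u , 2δ≡ = trans (sym (idx-+kc (toℕ v) u)) (trans (cong (λ z → idx (toℕ v + z)) (sym δ≡)) (idx-pt v+δ))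
    where
    δ≡ : δ ≡ u * c
    δ≡ = *-cancelˡ-≡ δ (u * c) 2 (begin
      2 * δ           ≡⟨ cong (δ +_) (+-identityʳ δ) ⟩
      δ + δ           ≡⟨ 2δ≡ ⟩
      u * (2 * 2 ^ a) ≡⟨ cong (λ z → u * (2 * z)) c≡ ⟨
      u * (2 * c)     ≡⟨ solve 2 (λ u c → u :* (con 2 :* c) := con 2 :* (u :* c)) refl u c ⟩
      2 * (u * c)     ∎)
      where open ≡-Reasoning

  not-x≢x : ∀ {x} → x ≢ not x
  not-x≢x {false} ()
  not-x≢x {true} ()

  true≢false : true ≢ false
  true≢false ()

  record OneDouble (f : Point → Bool) : Set where
    field
      double zeros : Fin c
      is-double    : ∀ e → f (double , e) ≡ true
      is-zero      : ∀ e → f (zeros , e) ≡ false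
      others       : ∀ i → i ≢ double → i ≢ zeros → Single f i

  -- A rotation that reproduces `f` up to complement permutes the two pairs on which `f` is
  -- constant. Fixing them makes it trivial modulo `c`; if it exchanges them, applying it twice is
  -- trivial modulo `c`, and the split pair `i` decides the rest.
  oneDouble⇒rigid : ∀ {f} (o : OneDouble f) → (∃ λ i → i ≢ OneDouble.double o × i ≢ OneDouble.zeros o) → Rigid f
  oneDouble⇒rigid {f} o (i , i≢d , i≢z) v w eq with coincidence f {toℕ v} {toℕ w} eq
  ... | δ , ε , v+δ , per = trans (sym idx-v+δ) (idx-pt v+δ)
    where
    open OneDouble o
    const-pair : ∀ j {b} → (∀ e → f (j , e) ≡ b) → ∀ e → f (idx (toℕ j + δ) , e) ≡ b xor ε
    const-pair j {b} const e = trans (cong f (here e)) (rotated (e xor odd ((toℕ j + δ) / c)))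
      where
      rotated : ∀ e′ → f (pt (toℕ j + δ + ⟦ e′ ⟧ * c)) ≡ b xor ε
      rotated e′ = trans (cong (f ∘ pt) (solve 3 (λ j d k → j :+ d :+ k := j :+ k :+ d) refl (toℕ j) δ (⟦ e′ ⟧ * c)))
        (trans (per _) (cong (_xor ε) (trans (cong f (pt-num (j , e′))) (const e′))))
      odd-⟦⟧ : ∀ e → odd ⟦ e ⟧ ≡ e
      odd-⟦⟧ false = refl
      odd-⟦⟧ true  = refl
      here : ∀ e → (idx (toℕ j + δ) , e) ≡ pt (toℕ j + δ + ⟦ e xor odd ((toℕ j + δ) / c) ⟧ * c)
      here e = trans (cong (idx (toℕ j + δ) ,_) (sym (trans (cong (_xor o′) (odd-⟦⟧ (e xor o′)))
          (trans (xor-assoc e o′ o′) (trans (cong (e xor_) (xor-same o′)) (xor-identityʳ e))))))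
        (sym (pt-+kc (toℕ j + δ) ⟦ e xor o′ ⟧))
        where o′ = odd ((toℕ j + δ) / c)
    find-double : ∀ j → (∀ e → f (j , e) ≡ true) → j ≡ double
    find-double j tt with j Fin.≟ double | j Fin.≟ zeros
    ... | yes eq | _ = eq
    ... | no _ | yes refl = ⊥-elim (true≢false (trans (sym (tt true)) (is-zero true)))
    ... | no j≢d | no j≢z = ⊥-elim (not-x≢x (trans (sym (tt true)) (trans (others j j≢d j≢z) (cong not (tt false)))))
    find-zero : ∀ j → (∀ e → f (j , e) ≡ false) → j ≡ zeros
    find-zero j ff with j Fin.≟ zeros | j Fin.≟ double
    ... | yes eq | _ = eq
    ... | no _ | yes refl = ⊥-elim (true≢false (trans (sym (is-double true)) (ff true)))
    ... | no j≢z | no j≢d = ⊥-elim (not-x≢x (trans (sym (ff true)) (trans (others j j≢d j≢z) (cong not (ff false)))))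

    fixed : ∀ {x} j → idx (toℕ j + x) ≡ j → ∀ u → idx (u + x) ≡ idx u
    fixed {x} j eq u = trans (cong idx (+-comm u x)) (trans (idx-cong-+ {x} {0} u
      (idx-cancel-+ (toℕ j) (trans (cong idx (+-comm x (toℕ j))) (trans eq (sym (idx-toℕ j)))))) refl)

    by-ε : ∀ b → ε ≡ b → idx (toℕ v + δ) ≡ idx (toℕ v)
    -- The doubled pair goes to a doubled pair, which can only be itself.
    by-ε false ε≡ = fixed double (find-double _ (λ e → trans (const-pair double is-double e) (cong (true xor_) ε≡))) (toℕ v)
    by-ε true  ε≡ = by-parity (odd q) refl
      where
      q = (δ + δ) / c
      d+δ : idx (toℕ double + δ) ≡ zeros
      d+δ = find-zero _ (λ e → trans (const-pair double is-double e) (cong (true xor_) ε≡))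
      z+δ : idx (toℕ zeros + δ) ≡ double
      z+δ = find-double _ (λ e → trans (const-pair zeros is-zero e) (cong (false xor_) ε≡))
      d+2δ : idx (toℕ double + (δ + δ)) ≡ double
      d+2δ = trans (cong idx (sym (+-assoc (toℕ double) δ δ)))
        (trans (idx-cong-+ δ (trans d+δ (sym (idx-toℕ zeros)))) z+δ)
      2δ≡ : δ + δ ≡ q * c
      2δ≡ = trans (m≡m%n+[m/n]*n (δ + δ) c) (cong (_+ q * c) (begin
        (δ + δ) % c       ≡⟨ toℕ-mod (δ + δ) ⟨
        toℕ (idx (δ + δ)) ≡⟨ cong toℕ (fixed double d+2δ 0) ⟩
        toℕ (idx 0)       ≡⟨ toℕ-mod 0 ⟩
        0 % c             ≡⟨ m*n%n≡0 0 c ⟩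
        0                 ∎))
        where open ≡-Reasoning
      by-parity : ∀ o → odd q ≡ o → idx (toℕ v + δ) ≡ idx (toℕ v)
      by-parity false q-even with half q
      ... | k , q≡ = trans (cong (λ z → idx (toℕ v + z)) δ≡) (idx-+kc (toℕ v) k)
        where
        δ≡ : δ ≡ k * c
        δ≡ = *-cancelˡ-≡ δ (k * c) 2 (begin
          2 * δ            ≡⟨ cong (δ +_) (+-identityʳ δ) ⟩
          δ + δ            ≡⟨ trans 2δ≡ (cong (_* c) (trans q≡ (cong (λ z → ⟦ z ⟧ + (k + k)) q-even))) ⟩
          (k + k) * c      ≡⟨ solve 2 (λ k c → (k :+ k) :* c := con 2 :* (k :* c)) refl k c ⟩
          2 * (k * c)      ∎)
          where open ≡-Reasoning
      -- For odd `q` the rotation by `δ + δ`, which fixes `f`, exchanges the two points of pair `i`,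
      -- where `f` takes different values.
      by-parity true q-odd = ⊥-elim (not-x≢x (begin
          f x                          ≡⟨ twice f per (toℕ i) ⟨
          f (pt (toℕ i + (δ + δ)))     ≡⟨ cong (λ z → f (pt (toℕ i + z))) 2δ≡ ⟩
          f (pt (toℕ i + q * c))       ≡⟨ cong f (trans (pt-+kc (toℕ i) q) (cong (λ o → idx (toℕ i) , o xor _) q-odd)) ⟩
          f (antipode x)               ≡⟨ single-antipode {f} (subst (Single f) (sym (idx-toℕ i)) (others i i≢d i≢z)) _ ⟩
          not (f x)                    ∎))
        where
        open ≡-Reasoning
        x = pt (toℕ i)

    idx-v+δ : idx (toℕ v + δ) ≡ idx (toℕ v)
    idx-v+δ = by-ε ε refl

  turn : ℕ → Permutation′ c
  turn d = mk↔ₛ′ (λ i → idx (toℕ i + d)) (λ i → idx (toℕ i + neg d))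
    (λ i → back-and-forth i (neg d) d (pt-neg-+ (toℕ i) d))
    (λ i → back-and-forth i d (neg d) (pt-+-neg (toℕ i) d))
    where
    back-and-forth : ∀ i d e → pt (toℕ i + d + e) ≡ pt (toℕ i) → idx (toℕ (idx (toℕ i + d)) + e) ≡ i
    back-and-forth i d e eq = trans (idx-cong-+ e (idx-toℕ (idx (toℕ i + d)))) (trans (idx-pt eq) (idx-toℕ i))

  pairSum : (Point → Bool) → Fin c → ℕ
  pairSum f i = ⟦ f (i , false) ⟧ + ⟦ f (i , true) ⟧

  count : (Point → Bool) → ℕ
  count f = sum (pairSum f)

  Doubled : (Point → Bool) → Fin c → Set
  Doubled f i = f (i , false) ≡ true × f (i , true) ≡ true

  module _ {d f f′} (shift : Shifted d f f′) where

    -- A rotation carries pairs to pairs; `o` tells whether the two points of the pair change roles.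
    shift-pair : ∀ i → ∃ λ o → ∀ e → f′ (idx (toℕ i + d) , e xor o) ≡ f (i , e)
    shift-pair i = odd ((toℕ i + d) / c) , λ e → begin
      f′ (idx (toℕ i + d) , e xor odd ((toℕ i + d) / c))
        ≡⟨ cong (λ b → f′ (idx (toℕ i + d) , b xor odd ((toℕ i + d) / c))) (odd-⟦⟧ e) ⟨
      f′ (idx (toℕ i + d) , odd ⟦ e ⟧ xor odd ((toℕ i + d) / c))
        ≡⟨ cong f′ (pt-+kc (toℕ i + d) ⟦ e ⟧) ⟨
      f′ (pt (toℕ i + d + ⟦ e ⟧ * c))
        ≡⟨ cong (f′ ∘ pt) (solve 3 (λ i d k → i :+ d :+ k := i :+ k :+ d) refl (toℕ i) d (⟦ e ⟧ * c)) ⟩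
      f′ (pt (toℕ i + ⟦ e ⟧ * c + d))
        ≡⟨ shift (toℕ i + ⟦ e ⟧ * c) ⟩
      f (pt (num (i , e)))
        ≡⟨ cong f (pt-num (i , e)) ⟩
      f (i , e) ∎
      where
      open ≡-Reasoning
      odd-⟦⟧ : ∀ e → odd ⟦ e ⟧ ≡ e
      odd-⟦⟧ false = refl
      odd-⟦⟧ true  = refl

    single-shift : ∀ {i} → Single f i → Single f′ (idx (toℕ i + d))
    single-shift {i} s with shift-pair i
    ... | false , eq = trans (eq true) (trans s (cong not (sym (eq false))))
    ... | true  , eq = antipode-single {f′} true (trans (eq true) (trans s (cong not (sym (eq false)))))

    doubled-shift : ∀ {i} → Doubled f i → Doubled f′ (idx (toℕ i + d))
    doubled-shift {i} (d₀ , d₁) with shift-pair i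
    ... | false , eq = trans (eq false) d₀ , trans (eq true) d₁
    ... | true  , eq = trans (eq true) d₁ , trans (eq false) d₀

    pairSum-shift : ∀ i → pairSum f′ (idx (toℕ i + d)) ≡ pairSum f i
    pairSum-shift i with shift-pair i
    ... | false , eq = cong₂ (λ x y → ⟦ x ⟧ + ⟦ y ⟧) (eq false) (eq true)
    ... | true  , eq = trans (+-comm ⟦ f′ (idx (toℕ i + d) , false) ⟧ _)
                         (cong₂ (λ x y → ⟦ x ⟧ + ⟦ y ⟧) (eq false) (eq true))

    count-shift : count f′ ≡ count f
    count-shift = trans (sum-permute (pairSum f′) (turn d)) (sum-cong-≗ pairSum-shift)

  antipodal-shift : ∀ {d f f′} → Shifted d f f′ → Antipodal f → Antipodal f′
  antipodal-shift {d} {f} {f′} shift anti i = subst (Single f′) (Inverse.inverseˡ (turn d) refl)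
    (single-shift {d} {f} {f′} shift (anti (turn d ⟨$⟩ˡ i)))

  antipodal-complement : ∀ f → Antipodal f → Antipodal (not ∘ f)
  antipodal-complement f anti i = cong not (anti i)

  sum-one : ∀ n {f : Fin n → ℕ} → (∀ i → f i ≡ 1) → sum f ≡ n
  sum-one n eq = trans (sum-const n eq) (*-identityʳ n)

  antipodal⇒count : ∀ {f} → Antipodal f → count f ≡ c
  antipodal⇒count {f} anti = sum-one c (λ i → trans (cong (λ x → ⟦ f (i , false) ⟧ + ⟦ x ⟧) (anti i)) (one (f (i , false))))
    where
    one : ∀ b → ⟦ b ⟧ + ⟦ not b ⟧ ≡ 1
    one false = refl
    one true  = refl

  count-complement : ∀ f → count f + count (not ∘ f) ≡ c + c
  count-complement f = trans (sym (∑-distrib-+ {c} _ _)) (trans (sum-const c (λ i → two (f (i , false)) (f (i , true))))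
    (trans (*-comm c 2) (cong (c +_) (+-identityʳ c))))
    where
    two : ∀ x y → ⟦ x ⟧ + ⟦ y ⟧ + (⟦ not x ⟧ + ⟦ not y ⟧) ≡ 2
    two false false = refl
    two false true  = refl
    two true  false = refl
    two true  true  = refl

  -- The lift of peak f to a point on which f holds; this makes sense when f is antipodal.
  lift : (Point → Bool) → ℕ
  lift f = peak f + ⟦ not (f (pt (peak f))) ⟧ * c

  idx-lift : ∀ f → idx (lift f) ≡ idx (peak f)
  idx-lift f = idx-+kc (peak f) ⟦ not (f (pt (peak f))) ⟧

  lift-holds : ∀ f → Antipodal f → f (pt (lift f)) ≡ true
  lift-holds f anti with f (pt (peak f)) in eq
  ... | true  = trans (cong (f ∘ pt) (+-identityʳ (peak f))) eq
  ... | false = trans (cong (f ∘ pt) (cong (peak f +_) (+-identityʳ c))) (trans (cong f (pt-+c (peak f)))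
                  (trans (single-antipode {f} (anti _) (proj₂ (pt (peak f)))) (cong not eq)))

  holds-unique : ∀ f → Antipodal f → ∀ {x y} → proj₁ x ≡ proj₁ y → f x ≡ true → f y ≡ true → x ≡ y
  holds-unique f anti {i , false} {.i , false} refl _ _ = refl
  holds-unique f anti {i , true}  {.i , true}  refl _ _ = refl
  holds-unique f anti {i , false} {.i , true}  refl fx fy = ⊥-elim (true≢false (trans (sym fy) (trans (anti i) (cong not fx))))
  holds-unique f anti {i , true}  {.i , false} refl fx fy = ⊥-elim (true≢false (trans (sym fx) (trans (anti i) (cong not fy))))

  -- Peaks are known only modulo `c`. Both angles lie in the same pair, and `f′` holds at both,
  -- which settles the half of the cycle.
  lift-shift : ∀ {d f f′} → Shifted d f f′ → Rigid f → Antipodal f → pt (lift f′) ≡ pt (lift f + d)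
  lift-shift {d} {f} {f′} shift rig anti = holds-unique f′ anti′
    (trans (idx-lift f′) (trans (peak-shift {d} {f} {f′} shift rig) (idx-cong-+ d (sym (idx-lift f)))))
    (lift-holds f′ anti′) (trans (shift (lift f)) (lift-holds f anti))
    where anti′ = antipodal-shift {d} {f} {f′} shift anti

  -- The complement has its peak in the same pair but holds at the opposite point.
  lift-complement : ∀ f → Rigid f → Antipodal f → pt (lift (not ∘ f)) ≡ pt (lift f + c)
  lift-complement f rig anti = holds-unique (not ∘ f) anti′
    (trans (idx-lift (not ∘ f)) (trans (peak-complement f rig) (trans (sym (idx-lift f)) (cong proj₁ (sym (pt-+c (lift f)))))))
    (lift-holds (not ∘ f) anti′)
    (cong not (trans (cong f (pt-+c (lift f))) (trans (single-antipode {f} (anti _) (proj₂ (pt (lift f)))) (cong not (lift-holds f anti)))))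
    where anti′ = antipodal-complement f anti

  sum-idx : ∀ {n} {g g′ : Fin n → ℕ} → (∀ i → idx (g i) ≡ idx (g′ i)) → idx (sum g) ≡ idx (sum g′)
  sum-idx {zero}  eq = refl
  sum-idx {suc n} eq = idx-cong-+₂ (eq zero) (sum-idx (eq ∘ suc))

  sum-pt : ∀ {n} {g g′ : Fin n → ℕ} → (∀ i → pt (g i) ≡ pt (g′ i)) → pt (sum g) ≡ pt (sum g′)
  sum-pt {zero}  eq = refl
  sum-pt {suc n} eq = pt-cong-+₂ (eq zero) (sum-pt (eq ∘ suc))

-- Boards of even size

module Even (h a B c : ℕ) .{{_ : NonZero c}} (B≡ : B ≡ suc (h + h)) (c≡ : c ≡ 2 ^ a) where

  open Block c

  X : Set
  X = Fin B × Point

  n : ℕ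
  n = B * (c * 2)

  board : Fin n ↔ X
  board = (↔-id (Fin B) ×-↔ ((↔-id (Fin c) ×-↔ Fin.2↔Bool) ↔-∘ Fin.*↔×)) ↔-∘ Fin.*↔×

  open Board board public

  antipodal-rigid : ∀ f → Antipodal f → Rigid f
  antipodal-rigid f = antipodal⇒rigid {a} c≡ {f}

  -- The cyclic tournament on the blocks: j is one of the h successors of i.
  Arrow : Fin B → Fin B → Set
  Arrow i j = (toℕ i < toℕ j × toℕ j ≤ toℕ i + h) ⊎ toℕ j + h < toℕ i

  arrow? : ∀ i j → Dec (Arrow i j)
  arrow? i j = ((toℕ i <? toℕ j) ×-dec (toℕ j ≤? toℕ i + h)) ⊎-dec (toℕ j + h <? toℕ i)

  arrow-asym : ∀ {i j} → Arrow i j → Arrow j i → ⊥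
  arrow-asym (inj₁ (i<j , _)) (inj₁ (j<i , _)) = <-asym i<j j<i
  arrow-asym (inj₁ (_ , j≤)) (inj₂ i+h<j) = <⇒≱ i+h<j j≤
  arrow-asym (inj₂ j+h<i) (inj₁ (_ , i≤)) = <⇒≱ j+h<i i≤
  arrow-asym (inj₂ j+h<i) (inj₂ i+h<j) = <-asym (≤-<-trans (m≤m+n _ h) j+h<i) (≤-<-trans (m≤m+n _ h) i+h<j)

  arrow-irrefl : ∀ {i} → Arrow i i → ⊥
  arrow-irrefl x = arrow-asym x x

  blk : (X → Bool) → Fin B → Point → Bool
  blk F k x = F (k , x)

  N₁ : (X → Bool) → Set
  N₁ F = ∃ λ i → ∃ λ j → Arrow i j × count (blk F i) ≡ suc c × suc (count (blk F j)) ≡ c ×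
         (∀ k → k ≢ i → k ≢ j → count (blk F k) ≡ c)

  -- When the blocks are rotated, each entry moves by the angle of its block, provided the other
  -- blocks are rigid. Angles with total 0 therefore leave the sum unchanged modulo `c`.
  weight : (X → Bool) → Fin B → Fin c → Fin B → ℕ
  weight F ℓ i k with k Fin.≟ ℓ
  ... | yes _ = toℕ i
  ... | no _  = peak (blk F k)

  -- The distance from the pair i of block ℓ to a pair that the other blocks of F single out.
  val : (X → Bool) → Fin B → Fin c → ℕ
  val F ℓ i = toℕ (idx (sum (weight F ℓ i)))

  Leads : (X → Bool) → Fin B → Fin c → Set
  Leads F ℓ d = Doubled (blk F ℓ) d × (∀ j → val F ℓ j < val F ℓ d → Single (blk F ℓ) j)

  -- Rigidity makes `val` invariant. The last alternative prevents a set and its complement from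
  -- having different leading blocks: neither of these could be antipodal, so there would be arrows
  -- both ways.
  N₂ : (X → Bool) → Set
  N₂ F = (∀ k → count (blk F k) ≡ c) × ∃ λ ℓ → (∃ λ d → Leads F ℓ d) ×
         (∀ k → k ≢ ℓ → Rigid (blk F k) × (Antipodal (blk F k) ⊎ Arrow k ℓ))

  heights : (X → Bool) → Fin B → ℕ
  heights F k = lift (blk F k)

  -- The second component of `pt` tells in which half of the cycle the sum of the heights lies.
  -- Complementing every block adds an odd multiple of `c`, hence changes the half.
  N₃ : (X → Bool) → Set
  N₃ F = (∀ k → Antipodal (blk F k)) × proj₂ (pt (sum (heights F))) ≡ false

  N : (X → Bool) → Set
  N F = N₁ F ⊎ N₂ F ⊎ N₃ F

  N? : ∀ F → Dec (N F)
  N? F = N₁? ⊎-dec N₂? ⊎-dec N₃?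
    where
    single? : ∀ f i → Dec (Single f i)
    single? f i = f (i , true) Data.Bool.≟ not (f (i , false))
    antipodal? : ∀ f → Dec (Antipodal f)
    antipodal? f = Fin.all? (single? f)
    N₁? = Fin.any? λ i → Fin.any? λ j → arrow? i j ×-dec (count (blk F i) ≟ suc c) ×-dec (suc (count (blk F j)) ≟ c)
      ×-dec Fin.all? λ k → ¬? (k Fin.≟ i) →-dec ¬? (k Fin.≟ j) →-dec (count (blk F k) ≟ c)
    N₂? = Fin.all? (λ k → count (blk F k) ≟ c) ×-dec Fin.any? λ ℓ →
      Fin.any? (λ d → ((blk F ℓ (d , false) Data.Bool.≟ true) ×-dec (blk F ℓ (d , true) Data.Bool.≟ true))
        ×-dec Fin.all? λ j → (val F ℓ j <? val F ℓ d) →-dec single? (blk F ℓ) j)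
      ×-dec Fin.all? λ k → ¬? (k Fin.≟ ℓ) →-dec (rigid? (blk F k) ×-dec (antipodal? (blk F k) ⊎-dec arrow? k ℓ))
    N₃? = Fin.all? (λ k → antipodal? (blk F k)) ×-dec (proj₂ (pt (sum (heights F))) Data.Bool.≟ false)

  weight-self : ∀ F ℓ i → weight F ℓ i ℓ ≡ toℕ i
  weight-self F ℓ i with ℓ Fin.≟ ℓ
  ... | yes _  = refl
  ... | no ℓ≢ℓ = ⊥-elim (ℓ≢ℓ refl)

  weight-other : ∀ F {ℓ} i {k} → k ≢ ℓ → weight F ℓ i k ≡ peak (blk F k)
  weight-other F {ℓ} i {k} k≢ℓ with k Fin.≟ ℓ
  ... | yes k≡ℓ = ⊥-elim (k≢ℓ k≡ℓ)
  ... | no _    = refl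

  val-cong : ∀ {F G} ℓ → (∀ k → k ≢ ℓ → blk F k ≗ blk G k) → ∀ i → val F ℓ i ≡ val G ℓ i
  val-cong {F} {G} ℓ same i = cong (toℕ ∘ idx) (sum-cong-≗ weights)
    where
    weights : ∀ k → weight F ℓ i k ≡ weight G ℓ i k
    weights k with k Fin.≟ ℓ
    ... | yes _  = refl
    ... | no k≢ℓ = peak-cong (same k k≢ℓ)

  -- Replacing `i` by `j` changes the sum by their difference modulo `c`. So `val` arranges the
  -- pairs of block `ℓ` in a strict order.
  val-injective : ∀ F ℓ {i j} → val F ℓ i ≡ val F ℓ j → i ≡ j
  val-injective F ℓ {i} {j} eq = trans (sym (idx-toℕ i)) (trans (idx-cancel-+ (sum (weight F ℓ j))
    (begin
      idx (toℕ i + sum (weight F ℓ j))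
        ≡⟨ cong idx (trans (+-comm (toℕ i) _) (trans
             (sum-exchange ℓ (λ k k≢ → trans (weight-other F j k≢) (sym (weight-other F i k≢)))
               (trans (cong (_+ toℕ i) (weight-self F ℓ j)) (trans (+-comm (toℕ j) (toℕ i))
                 (cong (_+ toℕ j) (sym (weight-self F ℓ i)))))) (+-comm _ (toℕ j)))) ⟩
      idx (toℕ j + sum (weight F ℓ i))
        ≡⟨ cong idx (+-comm (toℕ j) _) ⟩
      idx (sum (weight F ℓ i) + toℕ j)
        ≡⟨ idx-cong-+ {sum (weight F ℓ i)} (toℕ j) (Fin.toℕ-injective eq) ⟩
      idx (sum (weight F ℓ j) + toℕ j)
        ≡⟨ cong idx (+-comm _ (toℕ j)) ⟩
      idx (toℕ j + sum (weight F ℓ j)) ∎)) (idx-toℕ j))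
    where open ≡-Reasoning

  -- Invariance of `N`

  -- `F′` is only related to `F`, not computed from it, so one proof covers the shift of the blocks,
  -- the rotations, and the replacement of `F` by a pointwise equal function.
  module Invariance (π : Permutation′ B) (σ : Fin B → ℕ) (Σσ≡0 : pt (sum σ) ≡ pt 0)
                    (π-arrow : ∀ {i j} → Arrow i j → Arrow (π ⟨$⟩ʳ i) (π ⟨$⟩ʳ j))
                    {F F′ : X → Bool} (shift : ∀ k → Shifted (σ k) (blk F k) (blk F′ (π ⟨$⟩ʳ k))) where

    onto : ∀ {P : Fin B → Set} → (∀ k → P (π ⟨$⟩ʳ k)) → ∀ k → P k
    onto {P} p k = subst P (Inverse.inverseˡ π refl) (p (π ⟨$⟩ˡ k))

    π-injective : ∀ {i j} → π ⟨$⟩ʳ i ≡ π ⟨$⟩ʳ j → i ≡ j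
    π-injective {i} {j} eq = trans (sym (Inverse.inverseʳ π refl)) (trans (cong (π ⟨$⟩ˡ_) eq) (Inverse.inverseʳ π refl))

    count-eq : ∀ k → count (blk F′ (π ⟨$⟩ʳ k)) ≡ count (blk F k)
    count-eq k = count-shift {σ k} {blk F k} {blk F′ (π ⟨$⟩ʳ k)} (shift k)

    preserve₁ : N₁ F → N₁ F′
    preserve₁ (i , j , i→j , ci , cj , ck) = π ⟨$⟩ʳ i , π ⟨$⟩ʳ j , π-arrow i→j , trans (count-eq i) ci ,
      trans (cong suc (count-eq j)) cj ,
      onto λ k k≢i k≢j → trans (count-eq k) (ck k (k≢i ∘ cong (π ⟨$⟩ʳ_)) (k≢j ∘ cong (π ⟨$⟩ʳ_)))

    sum-preserved : ∀ {g g′ : Fin B → ℕ} → (∀ k → idx (g′ (π ⟨$⟩ʳ k)) ≡ idx (g k + σ k)) → idx (sum g′) ≡ idx (sum g)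
    sum-preserved {g} {g′} eq = begin
      idx (sum g′)                    ≡⟨ cong idx (sum-permute g′ π) ⟩
      idx (sum (λ k → g′ (π ⟨$⟩ʳ k))) ≡⟨ sum-idx eq ⟩
      idx (sum (λ k → g k + σ k))     ≡⟨ cong idx (∑-distrib-+ {B} g σ) ⟩
      idx (sum g + sum σ)             ≡⟨ cong proj₁ (pt-cong-+₂ {sum g} {sum g} refl Σσ≡0) ⟩
      idx (sum g + 0)                 ≡⟨ cong idx (+-identityʳ _) ⟩
      idx (sum g)                     ∎
      where open ≡-Reasoning

    preserve₂ : N₂ F → N₂ F′
    preserve₂ (balanced , ℓ , (d , doubled , first) , rest) =
      onto (λ k → trans (count-eq k) (balanced k)) , π ⟨$⟩ʳ ℓ ,
      (moved d , doubled-shift {σ ℓ} {blk F ℓ} {blk F′ (π ⟨$⟩ʳ ℓ)} (shift ℓ) doubled ,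
        λ j′ → subst (λ j → val F′ (π ⟨$⟩ʳ ℓ) j < val F′ (π ⟨$⟩ʳ ℓ) (moved d) → Single (blk F′ (π ⟨$⟩ʳ ℓ)) j)
          (Inverse.inverseˡ (turn (σ ℓ)) refl)
          λ lt → single-shift {σ ℓ} {blk F ℓ} {blk F′ (π ⟨$⟩ʳ ℓ)} (shift ℓ)
            (first _ (subst₂ _<_ (val-eq (turn (σ ℓ) ⟨$⟩ˡ j′)) (val-eq d) lt))) ,
      onto λ k k≢ → let k≢ℓ = k≢ ∘ cong (π ⟨$⟩ʳ_) in
        rigid-shift {σ k} {blk F k} {blk F′ (π ⟨$⟩ʳ k)} (shift k) (proj₁ (rest k k≢ℓ)) ,
        [ inj₁ ∘ antipodal-shift {σ k} {blk F k} {blk F′ (π ⟨$⟩ʳ k)} (shift k) , inj₂ ∘ π-arrow ]′ (proj₂ (rest k k≢ℓ))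
      where
      moved : Fin c → Fin c
      moved i = idx (toℕ i + σ ℓ)
      val-eq : ∀ i → val F′ (π ⟨$⟩ʳ ℓ) (moved i) ≡ val F ℓ i
      val-eq i = cong toℕ (sum-preserved λ k → by-cases k (k Fin.≟ ℓ))
        where
        by-cases : ∀ k → Dec (k ≡ ℓ) → idx (weight F′ (π ⟨$⟩ʳ ℓ) (moved i) (π ⟨$⟩ʳ k)) ≡ idx (weight F ℓ i k + σ k)
        by-cases k (yes refl) = trans (cong idx (weight-self F′ (π ⟨$⟩ʳ ℓ) (moved i)))
          (trans (idx-toℕ (moved i)) (cong (λ w → idx (w + σ ℓ)) (sym (weight-self F ℓ i))))
        by-cases k (no k≢ℓ) = trans (cong idx (weight-other F′ (moved i) (k≢ℓ ∘ π-injective)))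
          (trans (peak-shift {σ k} {blk F k} {blk F′ (π ⟨$⟩ʳ k)} (shift k) (proj₁ (rest k k≢ℓ)))
            (cong (λ w → idx (w + σ k)) (sym (weight-other F i k≢ℓ))))

    preserve₃ : N₃ F → N₃ F′
    preserve₃ (anti , lower) = onto (λ k → antipodal-shift {σ k} {blk F k} {blk F′ (π ⟨$⟩ʳ k)} (shift k) (anti k)) ,
      trans (cong proj₂ (begin
        pt (sum (heights F′))                    ≡⟨ cong pt (sum-permute (heights F′) π) ⟩
        pt (sum (λ k → heights F′ (π ⟨$⟩ʳ k)))
          ≡⟨ sum-pt (λ k → lift-shift {σ k} {blk F k} {blk F′ (π ⟨$⟩ʳ k)} (shift k) (antipodal-rigid (blk F k) (anti k)) (anti k)) ⟩
        pt (sum (λ k → heights F k + σ k))       ≡⟨ cong pt (∑-distrib-+ {B} (heights F) σ) ⟩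
        pt (sum (heights F) + sum σ)             ≡⟨ pt-cong-+₂ {sum (heights F)} {sum (heights F)} refl Σσ≡0 ⟩
        pt (sum (heights F) + 0)                 ≡⟨ cong pt (+-identityʳ _) ⟩
        pt (sum (heights F))                     ∎)) lower
      where open ≡-Reasoning

    preserve : N F → N F′
    preserve (inj₁ n₁) = inj₁ (preserve₁ n₁)
    preserve (inj₂ (inj₁ n₂)) = inj₂ (inj₁ (preserve₂ n₂))
    preserve (inj₂ (inj₂ n₃)) = inj₂ (inj₂ (preserve₃ n₃))

  N-resp-≗ : ∀ {F F′} → F ≗ F′ → N F → N F′
  N-resp-≗ {F} {F′} F≗F′ = Invariance.preserve Data.Fin.Permutation.id (λ _ → 0)
    (cong pt (trans (sum-const B (λ _ → refl)) (*-zeroʳ B))) id {F} {F′}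
    (λ k v → trans (sym (F≗F′ _)) (cong (λ u → F (k , pt u)) (+-identityʳ v)))

  -- No set belongs to `N` together with its complement

  single-not-doubled : ∀ {f i} → Single f i → Doubled f i → ⊥
  single-not-doubled s (f₀ , f₁) = true≢false (trans (sym f₁) (trans s (cong not f₀)))

  single-not-zero : ∀ {f i} → Single f i → Doubled (not ∘ f) i → ⊥
  single-not-zero s (f₀ , f₁) = not-x≢x (trans (sym f₀) (trans (sym s) (trans (sym (not-involutive _)) (cong not f₁))))

  -- Complementing turns an excess into a deficit, so two members of `N₁` would reverse an arrow.
  -- `N₁` is unbalanced, unlike `N₂` and `N₃`; a doubled pair separates `N₂` from `N₃`. For two
  -- members of `N₂` with the same leading block, `val` is the same, so the first pair that is not
  -- split would lie in both sets; different leading blocks are excluded by the arrows.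
  exclusive : ∀ {F} → N F → N (not ∘ F) → ⊥
  exclusive {F} = cases
    where
    count′ : ∀ k → count (blk F k) + count (blk (not ∘ F) k) ≡ c + c
    count′ k = count-complement (blk F k)
    more : ∀ k → count (blk F k) ≡ suc c → suc (count (blk (not ∘ F) k)) ≡ c
    more k eq = +-cancelˡ-≡ c _ _ (trans (+-suc c _) (trans (cong (_+ count (blk (not ∘ F) k)) (sym eq)) (count′ k)))
    less : ∀ k → suc (count (blk F k)) ≡ c → count (blk (not ∘ F) k) ≡ suc c
    less k eq = +-cancelˡ-≡ (count (blk F k)) _ _ (trans (count′ k) (trans (cong (_+ c) (sym eq)) (sym (+-suc _ c))))
    even : ∀ k → count (blk F k) ≡ c → count (blk (not ∘ F) k) ≡ c
    even k eq = +-cancelˡ-≡ c _ _ (trans (cong (_+ count (blk (not ∘ F) k)) (sym eq)) (count′ k))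

    val′ : ∀ {ℓ} → (∀ k → k ≢ ℓ → Rigid (blk F k)) → ∀ i → val (not ∘ F) ℓ i ≡ val F ℓ i
    val′ {ℓ} rig i = cong toℕ (sum-idx same)
      where
      same : ∀ k → idx (weight (not ∘ F) ℓ i k) ≡ idx (weight F ℓ i k)
      same k with k Fin.≟ ℓ
      ... | yes _  = refl
      ... | no k≢ℓ = peak-complement (blk F k) (rig k k≢ℓ)

    unbalanced : N₁ F → (∀ k → count (blk (not ∘ F) k) ≡ c) → ⊥
    unbalanced (i , _ , _ , ci , _) bal = 1+n≢n (trans (more i ci) (sym (bal i)))
    unbalanced′ : (∀ k → count (blk F k) ≡ c) → N₁ (not ∘ F) → ⊥
    unbalanced′ bal (i , _ , _ , ci , _) = 1+n≢n (trans (sym ci) (even i (bal i)))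

    cases : N F → N (not ∘ F) → ⊥
    cases (inj₁ (i , j , i→j , ci , cj , _)) (inj₁ (i′ , j′ , i′→j′ , ci′ , cj′ , ck′))
      with i Fin.≟ i′ | i Fin.≟ j′ | j Fin.≟ i′ | j Fin.≟ j′
    ... | yes refl | _ | _ | _ = m≢1+n+m c {1} (trans (sym (more i ci)) (cong suc ci′))
    ... | no i≢i′ | no i≢j′ | _ | _ = 1+n≢n (trans (more i ci) (sym (ck′ i i≢i′ i≢j′)))
    ... | no _ | yes refl | yes refl | _ = arrow-asym i→j i′→j′
    ... | no _ | yes refl | no _ | yes refl = arrow-irrefl i→j
    ... | no _ | yes refl | no j≢i′ | no j≢j′ = 1+n≢n (trans (sym (less j cj)) (ck′ j j≢i′ j≢j′))
    cases (inj₁ n₁) (inj₂ (inj₁ (bal , _))) = unbalanced n₁ bal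
    cases (inj₁ n₁) (inj₂ (inj₂ (anti , _))) = unbalanced n₁ (λ k → antipodal⇒count {blk (not ∘ F) k} (anti k))
    cases (inj₂ (inj₁ (bal , _))) (inj₁ n₁) = unbalanced′ bal n₁
    cases (inj₂ (inj₂ (anti , _))) (inj₁ n₁) = unbalanced′ (λ k → antipodal⇒count {blk F k} (anti k)) n₁
    cases (inj₂ (inj₁ (_ , ℓ , (d , dbl , first) , rest))) (inj₂ (inj₁ (_ , ℓ′ , (d′ , dbl′ , first′) , rest′)))
      with ℓ Fin.≟ ℓ′
    ... | yes refl with <-cmp (val F ℓ d) (val F ℓ d′)
    ...   | tri< lt _ _ = single-not-zero {not ∘ blk F ℓ} (first′ d (subst₂ _<_ (sym (val′ rig d)) (sym (val′ rig d′)) lt))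
              (trans (not-involutive _) (proj₁ dbl) , trans (not-involutive _) (proj₂ dbl))
      where rig = λ k k≢ → proj₁ (rest k k≢)
    ...   | tri> _ _ gt = single-not-zero {blk F ℓ} (first d′ gt) dbl′
    ...   | tri≈ _ eq _ = true≢false (trans (sym (proj₁ dbl)) (trans (sym (not-involutive _))
              (cong not (subst (λ i → not (F (ℓ , i , false)) ≡ true) (sym (val-injective F ℓ eq)) (proj₁ dbl′)))))
    cases (inj₂ (inj₁ (_ , ℓ , (d , dbl , first) , rest))) (inj₂ (inj₁ (_ , ℓ′ , (d′ , dbl′ , first′) , rest′)))
        | no ℓ≢ℓ′ with proj₂ (rest ℓ′ (ℓ≢ℓ′ ∘ sym)) | proj₂ (rest′ ℓ ℓ≢ℓ′)
    ... | inj₁ anti | _ = single-not-zero {blk F ℓ′} (anti d′) dbl′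
    ... | inj₂ _ | inj₁ anti = single-not-zero {not ∘ blk F ℓ} (anti d) (trans (not-involutive _) (proj₁ dbl) , trans (not-involutive _) (proj₂ dbl))
    ... | inj₂ ℓ′→ℓ | inj₂ ℓ→ℓ′ = arrow-asym ℓ′→ℓ ℓ→ℓ′
    cases (inj₂ (inj₁ (_ , ℓ , (d , dbl , _) , _))) (inj₂ (inj₂ (anti , _))) =
      single-not-zero {not ∘ blk F ℓ} (anti ℓ d) (trans (not-involutive _) (proj₁ dbl) , trans (not-involutive _) (proj₂ dbl))
    cases (inj₂ (inj₂ (anti , _))) (inj₂ (inj₁ (_ , ℓ , (d , dbl , _) , _))) = single-not-zero {blk F ℓ} (anti ℓ d) dbl
    -- Each of the `B` lifts moves by `c`, and `B` is odd, so the two sums lie in different halves.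
    cases (inj₂ (inj₂ (anti , low))) (inj₂ (inj₂ (_ , low′))) = true≢false (trans (sym (cong not low)) (trans (sym (begin
        proj₂ (pt (sum (heights (not ∘ F))))
          ≡⟨ cong proj₂ (sum-pt (λ k → lift-complement (blk F k) (antipodal-rigid (blk F k) (anti k)) (anti k))) ⟩
        proj₂ (pt (sum (λ k → heights F k + c)))
          ≡⟨ cong (proj₂ ∘ pt) (trans (∑-distrib-+ {B} (heights F) (λ _ → c)) (cong (sum (heights F) +_) (sum-const B (λ _ → refl)))) ⟩
        proj₂ (pt (sum (heights F) + B * c))
          ≡⟨ cong proj₂ (pt-+kc (sum (heights F)) B) ⟩
        odd B xor proj₂ (pt (sum (heights F)))
          ≡⟨ cong (λ o → o xor odd (sum (heights F) / c)) (trans (cong odd B≡) (cong not (odd-even h))) ⟩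
        not (proj₂ (pt (sum (heights F)))) ∎)) low′))
      where open ≡-Reasoning

  -- Changes in single blocks and transitivity on even boards

  delta : Fin B → ℕ → Fin B → ℕ
  delta u x k with k Fin.≟ u
  ... | yes _ = x
  ... | no _  = 0

  delta-at : ∀ u {x} → delta u x u ≡ x
  delta-at u with u Fin.≟ u
  ... | yes _  = refl
  ... | no u≢u = ⊥-elim (u≢u refl)

  delta-other : ∀ {u x} k → k ≢ u → delta u x k ≡ 0
  delta-other {u} k k≢u with k Fin.≟ u
  ... | yes k≡u = ⊥-elim (k≢u k≡u)
  ... | no _    = refl

  sum-delta : ∀ u x → sum (delta u x) ≡ x
  sum-delta u x = trans (sym (+-identityʳ _)) (trans
    (sum-exchange {f = λ _ → 0} {g = delta u x} {x = 0} {y = x} u delta-other (trans (+-identityʳ _) (delta-at u)))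
    (cong (_+ x) (trans (sum-const B (λ _ → refl)) (*-zeroʳ B))))

  delta-+ : ∀ u x y k → delta u x k + delta u y k ≡ delta u (x + y) k
  delta-+ u x y k with k Fin.≟ u
  ... | yes _ = refl
  ... | no _  = refl

  delta-* : ∀ u x k → delta u x k ≡ delta u 1 k * x
  delta-* u x k with k Fin.≟ u
  ... | yes _ = sym (+-identityʳ x)
  ... | no _  = refl

  copy : ∀ {f f′} → f′ ≗ f → Shifted 0 f f′
  copy {f} f′≗f v = trans (f′≗f _) (cong (f ∘ pt) (+-identityʳ v))

  -- Complementing one block toggles the alternative in N₃.
  antipodal-or-flipped : ∀ {F F′ u} → (∀ k → Antipodal (blk F k)) →
                         (∀ k → k ≢ u → blk F′ k ≗ blk F k) → (blk F′ u ≗ not ∘ blk F u) → N₃ F ⊎ N₃ F′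
  antipodal-or-flipped {F} {F′} {u} anti same flipped = by-height (proj₂ (pt (sum (heights F)))) refl
    where
    open ≡-Reasoning
    anti′ : ∀ k → Antipodal (blk F′ k)
    anti′ k with k Fin.≟ u
    ... | yes refl = antipodal-shift {0} {not ∘ blk F u} {blk F′ u} (copy flipped) (antipodal-complement (blk F u) (anti u))
    ... | no k≢u   = antipodal-shift {0} {blk F k} {blk F′ k} (copy (same k k≢u)) (anti k)
    lifted : ∀ {f f′} → f′ ≗ f → Antipodal f → pt (lift f′) ≡ pt (lift f)
    lifted {f} {f′} eq anti = trans (lift-shift {0} {f} {f′} (copy eq) (antipodal-rigid f anti) anti) (cong pt (+-identityʳ _))
    pointwise : ∀ k → pt (heights F′ k) ≡ pt (heights F k + delta u c k)
    pointwise k with k Fin.≟ u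
    ... | yes refl = trans (lifted flipped (antipodal-complement (blk F u) (anti u)))
                       (lift-complement (blk F u) (antipodal-rigid (blk F u) (anti u)) (anti u))
    ... | no k≢u   = trans (lifted (same k k≢u) (anti k)) (cong pt (sym (+-identityʳ _)))
    heights′ : pt (sum (heights F′)) ≡ antipode (pt (sum (heights F)))
    heights′ = begin
      pt (sum (heights F′))                  ≡⟨ sum-pt pointwise ⟩
      pt (sum (λ k → heights F k + delta u c k))    ≡⟨ cong pt (trans (∑-distrib-+ {B} (heights F) (delta u c)) (cong (sum (heights F) +_) (sum-delta u c))) ⟩
      pt (sum (heights F) + c)               ≡⟨ pt-+c _ ⟩
      antipode (pt (sum (heights F)))        ∎
    by-height : ∀ e → proj₂ (pt (sum (heights F))) ≡ e → N₃ F ⊎ N₃ F′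
    by-height false eq = inj₁ (anti , eq)
    by-height true  eq = inj₂ (anti′ , trans (cong proj₂ heights′) (cong not eq))

  open Rules (B * c) N N? N-resp-≗ public

  -- Angles are natural numbers, so the inverse rotations are given as data: `κ k` is the number of
  -- full turns made by `σ k` and `σ′ k` together.
  module Shear (σ σ′ κ : Fin B → ℕ) (inverse : ∀ k → σ k + σ′ k ≡ κ k * (c + c)) where

    inverse′ : ∀ k → σ′ k + σ k ≡ κ k * (c + c)
    inverse′ k = trans (+-comm (σ′ k) (σ k)) (inverse k)

    shear : X ↔ X
    shear = mk↔ₛ′ (λ { (k , x) → k , rotate (σ k) x }) (λ { (k , x) → k , rotate (σ′ k) x })
      (λ { (k , x) → cong (k ,_) (rotate-inverse (σ′ k) (σ k) (κ k) (inverse′ k) x) })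
      (λ { (k , x) → cong (k ,_) (rotate-inverse (σ k) (σ′ k) (κ k) (inverse k) x) })

    undo : ∀ (F : X → Bool) (σ σ′ : Fin B → ℕ) → (∀ k → σ k + σ′ k ≡ κ k * (c + c)) →
           ∀ k → Shifted (σ k) (blk F k) (λ x → F (k , rotate (σ′ k) x))
    undo F σ σ′ inv k v = cong (λ x → F (k , x)) (begin
      rotate (σ′ k) (pt (v + σ k))   ≡⟨ rotate-pt (σ′ k) (v + σ k) ⟩
      pt (v + σ k + σ′ k)            ≡⟨ cong pt (trans (+-assoc v (σ k) (σ′ k)) (cong (v +_) (inv k))) ⟩
      pt (v + κ k * (c + c))         ≡⟨ pt-+k2c v (κ k) ⟩
      pt v                           ∎)
      where open ≡-Reasoning

    shear-symmetry : pt (sum σ) ≡ pt 0 → pt (sum σ′) ≡ pt 0 → Symmetry shear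
    shear-symmetry Σσ Σσ′ = symmetry
      (λ {F} → Invariance.preserve Data.Fin.Permutation.id σ Σσ id {F} (undo F σ σ′ inverse))
      (λ {F} → Invariance.preserve Data.Fin.Permutation.id σ′ Σσ′ id {F} (undo F σ′ σ inverse′))

  module _ (1≤h : 1 ≤ h) where

    instance
      B≢0 : NonZero B
      B≢0 = subst NonZero (sym B≡) _

    -- The arithmetic of residues modulo `c` is reused modulo `B`, for the cyclic order of the
    -- blocks.
    module Ring = Block B

    next : Permutation′ B
    next = Ring.turn 1

    next-cases : ∀ k → toℕ (next ⟨$⟩ʳ k) ≡ suc (toℕ k) ⊎ (toℕ k ≡ h + h × toℕ (next ⟨$⟩ʳ k) ≡ 0)
    next-cases k with m≤n⇒m<n∨m≡n (Fin.toℕ<n k)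
    ... | inj₁ 1+k<B = inj₁ (trans toℕ-next (m<n⇒m%n≡m 1+k<B))
      where toℕ-next = trans (Ring.toℕ-mod (toℕ k + 1)) (cong (_% B) (+-comm (toℕ k) 1))
    ... | inj₂ 1+k≡B = inj₂ (suc-injective (trans 1+k≡B B≡) ,
            trans (Ring.toℕ-mod (toℕ k + 1)) (trans (cong (_% B) (trans (+-comm (toℕ k) 1) 1+k≡B)) (n%n≡0 B)))

    ≤2h : ∀ k → toℕ k ≤ h + h
    ≤2h k = ≤-pred (subst (toℕ k <_) B≡ (Fin.toℕ<n k))

    -- Being one of the next `h` blocks is a cyclic notion since `B = 2h + 1`; only the last block,
    -- `h + h`, wraps around and exchanges the two forms of `Arrow`.
    next-arrow : ∀ {i j} → Arrow i j → Arrow (next ⟨$⟩ʳ i) (next ⟨$⟩ʳ j)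
    next-arrow {i} {j} i→j with next-cases i | next-cases j
    ... | inj₁ i′ | inj₁ j′ rewrite i′ | j′ = [ (λ { (i<j , j≤) → inj₁ (s≤s i<j , s≤s j≤) }) , inj₂ ∘ s≤s ]′ i→j
    ... | inj₁ i′ | inj₂ (j≡ , j′) rewrite i′ | j′ | j≡ =
      [ (λ { (_ , 2h≤) → inj₂ (s≤s (+-cancelʳ-≤ h h (toℕ i) 2h≤)) }) , (λ gt → ⊥-elim (<⇒≱ gt (≤-trans (≤2h i) (m≤m+n _ h)))) ]′ i→j
    ... | inj₂ (i≡ , i′) | inj₁ j′ rewrite i′ | j′ | i≡ =
      [ (λ { (2h<j , _) → ⊥-elim (<⇒≱ 2h<j (≤2h j)) }) , (λ lt → inj₁ (z<s , +-cancelʳ-< h (toℕ j) h lt)) ]′ i→j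
    ... | inj₂ (i≡ , _) | inj₂ (j≡ , _) = ⊥-elim (arrow-irrefl {i} (subst (Arrow i) (Fin.toℕ-injective (trans j≡ (sym i≡))) i→j))

    arrow-total : ∀ {i j} → i ≢ j → Arrow i j ⊎ Arrow j i
    arrow-total {i} {j} i≢j with <-cmp (toℕ i) (toℕ j)
    ... | tri< i<j _ _ with toℕ j ≤? toℕ i + h
    ...   | yes j≤ = inj₁ (inj₁ (i<j , j≤))
    ...   | no j≰  = inj₂ (inj₂ (≰⇒> j≰))
    arrow-total {i} {j} i≢j | tri≈ _ eq _ = ⊥-elim (i≢j (Fin.toℕ-injective eq))
    arrow-total {i} {j} i≢j | tri> _ _ j<i with toℕ i ≤? toℕ j + h
    ...   | yes i≤ = inj₂ (inj₁ (j<i , i≤))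
    ...   | no i≰  = inj₁ (inj₂ (≰⇒> i≰))

    -- Distinct blocks are joined in exactly one direction, and the wrong direction would be carried
    -- forward by `next-arrow`.
    prev-arrow : ∀ {i j} → Arrow i j → Arrow (next ⟨$⟩ˡ i) (next ⟨$⟩ˡ j)
    prev-arrow {i} {j} i→j with (next ⟨$⟩ˡ i) Fin.≟ (next ⟨$⟩ˡ j)
    ... | yes eq = ⊥-elim (arrow-irrefl {i} (subst (Arrow i) (sym same) i→j))
      where same = trans (sym (Inverse.inverseˡ next refl)) (trans (cong (next ⟨$⟩ʳ_) eq) (Inverse.inverseˡ next refl))
    ... | no neq with arrow-total neq
    ...   | inj₁ fine = fine
    ...   | inj₂ bad = ⊥-elim (arrow-asym i→j (subst₂ Arrow (Inverse.inverseˡ next refl) (Inverse.inverseˡ next refl) (next-arrow bad)))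

    no-shift : pt (sum {B} (λ _ → 0)) ≡ pt 0
    no-shift = cong pt (trans (sum-const B (λ _ → refl)) (*-zeroʳ B))

    next-block : X ↔ X
    next-block = next ×-↔ ↔-id Point

    next-block-symmetry : Symmetry next-block
    next-block-symmetry = symmetry
      (λ {F} → Invariance.preserve next (λ _ → 0) no-shift next-arrow {F} {F ∘ Inverse.from next-block}
        λ k v → cong₂ (λ k v → F (k , pt v)) (Inverse.inverseʳ next refl) (+-identityʳ v))
      (λ {F} → Invariance.preserve (Data.Fin.Permutation.flip next) (λ _ → 0) no-shift prev-arrow {F} {F ∘ Inverse.to next-block}
        λ k v → cong₂ (λ k v → F (k , pt v)) (Inverse.inverseˡ next refl) (+-identityʳ v))

    next≢ : ∀ k → k ≢ next ⟨$⟩ʳ k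
    next≢ k eq with next-cases k
    ... | inj₁ k′ = 1+n≢n (trans (sym k′) (sym (cong toℕ eq)))
    ... | inj₂ (k≡ , k′) = <⇒≢ (≤-trans 1≤h (m≤m+n h h)) (trans (sym k′) (trans (sym (cong toℕ eq)) k≡))

    -- The following block is turned by -1 to compensate, so the angles add up to 0.
    ∼-rotate : ∀ k x → (k , x) ∼ (k , rotate 1 x)
    ∼-rotate k x = shear , shear-symmetry (balance 1 (neg 1) (+-neg 1)) (balance (neg 1) 1 (trans (+-comm (neg 1) 1) (+-neg 1))) ,
      cong (λ d → k , rotate d x) (trans (cong₂ _+_ (delta-at k) (delta-other {next ⟨$⟩ʳ k} k (next≢ k))) (+-identityʳ 1))
      where
      l = next ⟨$⟩ʳ k
      σ : ℕ → ℕ → Fin B → ℕ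
      σ d e j = delta k d j + delta l e j
      cancel : ∀ j → σ 1 (neg 1) j + σ (neg 1) 1 j ≡ σ 1 1 j * (c + c)
      cancel j = begin
        delta k 1 j + delta l (neg 1) j + (delta k (neg 1) j + delta l 1 j)
          ≡⟨ solve 4 (λ a b d e → a :+ b :+ (d :+ e) := (a :+ d) :+ (e :+ b)) refl (delta k 1 j) (delta l (neg 1) j) (delta k (neg 1) j) (delta l 1 j) ⟩
        (delta k 1 j + delta k (neg 1) j) + (delta l 1 j + delta l (neg 1) j)
          ≡⟨ cong₂ _+_ (fold k) (fold l) ⟩
        delta k 1 j * (c + c) + delta l 1 j * (c + c)
          ≡⟨ *-distribʳ-+ (c + c) (delta k 1 j) (delta l 1 j) ⟨
        σ 1 1 j * (c + c) ∎
        where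
        open ≡-Reasoning
        fold : ∀ u → delta u 1 j + delta u (neg 1) j ≡ delta u 1 j * (c + c)
        fold u = trans (delta-+ u 1 (neg 1) j) (trans (cong (λ x → delta u x j) (trans (+-neg 1) (*-identityˡ (c + c)))) (delta-* u (c + c) j))
      open Shear (σ 1 (neg 1)) (σ (neg 1) 1) (σ 1 1) cancel
      balance : ∀ d e → d + e ≡ 1 * (c + c) → pt (sum (σ d e)) ≡ pt 0
      balance d e eq = trans (cong pt (trans (∑-distrib-+ {B} (delta k d) (delta l e))
        (trans (cong₂ _+_ (sum-delta k d) (sum-delta l e)) eq))) (pt-+k2c 0 1)

    -- Unit rotations bring the point to angle 0 of its block, and shifts of the blocks then bring
    -- it to block 0.
    ∼-origin : ∀ k x → (k , x) ∼ (Ring.idx 0 , pt 0)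
    ∼-origin k x = subst₂ (λ k x → (k , x) ∼ (Ring.idx 0 , pt 0)) (Ring.idx-toℕ k) (pt-num x)
      (∼-trans (within (Ring.idx (toℕ k)) (num x)) (across (toℕ k)))
      where
      within : ∀ k v → (k , pt v) ∼ (k , pt 0)
      within k zero = ∼-refl
      within k (suc v) = ∼-trans (∼-sym (subst (λ x → (k , pt v) ∼ (k , x))
        (trans (rotate-pt 1 v) (cong pt (+-comm v 1))) (∼-rotate k (pt v)))) (within k v)
      across : ∀ v → (Ring.idx v , pt 0) ∼ (Ring.idx 0 , pt 0)
      across zero = ∼-refl
      across (suc v) = ∼-trans (∼-sym (next-block , next-block-symmetry ,
        cong (_, pt 0) (trans (Ring.idx-cong-+ 1 (Ring.idx-toℕ (Ring.idx v))) (cong Ring.idx (+-comm v 1))))) (across v)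

    all-symmetric : ∀ x y → x ∼ y
    all-symmetric (k , x) (l , y) = ∼-trans (∼-origin k x) (∼-sym (∼-origin l y))

-- Even boards: paired positions, targets and the three kinds of reply

argmin : ∀ {n} {P : Fin n → Set} (P? : ∀ i → Dec (P i)) (g : Fin n → ℕ) → ∃ P →
         ∃ λ i → P i × (∀ j → P j → g i ≤ g j)
argmin {n} {P} P? g (i , Pi) = descend (g i) i Pi ≤-refl
  where
  descend : ∀ bound i → P i → g i ≤ bound → ∃ λ i → P i × (∀ j → P j → g i ≤ g j)
  descend bound i Pi gi≤ with Fin.any? (λ j → P? j ×-dec (g j <? g i))
  ... | no none = i , Pi , λ j Pj → ≮⇒≥ λ lt → none (j , Pj , lt)
  descend zero i Pi gi≤ | yes (j , Pj , lt) = ⊥-elim (<⇒≱ lt (≤-trans gi≤ z≤n))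
  descend (suc bound) i Pi gi≤ | yes (j , Pj , lt) = descend bound j Pj (≤-pred (≤-trans lt gi≤))

module EvenStrategy (h a B c : ℕ) .{{_ : NonZero c}} (B≡ : B ≡ suc (h + h)) (c≡ : c ≡ 2 ^ a) (1≤h : 1 ≤ h) where

  open Block c
  open Even h a B c B≡ c≡

  Pair : Set
  Pair = Fin B × Fin c

  pairOf : X → Pair
  pairOf (k , i , _) = k , i

  opp : X → X
  opp (k , x) = k , antipode x

  opp-involutive : ∀ x → opp (opp x) ≡ x
  opp-involutive (k , x) = cong (k ,_) (antipode-involutive x)

  opp≢ : ∀ x → opp x ≢ x
  opp≢ (k , i , false) ()
  opp≢ (k , i , true) ()

  opp-swap : ∀ {x y} → opp x ≡ y → x ≡ opp y
  opp-swap {x} eq = trans (sym (opp-involutive x)) (cong opp eq)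

  same-pair : ∀ x y → pairOf x ≡ pairOf y → y ≡ x ⊎ y ≡ opp x
  same-pair (k , i , false) (.k , .i , false) refl = inj₁ refl
  same-pair (k , i , false) (.k , .i , true)  refl = inj₂ refl
  same-pair (k , i , true)  (.k , .i , false) refl = inj₂ refl
  same-pair (k , i , true)  (.k , .i , true)  refl = inj₁ refl

  module _ {p : Position} {x y : X} where

    private
      q : Position
      q = p [ x ≔ his ] [ y ≔ mine ]

    played-free : ∀ {w} → q w ≡ free → w ≢ x × w ≢ y × p w ≡ free
    played-free {w} eq with w ≟ˣ y
    ... | yes _ with () ← eq
    ... | no w≢y with w ≟ˣ x
    ...   | yes _ with () ← eq
    ...   | no w≢x = w≢x , w≢y , eq

    played-mine : ∀ {w} → q w ≡ mine → w ≡ y ⊎ p w ≡ mine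
    played-mine {w} eq with w ≟ˣ y
    ... | yes w≡y = inj₁ w≡y
    ... | no w≢y with w ≟ˣ x
    ...   | yes _ with () ← eq
    ...   | no w≢x = inj₂ eq

    played-his : ∀ {w} → q w ≡ his → w ≢ y × (w ≡ x ⊎ p w ≡ his)
    played-his {w} eq with w ≟ˣ y
    ... | yes _ with () ← eq
    ... | no w≢y with w ≟ˣ x
    ...   | yes w≡x = w≢y , inj₁ w≡x
    ...   | no w≢x = w≢y , inj₂ eq

    still-free : ∀ {w} → p w ≡ free → w ≢ x → w ≢ y → q w ≡ free
    still-free pw w≢x w≢y = trans (≔-other (p [ x ≔ his ]) w≢y) (trans (≔-other p w≢x) pw)

    still-taken : ∀ {w} → p w ≢ free → q w ≢ free
    still-taken pw qw = pw (proj₂ (proj₂ (played-free qw)))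

  set : (X → Bool) → Pair → (Bool → Bool) → X → Bool
  set V (k , i) g (l , j , e) with l Fin.≟ k | j Fin.≟ i
  ... | yes _ | yes _ = g e
  ... | _     | _     = V (l , j , e)

  set-in : ∀ V π {g} e → set V π g (proj₁ π , proj₂ π , e) ≡ g e
  set-in V (k , i) e with k Fin.≟ k | i Fin.≟ i
  ... | yes _ | yes _ = refl
  ... | no k≢ | _     = ⊥-elim (k≢ refl)
  ... | yes _ | no i≢ = ⊥-elim (i≢ refl)

  set-out : ∀ V {π g} x → pairOf x ≢ π → set V π g x ≡ V x
  set-out V {k , i} (l , j , e) x∉ with l Fin.≟ k | j Fin.≟ i
  ... | yes refl | yes refl = ⊥-elim (x∉ refl)
  ... | yes _    | no _     = refl
  ... | no _     | _        = refl

  set-block : ∀ V {π g} k → k ≢ proj₁ π → blk (set V π g) k ≗ blk V k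
  set-block V k k≢ x = set-out V (k , x) (k≢ ∘ cong proj₁)

  set-pair : ∀ V {k i g} j → j ≢ i → ∀ e → set V (k , i) g (k , j , e) ≡ V (k , j , e)
  set-pair V j j≢i e = set-out V _ (j≢i ∘ cong proj₂)

  count-set : ∀ V k i {g} → count (blk (set V (k , i) g) k) + pairSum (blk V k) i ≡ count (blk V k) + (⟦ g false ⟧ + ⟦ g true ⟧)
  count-set V k i {g} = sum-exchange i
    (λ j j≢i → cong₂ (λ x y → ⟦ x ⟧ + ⟦ y ⟧) (set-pair V j j≢i false) (set-pair V j j≢i true))
    (trans (cong₂ (λ x y → ⟦ x ⟧ + ⟦ y ⟧ + pairSum (blk V k) i) (set-in V (k , i) {g} false) (set-in V (k , i) {g} true))
      (+-comm (⟦ g false ⟧ + ⟦ g true ⟧) (pairSum (blk V k) i)))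

  count-cong : ∀ {f f′} → f ≗ f′ → count f ≡ count f′
  count-cong f≗f′ = sum-cong-≗ λ i → cong₂ (λ x y → ⟦ x ⟧ + ⟦ y ⟧) (f≗f′ (i , false)) (f≗f′ (i , true))

  -- A position in which every unclaimed point other than z has an unclaimed antipode,
  -- together with a set V that Player I means to own at the end.
  record Base (p : Position) (V : X → Bool) (z : X) : Set where
    field
      lone   : p z ≡ free
      paired : p (opp z) ≢ free
      z∉V    : V z ≡ false
      agree  : ∀ {x} → p x ≡ mine → V x ≡ true
      oppose : ∀ {x} → p x ≡ his → V x ≡ false
      pairs  : ∀ {x} → p x ≡ free → x ≢ z → p (opp x) ≡ free
      split  : ∀ {x} → p x ≡ free → x ≢ z → V (opp x) ≡ not (V x)

    opp≢z : ∀ {x} → p x ≡ free → opp x ≢ z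
    opp≢z px eq = paired (subst (λ y → p y ≡ free) (opp-swap eq) px)

    pair≢z : ∀ {x} → p x ≡ free → x ≢ z → pairOf z ≢ pairOf x
    pair≢z {x} px x≢z eq with same-pair z x eq
    ... | inj₁ x≡z = x≢z x≡z
    ... | inj₂ x≡z̄ = paired (subst (λ y → p y ≡ free) x≡z̄ px)

  module Moves {p V z} (base : Base p V z) where
    open Base base

    -- Player II takes the lone point. Player I starts another pair with its point in `V`, whose
    -- antipode becomes the new lone point.
    open-pair : ∀ {y} → p y ≡ free → y ≢ z → V y ≡ true → Base (p [ z ≔ his ] [ y ≔ mine ]) V (opp y)
    open-pair {y} py y≢z Vy = record
      { lone = still-free (pairs py y≢z) (opp≢z py) (opp≢ y)
      ; paired = λ eq → mine≢free (trans (sym (trans (cong q (opp-involutive y)) (≔-same (p [ z ≔ his ]) y))) eq)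
      ; z∉V = trans (split py y≢z) (cong not Vy)
      ; agree = λ eq → [ (λ { refl → Vy }) , agree ]′ (played-mine eq)
      ; oppose = λ eq → [ (λ { refl → z∉V }) , oppose ]′ (proj₂ (played-his eq))
      ; pairs = λ {x} eq x≢ȳ → let x≢z , x≢y , px = played-free eq in
          still-free (pairs px x≢z) (opp≢z px) (x≢ȳ ∘ opp-swap)
      ; split = λ eq x≢ȳ → let x≢z , x≢y , px = played-free eq in split px x≢z
      }
      where
      q = p [ z ≔ his ] [ y ≔ mine ]
      mine≢free : mine ≢ free
      mine≢free ()

    fill-target : X → X → Bool
    fill-target x = set V (pairOf x) (_xor proj₂ (proj₂ x))

    fill-at : ∀ x → fill-target x x ≡ false
    fill-at x = trans (set-in V (pairOf x) _) (xor-same (proj₂ (proj₂ x)))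

    fill-opp : ∀ x → fill-target x (opp x) ≡ true
    fill-opp x@(_ , _ , false) = set-in V (pairOf x) _
    fill-opp x@(_ , _ , true)  = set-in V (pairOf x) _

    fill-other : ∀ x {w} → w ≢ x → w ≢ opp x → fill-target x w ≡ V w
    fill-other x {w} w≢x w≢x̄ = set-out V w (λ eq → [ w≢x , w≢x̄ ]′ (same-pair x w (sym eq)))

    -- Player II takes a point of a free pair and Player I its antipode; the target is adapted to
    -- this in that pair, and the lone point stays.
    fill-pair : ∀ {x} → p x ≡ free → x ≢ z → Base (p [ x ≔ his ] [ opp x ≔ mine ]) (fill-target x) z
    fill-pair {x} px x≢z = record
      { lone = still-free lone (x≢z ∘ sym) z≢x̄
      ; paired = still-taken paired
      ; z∉V = trans (fill-other x (x≢z ∘ sym) z≢x̄) z∉V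
      ; agree = λ {w} eq → [ (λ { refl → fill-opp x }) , (λ pw → trans (fill-other x (differs pw (λ ()) px) (differs pw (λ ()) (pairs px x≢z))) (agree pw)) ]′ (played-mine eq)
      ; oppose = λ {w} eq → [ (λ { refl → fill-at x }) , (λ pw → trans (fill-other x (differs pw (λ ()) px) (differs pw (λ ()) (pairs px x≢z))) (oppose pw)) ]′ (proj₂ (played-his eq))
      ; pairs = λ {w} eq w≢z → let w≢x , w≢x̄ , pw = played-free eq in
          still-free (pairs pw w≢z) (w≢x̄ ∘ opp-swap) (w≢x ∘ opp-injective)
      ; split = λ {w} eq w≢z → let w≢x , w≢x̄ , pw = played-free eq in
          trans (fill-other x (w≢x̄ ∘ opp-swap) (w≢x ∘ opp-injective))
            (trans (split pw w≢z) (cong not (sym (fill-other x w≢x w≢x̄))))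
      }
      where
      z≢x̄ : z ≢ opp x
      z≢x̄ = opp≢z px ∘ sym
      differs : ∀ {w v c} → p w ≡ c → c ≢ free → p v ≡ free → w ≢ v
      differs pw c≢free pv refl = c≢free (trans (sym pw) pv)
      opp-injective : ∀ {x y} → opp x ≡ opp y → x ≡ y
      opp-injective {x} {y} eq = trans (opp-swap eq) (opp-involutive y)

    -- The first disjunct holds just when `e` is the coordinate of `z`: the target gains `z` and
    -- keeps its value at the antipode.
    raise : Bool → Bool
    raise e = not (e xor proj₂ (proj₂ z)) ∨ V (proj₁ z , proj₁ (proj₂ z) , e)

    raised : X → Bool
    raised = set V (pairOf z) raise

    double-target : X → X → Bool
    double-target x = set raised (pairOf x) (λ _ → false)

    raised-at : raised z ≡ true
    raised-at = trans (set-in V (pairOf z) _) (cong (λ b → not b ∨ V z) (xor-same (proj₂ (proj₂ z))))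

    raised-opp : raised (opp z) ≡ V (opp z)
    raised-opp = trans (set-in V (pairOf z) _) (cong (_∨ V (opp z)) (flipped (proj₂ (proj₂ z))))
      where
      flipped : ∀ e → not (not e xor e) ≡ false
      flipped false = refl
      flipped true  = refl

    raised-other : ∀ {w} → w ≢ z → raised w ≡ V w
    raised-other {w} w≢z with w ≟ˣ opp z
    ... | yes refl = raised-opp
    ... | no w≢z̄   = set-out V w (λ eq → [ w≢z , w≢z̄ ]′ (same-pair z w (sym eq)))

    -- Player I takes the lone point instead of the antipode of `x`, which becomes the new lone
    -- point. The target gains `z` and gives up the whole pair of `x`.
    double-pair : ∀ {x} → p x ≡ free → x ≢ z → Base (p [ x ≔ his ] [ z ≔ mine ]) (double-target x) (opp x)
    double-pair {x} px x≢z = record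
      { lone = still-free (pairs px x≢z) (opp≢ x) (opp≢z px)
      ; paired = λ eq → proj₁ (played-free eq) (opp-involutive x)
      ; z∉V = cleared refl
      ; agree = λ eq → [ (λ { refl → trans (kept (pair≢z px x≢z)) raised-at })
                       , (λ pw → trans (kept (differs pw (λ ()))) (trans (raised-other (λ { refl → absurd (trans (sym pw) lone) })) (agree pw))) ]′ (played-mine eq)
      ; oppose = λ {w} eq → [ (λ { refl → cleared refl })
                       , (λ pw → trans (kept (differs pw (λ ()))) (trans (raised-other (proj₁ (played-his {p} {x} {z} {w} eq))) (oppose pw))) ]′ (proj₂ (played-his eq))
      ; pairs = λ {w} eq w≢x̄ → let w≢x , w≢z , pw = played-free eq in
          still-free (pairs pw w≢z) (w≢x̄ ∘ opp-swap) (opp≢z pw)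
      ; split = λ {w} eq w≢x̄ → let w≢x , w≢z , pw = played-free eq in
          trans (untouched-by w≢z (opp≢z pw) w≢x w≢x̄) (trans (split pw w≢z) (cong not (sym (trans (kept (far w≢x w≢x̄)) (raised-other w≢z)))))
      }
      where
      absurd : ∀ {P : Set} → mine ≡ free → P
      absurd ()
      cleared : ∀ {w} → pairOf w ≡ pairOf x → double-target x w ≡ false
      cleared refl = set-in raised (pairOf x) _
      kept : ∀ {w} → pairOf w ≢ pairOf x → double-target x w ≡ raised w
      kept {w} w∉ = set-out raised w w∉
      far : ∀ {w} → w ≢ x → w ≢ opp x → pairOf w ≢ pairOf x
      far {w} w≢x w≢x̄ eq = [ w≢x , w≢x̄ ]′ (same-pair x w (sym eq))
      differs : ∀ {w c} → p w ≡ c → c ≢ free → pairOf w ≢ pairOf x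
      differs {w} pw c≢free eq with same-pair x w (sym eq)
      ... | inj₁ refl = c≢free (trans (sym pw) px)
      ... | inj₂ refl = c≢free (trans (sym pw) (pairs px x≢z))
      untouched-by : ∀ {w} → w ≢ z → opp w ≢ z → w ≢ x → w ≢ opp x → double-target x (opp w) ≡ V (opp w)
      untouched-by w≢z w̄≢z w≢x w≢x̄ = trans (kept (far w≢x w≢x̄)) (raised-other w̄≢z)

    openable : ∀ {w} → p w ≡ free → w ≢ z → ∃ λ y → pairOf y ≡ pairOf w × p y ≡ free × y ≢ z × V y ≡ true
    openable {w} pw w≢z with V w in eq
    ... | true  = w , refl , pw , w≢z , eq
    ... | false = opp w , refl , pairs pw w≢z , opp≢z pw , trans (split pw w≢z) (cong not eq)

    single-at : ∀ {x} → p x ≡ free → x ≢ z → Single (blk V (proj₁ x)) (proj₁ (proj₂ x))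
    single-at {x} px x≢z = antipode-single {blk V (proj₁ x)} (proj₂ (proj₂ x)) (split px x≢z)

    pairSum-single : ∀ {f i} → Single f i → pairSum f i ≡ 1
    pairSum-single {f} {i} s with f (i , false) | f (i , true)
    pairSum-single refl | false | .true = refl
    pairSum-single refl | true | .false = refl

    fill-single : ∀ x → Single (blk (fill-target x) (proj₁ x)) (proj₁ (proj₂ x))
    fill-single x = trans (set-in V (pairOf x) true) (cong not (sym (set-in V (pairOf x) false)))

    fill-antipodal : ∀ x → (∀ k → Antipodal (blk V k)) → ∀ k → Antipodal (blk (fill-target x) k)
    fill-antipodal x anti k i with k Fin.≟ proj₁ x | i Fin.≟ proj₁ (proj₂ x)
    ... | yes refl | yes refl = refl
    ... | yes _    | no _     = anti k i
    ... | no _     | _        = anti k i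

    fill-count : ∀ {x} → p x ≡ free → x ≢ z → ∀ k → count (blk (fill-target x) k) ≡ count (blk V k)
    fill-count {x} px x≢z k = by-block (k Fin.≟ proj₁ x)
      where
      one : ∀ e → ⟦ false xor e ⟧ + ⟦ true xor e ⟧ ≡ 1
      one false = refl
      one true  = refl
      by-block : Dec (k ≡ proj₁ x) → count (blk (fill-target x) k) ≡ count (blk V k)
      by-block (no k≢) = count-cong (set-block V k k≢)
      by-block (yes refl) = +-cancelʳ-≡ 1 _ _ (trans
        (cong (count (blk (fill-target x) k) +_) (sym (pairSum-single {blk V k} (single-at px x≢z))))
        (trans (count-set V k (proj₁ (proj₂ x))) (cong (count (blk V k) +_) (one (proj₂ (proj₂ x))))))

    raised-count : count (blk raised (proj₁ z)) ≡ suc (count (blk V (proj₁ z)))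
    raised-count = +-cancelʳ-≡ (pairSum (blk V k) i) _ _ (trans (count-set V k i)
      (trans (cong (count (blk V k) +_) (more (proj₂ (proj₂ z)) z∉V)) (+-suc _ _)))
      where
      k = proj₁ z
      i = proj₁ (proj₂ z)
      more : ∀ e → V (k , i , e) ≡ false → ⟦ not (false xor e) ∨ V (k , i , false) ⟧ + ⟦ not (true xor e) ∨ V (k , i , true) ⟧
             ≡ suc (pairSum (blk V k) i)
      more false eq rewrite eq = refl
      more true  eq rewrite eq = trans (+-comm ⟦ V (k , i , false) ⟧ 1) (cong suc (sym (+-identityʳ _)))

    raised-block : ∀ k → k ≢ proj₁ z → blk raised k ≗ blk V k
    raised-block k k≢ = set-block V k k≢

    double-count : ∀ {x} → p x ≡ free → x ≢ z → suc (count (blk (double-target x) (proj₁ x))) ≡ count (blk raised (proj₁ x))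
    double-count {x} px x≢z = trans (+-comm 1 _) (trans (cong (count (blk (double-target x) k) +_) (sym one))
      (trans (count-set raised k i) (+-identityʳ _)))
      where
      k = proj₁ x
      i = proj₁ (proj₂ x)
      one : pairSum (blk raised k) i ≡ 1
      one = trans (cong₂ (λ u v → ⟦ u ⟧ + ⟦ v ⟧) (off false) (off true)) (pairSum-single {blk V k} (single-at px x≢z))
        where
        off : ∀ e → raised (k , i , e) ≡ V (k , i , e)
        off e = set-out V (k , i , e) (pair≢z px x≢z ∘ sym)

    double-block : ∀ {x} k → k ≢ proj₁ x → blk (double-target x) k ≗ blk raised k
    double-block k k≢ = set-block raised k k≢

  -- Phases of the strategy

  FullBelow : Position → Fin B → Set
  FullBelow p s = ∀ {w} → p w ≡ free → toℕ s ≤ toℕ (proj₁ w)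

  Whole : Position → Fin B → Set
  Whole p u = ∀ x → p (u , x) ≡ free

  Full : Position → Fin B → Fin c → Set
  Full p k i = ∀ e → p (k , i , e) ≢ free

  -- A full pair of block `s`, next to the pairs of two free points, shows that a cycle has at least
  -- three pairs. This provides the split pair that `oneDouble⇒rigid` asks for in earlier blocks.
  Spare : Position → (X → Bool) → Fin B → Set
  Spare p V s = (∀ k → k ≢ s → Antipodal (blk V k)) ⊎ ∃ (Full p s)

  N₂At : (X → Bool) → Fin B → Set
  N₂At V ℓ = (∃ λ d → Leads V ℓ d) × (∀ k → k ≢ ℓ → Rigid (blk V k) × (Antipodal (blk V k) ⊎ Arrow k ℓ))

  -- `late` makes all later blocks successors of `s`, so Player II cannot enter them without falling
  -- into `N₁`. `touched` provides `Spare` when such a block becomes current. `shapes` allows the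
  -- traces of deviations only in the blocks from `h` to `s`.
  record Main (p : Position) (V : X → Bool) (s : Fin B) : Set where
    field
      late     : h ≤ toℕ s
      full     : FullBelow p s
      touched  : ∀ k → toℕ s < toℕ k → ∃ (Full p k)
      balanced : ∀ k → count (blk V k) ≡ c
      shapes   : ∀ k → Antipodal (blk V k) ⊎ (OneDouble (blk V k) × h ≤ toℕ k × toℕ k ≤ toℕ s)

  -- profile: the target has c + 1 points in one block and c - 1 in a successor of it.
  -- fill:    nothing is decided; block u is untouched, and Player II cannot enter it without
  --          running into the phase profile.
  -- aim:     all points taken so far fit a target in N.
  -- spoiled: Player II deviated in the current block, which now leads the target.
  data Phase (p : Position) (V : X → Bool) (z : X) : Set where
    profile : N₁ V → Phase p V z
    fill    : (∀ k → Antipodal (blk V k)) → ∀ u → h ≤ toℕ u → toℕ (proj₁ z) < toℕ u →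
              toℕ u ≤ toℕ (proj₁ z) + h → Whole p u → FullBelow p (proj₁ z) → Phase p V z
    aim     : Main p V (proj₁ z) → N V → Antipodal (blk V (proj₁ z)) → Spare p V (proj₁ z) →
              (∀ {i e} → p (proj₁ z , i , e) ≡ free → val V (proj₁ z) (proj₁ (proj₂ z)) ≤ val V (proj₁ z) i) → Phase p V z
    spoiled : Main p V (proj₁ z) → N₂At V (proj₁ z) → OneDouble (blk V (proj₁ z)) → Phase p V z

  State : Position → Set
  State p = ∃ λ V → ∃ λ z → Base p V z × Phase p V z

  Next : Position → X → Set
  Next p x = ∃ λ y → (p [ x ≔ his ]) y ≡ free × State (p [ x ≔ his ] [ y ≔ mine ])

  n₂ : ∀ {V ℓ} → (∀ k → count (blk V k) ≡ c) → N₂At V ℓ → N V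
  n₂ {ℓ = ℓ} bal (lead , rest) = inj₂ (inj₁ (bal , ℓ , lead , rest))

  -- The last block is `h + h`, which is within `h` of any block from `h` on.
  later-arrow : ∀ {s k} → h ≤ toℕ s → toℕ s < toℕ k → Arrow s k
  later-arrow {s} {k} h≤s s<k = inj₁ (s<k , ≤-trans (≤2h 1≤h k) (+-monoˡ-≤ h h≤s))

  free? : ∀ (p : Position) x → Dec (p x ≡ free)
  free? p x with p x
  ... | free = yes refl
  ... | mine = no λ ()
  ... | his  = no λ ()

  any-bool? : ∀ {P : Bool → Set} → (∀ e → Dec (P e)) → Dec (∃ P)
  any-bool? P? with P? false | P? true
  ... | yes p | _ = yes (false , p)
  ... | _ | yes p = yes (true , p)
  ... | no ¬f | no ¬t = no λ { (false , p) → ¬f p ; (true , p) → ¬t p }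

  Available : Position → X → X → Set
  Available p z w = p w ≡ free × w ≢ z

  available? : ∀ p z k i → Dec (∃ λ e → Available p z (k , i , e))
  available? p z k i = any-bool? λ e → free? p (k , i , e) ×-dec ¬? ((k , i , e) ≟ˣ z)

  lowest : ∀ {p z w} → Available p z w →
           ∃ λ w′ → Available p z w′ × (∀ {v} → Available p z v → toℕ (proj₁ w′) ≤ toℕ (proj₁ v))
  lowest {p} {z} {k , i , e} av with argmin (λ k → Fin.any? (available? p z k)) toℕ (k , i , e , av)
  ... | t , (j , e′ , av′) , least = (t , j , e′) , av′ , λ {v} av → least (proj₁ v) (_ , _ , av)

  module Turn {p V z} (base : Base p V z) where
    open Base base
    open Moves base

    s : Fin B
    s = proj₁ z

    opened-position filled-position doubled-position : X → Position
    opened-position y = p [ z ≔ his ] [ y ≔ mine ]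
    filled-position x = p [ x ≔ his ] [ opp x ≔ mine ]
    doubled-position x = p [ x ≔ his ] [ z ≔ mine ]

    unclaimed-his : ∀ {x y} → p y ≡ free → y ≢ x → (p [ x ≔ his ]) y ≡ free
    unclaimed-his py y≢x = trans (≔-other p y≢x) py

    play-open : ∀ {y} → p y ≡ free → y ≢ z → V y ≡ true → Phase (opened-position y) V (opp y) → Next p z
    play-open {y} py y≢z Vy phase = y , unclaimed-his py y≢z , V , opp y , open-pair py y≢z Vy , phase

    play-fill : ∀ {x} → p x ≡ free → x ≢ z → Phase (filled-position x) (fill-target x) z → Next p x
    play-fill {x} px x≢z phase = opp x , unclaimed-his (pairs px x≢z) (opp≢ x) , fill-target x , z , fill-pair px x≢z , phase

    play-double : ∀ {x} → p x ≡ free → x ≢ z → Phase (doubled-position x) (double-target x) (opp x) → Next p x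
    play-double {x} px x≢z phase = z , unclaimed-his lone (x≢z ∘ sym) , double-target x , opp x , double-pair px x≢z , phase

    full-below-played : ∀ {x y t} → FullBelow p t → FullBelow (p [ x ≔ his ] [ y ≔ mine ]) t
    full-below-played full {w} qw = full (proj₂ (proj₂ (played-free {w = w} qw)))

    full-played : ∀ {x y k i} → Full p k i → Full (p [ x ≔ his ] [ y ≔ mine ]) k i
    full-played full e = still-taken (full e)

    -- Taking `z` gives block `s` one point more than half, and giving up the pair of `x` leaves its
    -- successor one short.
    to-profile : ∀ {x} → p x ≡ free → x ≢ z → (∀ k → count (blk V k) ≡ c) → Arrow s (proj₁ x) → Next p x
    to-profile {x} px x≢z bal s→k = play-double px x≢z (profile
      ( s , k , s→k
      , trans (count-cong (double-block {x} s (k≢s ∘ sym))) (trans raised-count (cong suc (bal s)))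
      , trans (double-count px x≢z) (trans (count-cong (raised-block k k≢s)) (bal k))
      , λ l l≢s l≢k → trans (count-cong (double-block {x} l l≢k)) (trans (count-cong (raised-block l l≢s)) (bal l))))
      where
      k = proj₁ x
      k≢s : k ≢ s
      k≢s eq = arrow-irrefl {s} (subst (Arrow s) eq s→k)

    -- Opening the val-minimal pair makes it come before every pair of block t that Player II may open later.
    aim-at : ∀ t → (∃ λ x → Available p z (t , x)) → (∀ {v} → Available p z v → toℕ t ≤ toℕ (proj₁ v)) →
             h ≤ toℕ t → (∀ k → toℕ t < toℕ k → ∃ (Full p k)) → (∀ k → count (blk V k) ≡ c) →
             (∀ k → Antipodal (blk V k) ⊎ (OneDouble (blk V k) × h ≤ toℕ k × toℕ k ≤ toℕ t)) →
             N V → Antipodal (blk V t) → Spare p V t → Next p z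
    aim-at t ((i₀ , e₀) , av₀) least h≤t touched bal shapes NV anti spare
      with argmin (available? p z t) (val V t) (i₀ , e₀ , av₀)
    ... | i , (e , pw , w≢z) , minimal with openable pw w≢z
    ... | y@(.t , .i , e′) , refl , py , y≢z , Vy = play-open py y≢z Vy (aim
          (record { late = h≤t ; full = λ {w} qw → let w≢z , _ , pw = played-free {w = w} qw in least (pw , w≢z)
                  ; touched = λ k t<k → let j , full = touched k t<k in j , full-played {z} {y} full
                  ; balanced = bal ; shapes = shapes })
          NV anti ([ inj₁ , (λ { (j , full) → inj₂ (j , full-played {z} {y} full) }) ]′ spare)
          (λ {j} {e} qw → let w≢z , _ , pw = played-free {w = t , j , e} qw in minimal j (e , pw , w≢z)))

    -- If the first block with an available point lies after `s`, `shapes` leaves only the antipodal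
    -- case for it, and `touched` supplies its full pair.
    resume : ∀ {w} → Available p z w → (∀ {v} → Available p z v → toℕ (proj₁ w) ≤ toℕ (proj₁ v)) →
             Main p V s → N V → (proj₁ w ≡ s → Antipodal (blk V s) × Spare p V s) → Next p z
    resume {w} av least main NV here = aim-at t (proj₂ w , av) least (≤-trans late s≤t)
        (λ k t<k → touched k (≤-<-trans s≤t t<k)) balanced
        (λ k → [ inj₁ , (λ { (o , h≤k , k≤s) → inj₂ (o , h≤k , ≤-trans k≤s s≤t) }) ]′ (shapes k))
        NV (proj₁ at-t) (proj₂ at-t)
      where
      open Main main
      t = proj₁ w
      s≤t : toℕ s ≤ toℕ t
      s≤t = full (proj₁ av)
      at-t : Antipodal (blk V t) × Spare p V t
      at-t with t Fin.≟ s
      ... | yes refl = here refl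
      ... | no t≢s = [ id , (λ { (_ , _ , t≤s) → ⊥-elim (<⇒≱ s<t t≤s) }) ]′ (shapes t) , inj₂ (touched t s<t)
        where
        s<t : toℕ s < toℕ t
        s<t = ≤∧≢⇒< s≤t (t≢s ∘ sym ∘ Fin.toℕ-injective)

    -- Outside the block of `z`, free points come in antipodal pairs, so one claimed point means a
    -- full pair.
    block-full : ∀ {k x} → s ≢ k → p (k , x) ≢ free → Full p k (proj₁ x)
    block-full {k} {i , e₀} s≢k taken e pf with e Data.Bool.≟ e₀
    ... | yes refl = taken pf
    ... | no e≢e₀ = taken (subst (λ b → p (k , i , b) ≡ free) (not-other e≢e₀) (pairs pf (s≢k ∘ sym ∘ cong proj₁)))
      where
      not-other : ∀ {e e₀} → e ≢ e₀ → not e ≡ e₀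
      not-other {false} {false} e≢ = ⊥-elim (e≢ refl)
      not-other {false} {true}  _  = refl
      not-other {true}  {false} _  = refl
      not-other {true}  {true}  e≢ = ⊥-elim (e≢ refl)

  flipBlock : (X → Bool) → Fin B → X → Bool
  flipBlock V u (k , x) with k Fin.≟ u
  ... | yes _ = not (V (k , x))
  ... | no _  = V (k , x)

  flip-same : ∀ V {u} k → k ≢ u → blk (flipBlock V u) k ≗ blk V k
  flip-same V {u} k k≢u x with k Fin.≟ u
  ... | yes k≡u = ⊥-elim (k≢u k≡u)
  ... | no _    = refl

  flip-at : ∀ V u → blk (flipBlock V u) u ≗ not ∘ blk V u
  flip-at V u x with u Fin.≟ u
  ... | yes _  = refl
  ... | no u≢u = ⊥-elim (u≢u refl)

  -- Nothing in block `u` is claimed, so the target may be complemented there; its free pairs remain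
  -- split.
  base-flip : ∀ {p V z u} → Base p V z → Whole p u → proj₁ z ≢ u → Base p (flipBlock V u) z
  base-flip {p} {V} {z} {u} base whole z∉u = record
    { lone = lone
    ; paired = paired
    ; z∉V = trans (flip-same V (proj₁ z) z∉u (proj₂ z)) z∉V
    ; agree = λ {x} px → trans (flip-same V (proj₁ x) (outside px (λ ())) (proj₂ x)) (agree px)
    ; oppose = λ {x} px → trans (flip-same V (proj₁ x) (outside px (λ ())) (proj₂ x)) (oppose px)
    ; pairs = pairs
    ; split = λ {x} px x≢z → split′ x (split px x≢z)
    }
    where
    open Base base
    outside : ∀ {x c} → p x ≡ c → c ≢ free → proj₁ x ≢ u
    outside {x} px c≢free refl = c≢free (trans (sym px) (whole (proj₂ x)))
    split′ : ∀ x → V (opp x) ≡ not (V x) → flipBlock V u (opp x) ≡ not (flipBlock V u x)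
    split′ (k , x) eq with k Fin.≟ u
    ... | yes _ = cong not eq
    ... | no _  = eq

  third : ∀ {i₀ i₁ i₂ : Fin c} → i₁ ≢ i₀ → i₂ ≢ i₀ → i₂ ≢ i₁ → ∀ d e → ∃ λ i → i ≢ d × i ≢ e
  third {i₀} {i₁} {i₂} 1≢0 2≢0 2≢1 d e with i₀ Fin.≟ d | i₀ Fin.≟ e
  ... | no 0≢d | no 0≢e = i₀ , 0≢d , 0≢e
  ... | yes refl | _ with i₁ Fin.≟ e
  ...   | no 1≢e = i₁ , 1≢0 , 1≢e
  ...   | yes refl = i₂ , 2≢0 , 2≢1
  third {i₀} {i₁} {i₂} 1≢0 2≢0 2≢1 d e | no 0≢d | yes refl with i₁ Fin.≟ d
  ...   | no 1≢d = i₁ , 1≢d , 1≢0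
  ...   | yes refl = i₂ , 2≢1 , 2≢0

  oneDouble-cong : ∀ {f f′} → f′ ≗ f → OneDouble f → OneDouble f′
  oneDouble-cong eq o = record
    { double = double ; zeros = zeros
    ; is-double = λ e → trans (eq _) (is-double e)
    ; is-zero = λ e → trans (eq _) (is-zero e)
    ; others = λ i i≢d i≢z → trans (eq _) (trans (others i i≢d i≢z) (cong not (sym (eq _))))
    }
    where open OneDouble o

  rigid-cong : ∀ {f f′} → f′ ≗ f → Rigid f → Rigid f′
  rigid-cong {f} {f′} eq = rigid-shift {0} {f} {f′} (copy eq)

  antipodal-cong : ∀ {f f′} → f′ ≗ f → Antipodal f → Antipodal f′
  antipodal-cong {f} {f′} eq = antipodal-shift {0} {f} {f′} (copy eq)

  -- Replies to Player II in each phase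

  module Reply {p V z} (base : Base p V z) where
    open Base base
    open Moves base
    open Turn base

    answer : Next p z → (∀ {x} → p x ≡ free → x ≢ z → Next p x) → ∀ x → p x ≡ free → Next p x
    answer at-z elsewhere x px with x ≟ˣ z
    ... | yes x≡z = subst (Next p) (sym x≡z) at-z
    ... | no x≢z  = elsewhere px x≢z

    -- Filling pairs keeps all block counts and opening pairs keeps the target, so `N₁` persists.
    reply-profile : N₁ V → (∃ λ w → Available p z w) → ∀ x → p x ≡ free → Next p x
    reply-profile n₁@(i , j , i→j , ci , cj , ck) (w , pw , w≢z) = answer at-z λ {x} px x≢z →
      play-fill px x≢z (profile (i , j , i→j , trans (fill-count px x≢z i) ci ,
        trans (cong suc (fill-count px x≢z j)) cj , λ k k≢i k≢j → trans (fill-count px x≢z k) (ck k k≢i k≢j)))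
      where
      at-z : Next p z
      at-z with openable pw w≢z
      ... | y , _ , py , y≢z , Vy = play-open py y≢z Vy (profile n₁)

    module Filling (anti : ∀ k → Antipodal (blk V k)) (u : Fin B) (h≤u : h ≤ toℕ u) (s<u : toℕ s < toℕ u)
                   (u≤s+h : toℕ u ≤ toℕ s + h) (whole : Whole p u) (full : FullBelow p s) where

      balanced : ∀ k → count (blk V k) ≡ c
      balanced k = antipodal⇒count {blk V k} (anti k)

      whole-played : ∀ {x y k} → Whole p k → proj₁ x ≢ k → proj₁ y ≢ k → Whole (p [ x ≔ his ] [ y ≔ mine ]) k
      whole-played whole x∉k y∉k v = still-free (whole v) (x∉k ∘ sym ∘ cong proj₁) (y∉k ∘ sym ∘ cong proj₁)

      -- Free points lie in block `s` or later. Entering one of the next `h` blocks leads to `N₁`;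
      -- any other point is answered by its antipode, and this leaves `u` untouched because `u` is
      -- among those `h` blocks.
      elsewhere : ∀ {x} → p x ≡ free → x ≢ z → Next p x
      elsewhere {x} px x≢z with proj₁ x Fin.≟ s | toℕ (proj₁ x) ≤? toℕ s + h
      ... | no x∉s | yes ≤s+h = to-profile px x≢z balanced
              (inj₁ (≤∧≢⇒< (full px) (x∉s ∘ sym ∘ Fin.toℕ-injective) , ≤s+h))
      ... | yes x∈s | _ = play-fill px x≢z (fill (fill-antipodal x anti) u h≤u s<u u≤s+h
              (whole-played whole x∉u x∉u) (full-below-played full))
        where
        x∉u : proj₁ x ≢ u
        x∉u eq = <⇒≢ s<u (cong toℕ (trans (sym x∈s) eq))
      ... | no _ | no ≰s+h = play-fill px x≢z (fill (fill-antipodal x anti) u h≤u s<u u≤s+h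
              (whole-played whole x∉u x∉u) (full-below-played full))
        where
        x∉u : proj₁ x ≢ u
        x∉u eq = ≰s+h (subst (λ k → toℕ k ≤ toℕ s + h) (sym eq) u≤s+h)

      all-bool? : ∀ {P : Bool → Set} → (∀ e → Dec (P e)) → Dec (∀ e → P e)
      all-bool? P? = map′ (λ { (f , t) false → f ; (f , t) true → t }) (λ all → all false , all true) (P? false ×-dec P? true)

      whole? : ∀ k → Dec (Whole p k)
      whole? k = map′ (λ { all (i , e) → all i e }) (λ w i e → w (i , e))
        (Fin.all? λ i → all-bool? λ e → free? p (k , i , e))

      not-whole : ∀ {k} → s ≢ k → ¬ Whole p k → ∃ (Full p k)
      not-whole {k} s≢k ¬whole with Fin.any? (λ i → any-bool? λ e → ¬? (free? p (k , i , e)))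
      ... | yes (i , e , taken) = i , block-full s≢k taken
      ... | no none = ⊥-elim (¬whole λ { (i , e) → decidable-stable (free? p (k , i , e)) λ taken → none (i , e , taken) })

      s∉whole : ∀ {k} → Whole p k → s ≢ k
      s∉whole whole refl = paired (whole (proj₂ (opp z)))

      u-available : Available p z (u , pt 0)
      u-available = whole (pt 0) , λ eq → <⇒≢ s<u (cong (toℕ ∘ proj₁) (sym eq))

      ∸-reflect : ∀ (i j : Fin B) → B ∸ toℕ j ≤ B ∸ toℕ i → toℕ i ≤ toℕ j
      ∸-reflect i j le = ≮⇒≥ λ j<i → <⇒≱ (∸-monoʳ-< j<i (<⇒≤ (Fin.toℕ<n i))) le

      -- Everything before `u` is full and a pair of `u` has to be opened. A later untouched block
      -- takes over the role of `u`; if there is none, the target is fixed now.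
      in-u : (∀ {v} → Available p z v → toℕ u ≤ toℕ (proj₁ v)) → Next p z
      -- Minimising `B ∸ toℕ k` selects the last untouched block.
      in-u least with argmin whole? (λ k → B ∸ toℕ k) (u , whole)
      ... | w , w-whole , last with w Fin.≟ u
      ...   | no w≢u with openable (proj₁ u-available) (proj₂ u-available)
      ...     | y@(.u , _ , _) , refl , py , y≢z , Vy = play-open py y≢z Vy (fill anti w (≤-trans h≤u (<⇒≤ u<w)) u<w
                  (≤-trans (≤2h 1≤h w) (+-monoˡ-≤ h h≤u)) (whole-played w-whole (s∉whole w-whole) (w≢u ∘ sym))
                  (λ {v} qv → let v≢z , _ , pv = played-free {w = v} qv in least (pv , v≢z)))
        where
        u<w : toℕ u < toℕ w
        u<w = ≤∧≢⇒< (∸-reflect u w (last u whole)) (w≢u ∘ sym ∘ Fin.toℕ-injective)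
      -- Block `u` is still untouched, so complementing the target there is possible, and one of the
      -- two targets lies in `N₃`.
      in-u least | w , w-whole , last | yes refl = go (antipodal-or-flipped {V} {flipBlock V u} {u} anti (flip-same V) (flip-at V u))
        where
        go : N₃ V ⊎ N₃ (flipBlock V u) → Next p z
        go (inj₁ n₃) = Turn.aim-at base u (pt 0 , u-available) least h≤u
          (λ k u<k → not-whole (λ { refl → <-asym s<u u<k }) λ k-whole → <⇒≱ u<k (∸-reflect k u (last k k-whole)))
          balanced (λ k → inj₁ (anti k)) (inj₂ (inj₂ n₃)) (anti u) (inj₁ λ k _ → anti k)
        go (inj₂ n₃@(anti′ , _)) = Turn.aim-at (base-flip base whole (s∉whole whole)) u (pt 0 , u-available) least h≤u
          (λ k u<k → not-whole (λ { refl → <-asym s<u u<k }) λ k-whole → <⇒≱ u<k (∸-reflect k u (last k k-whole)))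
          (λ k → antipodal⇒count {blk (flipBlock V u) k} (anti′ k)) (λ k → inj₁ (anti′ k)) (inj₂ (inj₂ n₃)) (anti′ u) (inj₁ λ k _ → anti′ k)

      at-z : Next p z
      at-z with lowest u-available
      ... | w , av@(pw , w≢z) , least with proj₁ w Fin.≟ u
      ...   | yes refl = in-u least
      ...   | no t≢u with openable pw w≢z
      ...     | y@(t , _ , _) , refl , py , y≢z , Vy = play-open py y≢z Vy (fill anti u h≤u
                  (≤∧≢⇒< (least u-available) (t≢u ∘ Fin.toℕ-injective))
                  (≤-trans u≤s+h (+-monoˡ-≤ h (full pw)))
                  (whole-played whole (s∉whole whole) t≢u)
                  (λ {v} qv → let v≢z , _ , pv = played-free {w = v} qv in least (pv , v≢z)))

      reply-fill : ∀ x → p x ≡ free → Next p x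
      reply-fill = answer at-z elsewhere

    module Aiming (main : Main p V s) where
      open Main main

      outside : ∀ {x} → p x ≡ free → x ≢ z → proj₁ x ≢ s → Next p x
      outside px x≢z x∉s = to-profile px x≢z balanced
        (later-arrow late (≤∧≢⇒< (full px) (x∉s ∘ sym ∘ Fin.toℕ-injective)))

      i₀ : Fin c
      i₀ = proj₁ (proj₂ z)

      played-main : ∀ {x y V′} → (∀ k → count (blk V′ k) ≡ c) → (∀ k → k ≢ s → blk V′ k ≗ blk V k) →
                    OneDouble (blk V′ s) → Main (p [ x ≔ his ] [ y ≔ mine ]) V′ s
      played-main {x} {y} {V′} balanced′ same one = record
        { late = late
        ; full = full-below-played full
        ; touched = λ k s<k → let j , full = touched k s<k in j , full-played {x} {y} full
        ; balanced = balanced′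
        ; shapes = λ k → by-block k (k Fin.≟ s)
        }
        where
        by-block : ∀ k → Dec (k ≡ s) → Antipodal (blk V′ k) ⊎ (OneDouble (blk V′ k) × h ≤ toℕ k × toℕ k ≤ toℕ s)
        by-block k (yes refl) = inj₂ (one , late , ≤-refl)
        by-block k (no k≢s) = [ inj₁ ∘ antipodal-cong (same k k≢s)
                              , (λ { (o , bounds) → inj₂ (oneDouble-cong (same k k≢s) o , bounds) }) ]′ (shapes k)

      -- Player II deviates inside the current block. Player I takes `z`, which completes the pair
      -- `i₀`, and the pair of `x` drops out of the target; the block then leads in the sense of
      -- `N₂`.
      module Spoiling (anti : Antipodal (blk V s)) (spare : Spare p V s)
                      (minimal : ∀ {i e} → p (s , i , e) ≡ free → val V s i₀ ≤ val V s i)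
                      {i e} (px : p (s , i , e) ≡ free) (x≢z : (s , i , e) ≢ z) where

        x : X
        x = s , i , e

        V′ : X → Bool
        V′ = double-target x

        i≢i₀ : i ≢ i₀
        i≢i₀ eq = pair≢z px x≢z (cong (s ,_) (sym eq))

        same : ∀ k → k ≢ s → blk V′ k ≗ blk V k
        same k k≢s y = trans (double-block {x} k k≢s y) (raised-block k k≢s y)

        same-pairs : ∀ j → j ≢ i₀ → j ≢ i → ∀ e → V′ (s , j , e) ≡ V (s , j , e)
        same-pairs j j≢i₀ j≢i e = trans (set-pair raised {s} {i} {λ _ → false} j j≢i e) (set-pair V {s} {i₀} {raise} j j≢i₀ e)

        top : ∀ e′ → V′ (s , i₀ , e′) ≡ true
        top e′ = trans (set-pair raised {s} {i} {λ _ → false} i₀ (i≢i₀ ∘ sym) e′) (trans (set-in V (pairOf z) {raise} e′)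
          (by-bits e′ (proj₂ (proj₂ z)) z∉V (trans (single-antipode {blk V s} (anti i₀) _) (cong not z∉V))))
          where
          by-bits : ∀ e′ ez → V (s , i₀ , ez) ≡ false → V (s , i₀ , not ez) ≡ true → not (e′ xor ez) ∨ V (s , i₀ , e′) ≡ true
          by-bits false false _ _ = refl
          by-bits false true  _ eq = eq
          by-bits true  false _ eq = eq
          by-bits true  true  _ _ = refl

        bottom : ∀ e′ → V′ (s , i , e′) ≡ false
        bottom = set-in raised (s , i)

        single′ : ∀ j → j ≢ i₀ → j ≢ i → Single (blk V′ s) j
        single′ j j≢i₀ j≢i = trans (same-pairs j j≢i₀ j≢i true) (trans (anti j) (cong not (sym (same-pairs j j≢i₀ j≢i false))))

        one : OneDouble (blk V′ s)
        one = record { double = i₀ ; zeros = i ; is-double = top ; is-zero = bottom ; others = single′ }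

        balanced′ : ∀ k → count (blk V′ k) ≡ c
        balanced′ k = by-block (k Fin.≟ s)
          where
          by-block : Dec (k ≡ s) → count (blk V′ k) ≡ c
          by-block (yes refl) = suc-injective (trans (double-count px x≢z) (trans raised-count (cong suc (balanced s))))
          by-block (no k≢s) = trans (count-cong (same k k≢s)) (balanced k)

        val′ : ∀ j → val V′ s j ≡ val V s j
        val′ = val-cong s same

        -- The pair `i` was free, so by minimality it does not precede `i₀`. Pairs that do precede
        -- are unchanged and hence split.
        lead : Leads V′ s i₀
        lead = (top false , top true) , λ j lt → single′ j
          (λ { refl → <-irrefl refl lt })
          (λ { refl → <⇒≱ (subst₂ _<_ (val′ i) (val′ i₀) lt) (minimal px) })

        rest : ∀ k → k ≢ s → Rigid (blk V′ k) × (Antipodal (blk V′ k) ⊎ Arrow k s)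
        rest k k≢s = by-shape (shapes k) spare
          where
          antipodal-case : Antipodal (blk V k) → Rigid (blk V′ k) × (Antipodal (blk V′ k) ⊎ Arrow k s)
          antipodal-case anti-k = rigid-cong (same k k≢s) (antipodal-rigid (blk V k) anti-k) , inj₁ (antipodal-cong (same k k≢s) anti-k)
          by-shape : Antipodal (blk V k) ⊎ (OneDouble (blk V k) × h ≤ toℕ k × toℕ k ≤ toℕ s) → Spare p V s →
                     Rigid (blk V′ k) × (Antipodal (blk V′ k) ⊎ Arrow k s)
          by-shape (inj₁ anti-k) _ = antipodal-case anti-k
          by-shape (inj₂ _) (inj₁ all-anti) = antipodal-case (all-anti k k≢s)
          -- An earlier deviation in block `k`: the pairs `i₀`, `i` and the full pair `i₂` are
          -- distinct, so block `k` has a split pair and is rigid. It lies between `h` and `s`,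
          -- which gives the arrow to `s`.
          by-shape (inj₂ (o , h≤k , k≤s)) (inj₂ (i₂ , taken)) =
            rigid-cong (same k k≢s) (oneDouble⇒rigid {blk V k} o (third i≢i₀ i₂≢i₀ i₂≢i (OneDouble.double o) (OneDouble.zeros o))) ,
            inj₂ (later-arrow h≤k (≤∧≢⇒< k≤s (k≢s ∘ Fin.toℕ-injective)))
            where
            i₂≢i₀ : i₂ ≢ i₀
            i₂≢i₀ refl = taken (proj₂ (proj₂ z)) lone
            i₂≢i : i₂ ≢ i
            i₂≢i refl = taken e px

        spoil : Next p x
        spoil = play-double px x≢z (spoiled (played-main balanced′ same one) ((i₀ , lead) , rest) one)

      reply-aim : N V → Antipodal (blk V s) → Spare p V s → (∀ {i e} → p (s , i , e) ≡ free → val V s i₀ ≤ val V s i) →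
                  (∃ λ w → Available p z w) → ∀ x → p x ≡ free → Next p x
      reply-aim NV anti spare minimal (w , av) = answer at-z elsewhere
        where
        at-z : Next p z
        at-z with lowest av
        ... | w′ , av′ , least = resume av′ least main NV (λ _ → anti , spare)
        elsewhere : ∀ {x} → p x ≡ free → x ≢ z → Next p x
        elsewhere {x} px x≢z with proj₁ x Fin.≟ s
        ... | yes refl = Spoiling.spoil anti spare minimal px x≢z
        ... | no x∉s = outside px x≢z x∉s

      -- The pair of `x` is split before and after the exchange, so it is neither the leading pair
      -- nor one of the two constant pairs, and `N₂` is kept.
      module Filled (at : N₂At V s) (one : OneDouble (blk V s)) {i e} (px : p (s , i , e) ≡ free) (x≢z : (s , i , e) ≢ z) where

        open OneDouble one

        x : X
        x = s , i , e

        V′ : X → Bool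
        V′ = fill-target x

        same : ∀ k → k ≢ s → blk V′ k ≗ blk V k
        same k k≢s = set-block V k k≢s

        same-pairs : ∀ j → j ≢ i → ∀ e → V′ (s , j , e) ≡ V (s , j , e)
        same-pairs j j≢i e = set-pair V j j≢i e

        i-single : Single (blk V s) i
        i-single = single-at px x≢z

        single′ : ∀ j → Single (blk V s) j → Single (blk V′ s) j
        single′ j sj = by-pair (j Fin.≟ i)
          where
          by-pair : Dec (j ≡ i) → Single (blk V′ s) j
          by-pair (yes refl) = fill-single x
          by-pair (no j≢i) = trans (same-pairs j j≢i true) (trans sj (cong not (sym (same-pairs j j≢i false))))

        i≢double : double ≢ i
        i≢double refl = single-not-doubled {blk V s} i-single (is-double false , is-double true)

        i≢zeros : zeros ≢ i
        i≢zeros refl = single-not-zero {blk V s} i-single (cong not (is-zero false) , cong not (is-zero true))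

        one′ : OneDouble (blk V′ s)
        one′ = record
          { double = double ; zeros = zeros
          ; is-double = λ e → trans (same-pairs double i≢double e) (is-double e)
          ; is-zero = λ e → trans (same-pairs zeros i≢zeros e) (is-zero e)
          ; others = λ j j≢d j≢z → single′ j (others j j≢d j≢z)
          }

        val′ : ∀ j → val V′ s j ≡ val V s j
        val′ = val-cong s same

        at′ : N₂At V′ s
        at′ = transfer at
          where
          transfer : N₂At V s → N₂At V′ s
          transfer ((d , (d₀ , d₁) , first) , rest) =
            ( d , (trans (same-pairs d d≢i false) d₀ , trans (same-pairs d d≢i true) d₁)
            , λ j lt → single′ j (first j (subst₂ _<_ (val′ j) (val′ d) lt))) ,
            λ k k≢s → rigid-cong (same k k≢s) (proj₁ (rest k k≢s)) ,
              [ inj₁ ∘ antipodal-cong (same k k≢s) , inj₂ ]′ (proj₂ (rest k k≢s))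
            where
            d≢i : d ≢ i
            d≢i refl = single-not-doubled {blk V s} i-single (d₀ , d₁)

        refill : Next p x
        refill = play-fill px x≢z (spoiled
          (played-main (λ k → trans (fill-count px x≢z k) (balanced k)) same one′) at′ one′)

      reply-spoiled : N₂At V s → OneDouble (blk V s) → (∃ λ w → Available p z w) → ∀ x → p x ≡ free → Next p x
      reply-spoiled at one (w , av) = answer at-z elsewhere
        where
        at-z : Next p z
        at-z with lowest av
        ... | w′ , av′@(pw , w≢z) , least with proj₁ w′ Fin.≟ s
        -- Block `s` has no available point left; the target, by now in `N₂`, becomes the aim in a
        -- later block.
        ...   | no w∉s = resume av′ least main (n₂ balanced at) (λ w∈s → ⊥-elim (w∉s w∈s))
        ...   | yes refl with openable pw w≢z
        ...     | (.s , _ , _) , refl , py , y≢z , Vy = play-open py y≢z Vy (spoiled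
                    (played-main balanced (λ _ _ _ → refl) one) at one)
        elsewhere : ∀ {x} → p x ≡ free → x ≢ z → Next p x
        elsewhere {x} px x≢z with proj₁ x Fin.≟ s
        ... | yes refl = Filled.refill at one px x≢z
        ... | no x∉s = outside px x≢z x∉s

    reply : Phase p V z → (∃ λ w → Available p z w) → ∀ x → p x ≡ free → Next p x
    reply (profile n₁) other = reply-profile n₁ other
    reply (fill anti u h≤u s<u u≤s+h whole full) _ = Filling.reply-fill anti u h≤u s<u u≤s+h whole full
    reply (aim main NV anti spare minimal) other = Aiming.reply-aim main NV anti spare minimal other
    reply (spoiled main at one) other = Aiming.reply-spoiled main at one other

    -- When only `z` is free, phase `fill` is impossible, since the untouched block `u` lies after
    -- the block of `z`; the other phases carry a target in `N`.
    outcome : Phase p V z → (∀ {x} → p x ≡ free → x ≡ z) → N V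
    outcome (profile n₁) _ = inj₁ n₁
    outcome (fill anti u h≤u s<u u≤s+h whole full) only = ⊥-elim (<⇒≢ s<u (cong (toℕ ∘ proj₁) (sym (only (whole (pt 0))))))
    outcome (aim _ NV _ _ _) _ = NV
    outcome (spoiled main at _) _ = n₂ (Main.balanced main) at

  -- The strategy on even boards assembled

  half-board : B * c + B * c ≡ n
  half-board = trans (sym (*-distribˡ-+ B c c)) (cong (B *_) (trans (cong (c +_) (sym (+-identityʳ c))) (*-comm 2 c)))

  strategy : Strategy
  strategy = record
    { Inv = λ _ → State
    ; first = x₀ , start
    ; open′ = λ { (V , z , base , _) _ _ _ → z , Base.lone base }
    ; reply = λ { {t} {p} (V , z , base , phase) szA szB t<s x px →
        Reply.reply base phase (other-free p (Base.lone base) (room p szA szB t<s)) x px }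
    ; safe = λ { {p} (V , z , base , phase) szA szB → N-resp-≗ (λ x → sym (mine-is-V base (only base szA szB) x))
        (Reply.outcome base phase (only base szA szB)) }
    -- Player II's last point can only be `z`, so his final set is the complement of the target, and
    -- `exclusive` applies.
    ; fatal = λ { {p} (V , z , base , phase) szA szB x px N-his →
        exclusive (Reply.outcome base phase (only base szA szB))
          (N-resp-≗ (his-is-complement base (only base szA szB) (only base szA szB px)) N-his) }
    }
    where
    room : ∀ p {t} → size (isMine ∘ p) ≡ t → suc (size (isHis ∘ p)) ≡ t → t < B * c →
           suc (size (isMine ∘ p) + size (isHis ∘ p)) < n
    room p {t} refl szB t<s = subst₂ _<_ (trans (cong (t +_) (sym szB)) (+-suc t _)) half-board (+-mono-< t<s t<s)

    only : ∀ {p V z} → Base p V z → size (isMine ∘ p) ≡ B * c → suc (size (isHis ∘ p)) ≡ B * c → ∀ {x} → p x ≡ free → x ≡ z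
    only {p} base szA szB px = free-unique p (Base.lone base) px
      (trans (sym (+-suc _ _)) (trans (cong₂ _+_ szA szB) half-board))

    mine-is-V : ∀ {p V z} → Base p V z → (∀ {x} → p x ≡ free → x ≡ z) → isMine ∘ p ≗ V
    mine-is-V {p} {V} base only x with p x in px
    ... | mine = sym (Base.agree base px)
    ... | his  = sym (Base.oppose base px)
    ... | free = trans (sym (Base.z∉V base)) (cong V (sym (only px)))

    his-is-complement : ∀ {p V z x} → Base p V z → (∀ {x} → p x ≡ free → x ≡ z) → x ≡ z → isHis ∘ p [ x ≔ his ] ≗ not ∘ V
    his-is-complement {p} {V} {z} base only refl y with y ≟ˣ z
    ... | yes refl = cong not (sym (Base.z∉V base))
    ... | no y≢z with p y in py
    ...   | mine = cong not (sym (Base.agree base py))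
    ...   | his  = cong not (sym (Base.oppose base py))
    ...   | free = ⊥-elim (y≢z (only py))

    k₀ : Fin B
    k₀ = fromℕ< (subst (0 <_) (sym B≡) z<s)
    k₀≡0 : toℕ k₀ ≡ 0
    k₀≡0 = Fin.toℕ-fromℕ< _
    x₀ : X
    x₀ = k₀ , idx 0 , false
    V₀ : X → Bool
    V₀ (_ , _ , e) = not e
    -- Play starts in block 0, and block `h`, its farthest successor, is the first one to be kept
    -- untouched.
    u : Fin B
    u = fromℕ< (subst (h <_) (sym B≡) (s≤s (m≤m+n h h)))
    u≡h : toℕ u ≡ h
    u≡h = Fin.toℕ-fromℕ< _
    p₀ p₁ : Position
    p₀ _ = free
    p₁ = p₀ [ x₀ ≔ mine ]

    start : State p₁
    start = V₀ , opp x₀ , base₀ , fill (λ _ _ → refl) u (≤-reflexive (sym u≡h))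
        (subst₂ _<_ (sym k₀≡0) (sym u≡h) 1≤h)
        (subst₂ _≤_ (sym u≡h) (cong (_+ h) (sym k₀≡0)) ≤-refl)
        (λ x → ≔-other p₀ λ eq → <⇒≢ 1≤h (trans (sym k₀≡0) (trans (cong (toℕ ∘ proj₁) (sym eq)) u≡h)))
        (λ {w} _ → subst (_≤ toℕ (proj₁ w)) (sym k₀≡0) z≤n)
      where
      free₁ : ∀ {y} → p₁ y ≡ free → y ≢ x₀
      free₁ eq refl with trans (sym (≔-same p₀ x₀)) eq
      ... | ()
      mine₁ : ∀ {y} → p₁ y ≡ mine → y ≡ x₀
      mine₁ {y} eq with y ≟ˣ x₀
      ... | yes y≡ = y≡
      mine₁ () | no _
      base₀ : Base p₁ V₀ (opp x₀)
      base₀ = record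
        { lone = ≔-other p₀ (opp≢ x₀)
        ; paired = λ eq → free₁ eq refl
        ; z∉V = refl
        ; agree = λ eq → cong V₀ (mine₁ eq)
        ; oppose = λ {y} eq → absurd y eq
        ; pairs = λ {y} eq y≢z → ≔-other p₀ (y≢z ∘ opp-swap)
        ; split = λ _ _ → refl
        }
        where
        absurd : ∀ y → p₁ y ≡ his → V₀ y ≡ false
        absurd y eq with y ≟ˣ x₀
        absurd y () | yes _
        absurd y () | no _

  game : Σ (Lines n) λ ℒ → IsTransitive ℒ × PlayerIWin ℒ
  game = lines , transitive (all-symmetric 1≤h) , playerIWin strategy (*-mono-≤ (subst (1 ≤_) (sym B≡) (s≤s z≤n)) (>-nonZero⁻¹ c))

-- Factorisation of `n` and the choice of the construction

odd-part : ∀ bound n → 1 ≤ n → n ≤ bound → ∃ λ a → ∃ λ h → n ≡ 2 ^ a * suc (h + h)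
odd-part zero n 1≤n n≤0 = ⊥-elim (<⇒≱ 1≤n n≤0)
odd-part (suc bound) n 1≤n n≤ with odd n | half n
... | true  | h , n≡ = 0 , h , trans n≡ (sym (*-identityˡ _))
... | false | zero , n≡ = ⊥-elim (<⇒≱ 1≤n (≤-reflexive n≡))
... | false | k@(suc _) , n≡ with odd-part bound k (s≤s z≤n)
        (≤-pred (≤-trans (+-monoˡ-≤ k (s≤s z≤n)) (≤-trans (≤-reflexive (sym n≡)) n≤)))
...   | a , h , k≡ = suc a , h , (begin
          n                              ≡⟨ n≡ ⟩
          k + k                          ≡⟨ cong₂ _+_ k≡ k≡ ⟩
          2 ^ a * d + 2 ^ a * d          ≡⟨ solve 2 (λ x d → x :* d :+ x :* d := con 2 :* x :* d) refl (2 ^ a) d ⟩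
          2 * 2 ^ a * d                  ∎)
        where
        open ≡-Reasoning
        d = suc (h + h)

-- An even factor would make the odd product even, and an odd number from 2 on is at least 3.
odd-factor : ∀ {x y h} → x * y ≡ suc (h + h) → 2 ≤ x → ∃ λ i → x ≡ suc (i + i) × 1 ≤ i
odd-factor {x} {y} {h} xy≡ 2≤x with odd x | half x
... | true  | suc i , x≡ = suc i , x≡ , s≤s z≤n
... | true  | zero , refl = ⊥-elim (<-irrefl refl 2≤x)
... | false | k , x≡ = ⊥-elim (even≢odd (k * y) h (begin
        2 * (k * y)       ≡⟨ solve 2 (λ k y → con 2 :* (k :* y) := (k :+ k) :* y) refl k y ⟩
        (k + k) * y       ≡⟨ cong (_* y) x≡ ⟨
        x * y             ≡⟨ xy≡ ⟩
        suc (h + h)       ≡⟨ cong (λ z → suc (h + z)) (+-identityʳ h) ⟨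
        suc (2 * h)       ∎))
      where open ≡-Reasoning

theorem1 : (n : ℕ) → 1 ≤ n → ¬ Σ ℕ (λ k → n ≡ 2 ^ k) → ¬ Prime n →
    Σ (Lines n) (λ ℒ → IsTransitive ℒ × PlayerIWin ℒ)
theorem1 n 1≤n not-power not-prime with odd-part n n 1≤n ≤-refl
... | a , zero , n≡ = ⊥-elim (not-power (a , trans n≡ (*-identityʳ (2 ^ a))))
-- One factor 2 accounts for the two points of an antipodal pair; the remaining power of two is `c`,
-- and the odd part is the number of blocks.
... | suc a , h@(suc _) , refl = subst (λ n → Σ (Lines n) (λ ℒ → IsTransitive ℒ × PlayerIWin ℒ))
        (trans (cong (suc (h + h) *_) (*-comm (2 ^ a) 2)) (*-comm (suc (h + h)) (2 * 2 ^ a)))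
        (EvenStrategy.game h a (suc (h + h)) (2 ^ a) {{m^n≢0 2 a}} refl refl (s≤s z≤n))
... | zero , h@(suc _) , n≡ with composite? n
...   | no not-composite = ⊥-elim (not-prime (prime {{n>1⇒nonTrivial 1<n}} not-composite))
        where
        1<n : 1 < n
        1<n = subst (1 <_) (sym n≡) (s≤s (s≤s z≤n))
...   | yes (composite {d} d<n (divides q refl)) = result
        where
        qd≡ : q * d ≡ suc (h + h)
        qd≡ = trans n≡ (*-identityˡ _)
        2≤q : 2 ≤ q
        -- A cofactor 0 or 1 would contradict that the divisor `d` is smaller than `n`.
        2≤q = ≰⇒> λ { z≤n → n≮0 d<n ; (s≤s z≤n) → <-irrefl (sym (*-identityˡ d)) d<n }
        2≤d : 2 ≤ d
        2≤d = nonTrivial⇒n>1 d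
        result : Σ (Lines (q * d)) (λ ℒ → IsTransitive ℒ × PlayerIWin ℒ)
        result with odd-factor {q} {d} {h} qd≡ 2≤q | odd-factor {d} {q} {h} (trans (*-comm d q) qd≡) 2≤d
        ... | i , refl , 1≤i | j , refl , 1≤j = odd-game (suc i) (suc j) (suc (i + i)) (suc (j + j))
                (cong suc (+-suc i i)) (cong suc (+-suc j j)) (s≤s 1≤i) (s≤s 1≤j)
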